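{- Let $G$ be a $V_5$-free graph with $m\ge 8$ edges. Then \[ \lambda(G)\le \frac{1+\sqrt{4m-3}}{2}, \] and equality holds if and only if $G = K_2\vee \frac{m-1}{2}K_1$ (up to isolated vertices).
   Context: All graphs are finite and simple. $\lambda(G)$ denotes the spectral radius (largest eigenvalue of the adjacency matrix) of $G$. $P_k$ is the path on $k$ vertices, $K_n$ the complete graph, $tK_1$ the edgeless graph on $t$ vertices, and $G\vee H$ the join of $G$ and $H$ (disjoint union plus all edges between $V(G)$ and $V(H)$). The fan graph is $V_k=K_1\vee P_{k-1}$; in particular $V_5=K_1\vee P_4$. A graph is $F$-free if it contains no (not necessarily induced) subgraph isomorphic to $F$. Thus $K_2\vee \frac{m-1}{2}K_1$ (which exists when $m$ is odd) has exactly $m$ edges. -}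

module Defs where

open import Data.Bool.Base using (if_then_else_)
open import Data.Empty using (⊥)
open import Data.Fin.Base using (Fin; toℕ; splitAt)
import Data.Fin.Base as Fin
import Data.Fin.Properties as Fin
open import Data.Integer.Base as ℤ using (ℤ)
open import Data.List.Base using (length; filter; allFin; cartesianProduct)
open import Data.Nat.Base as ℕ using (ℕ; suc; _⊔_; _∸_)
import Data.Nat.Properties as ℕ
open import Data.Product.Base using (Σ; ∃; _×_; _,_)
open import Data.Rational.Base as ℚ
  using (ℚ; 0ℚ; 1ℚ; ½; ∣_∣; 1/_; Positive; positive)
import Data.Rational.Properties as ℚ
open import Data.Rational.Solver using (module +-*-Solver)
open import Data.Sum.Base using (_⊎_; inj₁; inj₂; swap)
open import Data.Unit.Base using (⊤; tt)
open import Data.Vec.Functional using (foldr)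
open import Function.Bundles using (_↔_; _⇔_; Inverse)
open import Function.Definitions using (Injective)
open import Level using (0ℓ)
open import Relation.Binary.Core using (Rel)
open import Relation.Binary.Definitions using (Decidable; Symmetric)
open import Relation.Binary.PropositionalEquality
  using (_≡_; _≢_; refl; sym; trans; cong; subst)
open import Relation.Nullary using (¬_; Dec; yes; no)
open import Relation.Nullary.Decidable using (⌊_⌋; ¬?; _×-dec_; _⊎-dec_)

------------------------------------------------------------------------
-- Real numbers: Cauchy sequences of rationals, compared by the setoid
-- equality _≃_ (difference tends to 0).

record ℝ : Set where
  constructor mkℝ
  field
    seq    : ℕ → ℚ
    cauchy : ∀ ε → 0ℚ ℚ.< ε →
             ∃ λ N → ∀ m n → N ℕ.≤ m → N ℕ.≤ n → ∣ seq m ℚ.- seq n ∣ ℚ.< ε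

open ℝ public

infix 4 _≃_ _≤ℝ_

_≃_ : Rel ℝ 0ℓ
x ≃ y = ∀ ε → 0ℚ ℚ.< ε → ∃ λ N → ∀ n → N ℕ.≤ n → ∣ seq x n ℚ.- seq y n ∣ ℚ.< ε

_≤ℝ_ : Rel ℝ 0ℓ
x ≤ℝ y = ∀ ε → 0ℚ ℚ.< ε → ∃ λ N → ∀ n → N ℕ.≤ n → seq x n ℚ.< seq y n ℚ.+ ε

private open module ℚ-Solver = +-*-Solver using (solve; _:+_; _:*_; _:-_; _:=_; con)

halve : ∀ ε → 0ℚ ℚ.< ε → ∃ λ δ → 0ℚ ℚ.< δ × δ ℚ.+ δ ≡ ε
halve ε 0<ε =
  ½ ℚ.* ε ,
  subst (ℚ._< ½ ℚ.* ε) (ℚ.*-zeroʳ ½) (ℚ.*-monoʳ-<-pos ½ 0<ε) ,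
  solve 1 (λ e → con ½ :* e :+ con ½ :* e := e) refl ε

cancel : ∀ b a → b ≡ (b ℚ.- a) ℚ.+ a
cancel = solve 2 (λ b a → b := (b :- a) :+ a) refl

+-difference : ∀ a b c d → (a ℚ.+ b) ℚ.- (c ℚ.+ d) ≡ (a ℚ.- c) ℚ.+ (b ℚ.- d)
+-difference = solve 4 (λ a b c d → (a :+ b) :- (c :+ d) := (a :- c) :+ (b :- d)) refl

*-difference : ∀ a b c d → a ℚ.* b ℚ.- c ℚ.* d ≡ a ℚ.* (b ℚ.- d) ℚ.+ d ℚ.* (a ℚ.- c)
*-difference = solve 4 (λ a b c d → a :* b :- c :* d := a :* (b :- d) :+ d :* (a :- c)) refl

collect : ∀ B C i ε → B ℚ.* (i ℚ.* ε) ℚ.+ C ℚ.* (i ℚ.* ε) ≡ ((B ℚ.+ C) ℚ.* i) ℚ.* ε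
collect = solve 4 (λ B C i ε → B :* (i :* ε) :+ C :* (i :* ε) := ((B :+ C) :* i) :* ε) refl

divide : ∀ B C ε → .{{Positive B}} → .{{Positive C}} → 0ℚ ℚ.< ε →
         ∃ λ δ → 0ℚ ℚ.< δ × B ℚ.* δ ℚ.+ C ℚ.* δ ≡ ε
divide B C ε 0<ε =
  i ℚ.* ε ,
  subst (ℚ._< i ℚ.* ε) (ℚ.*-zeroʳ i) (ℚ.*-monoʳ-<-pos i 0<ε) ,
  trans (collect B C i ε)
    (trans (cong (ℚ._* ε) (ℚ.*-inverseʳ (B ℚ.+ C))) (ℚ.*-identityˡ ε))
  where
  instance
    B+C-pos : Positive (B ℚ.+ C)
    B+C-pos = ℚ.pos+pos⇒pos B C
    B+C-nonZero : ℚ.NonZero (B ℚ.+ C)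
    B+C-nonZero = ℚ.pos⇒nonZero (B ℚ.+ C)
    1/-pos : Positive (1/ (B ℚ.+ C))
    1/-pos = ℚ.1/pos⇒pos (B ℚ.+ C)
  i : ℚ
  i = 1/ (B ℚ.+ C)

-- Implicit arguments are spelled out: solving for them unfolds ℚ's arithmetic.
∣+∣-< : ∀ p q η ζ → ∣ p ∣ ℚ.< η → ∣ q ∣ ℚ.< ζ → ∣ p ℚ.+ q ∣ ℚ.< η ℚ.+ ζ
∣+∣-< p q η ζ p<η q<ζ =
  ℚ.≤-<-trans {∣ p ℚ.+ q ∣} {∣ p ∣ ℚ.+ ∣ q ∣} {η ℚ.+ ζ}
    (ℚ.∣p+q∣≤∣p∣+∣q∣ p q) (ℚ.+-mono-< {∣ p ∣} {η} {∣ q ∣} {ζ} p<η q<ζ)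

∣*∣-< : ∀ p q B δ → .{{Positive B}} → ∣ p ∣ ℚ.≤ B → ∣ q ∣ ℚ.< δ → ∣ p ℚ.* q ∣ ℚ.< B ℚ.* δ
∣*∣-< p q B δ p≤B q<δ =
  subst (ℚ._< B ℚ.* δ) (sym (ℚ.∣p*q∣≡∣p∣*∣q∣ p q))
    (ℚ.≤-<-trans {∣ p ∣ ℚ.* ∣ q ∣} {B ℚ.* ∣ q ∣} {B ℚ.* δ}
      (ℚ.*-monoʳ-≤-nonNeg ∣ q ∣ {{ℚ.∣-∣-nonNeg q}} {∣ p ∣} {B} p≤B)
      (ℚ.*-monoʳ-<-pos B {∣ q ∣} {δ} q<δ))

+-close : ∀ a b c d η ζ → ∣ a ℚ.- c ∣ ℚ.< η → ∣ b ℚ.- d ∣ ℚ.< ζ →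
          ∣ (a ℚ.+ b) ℚ.- (c ℚ.+ d) ∣ ℚ.< η ℚ.+ ζ
+-close a b c d η ζ ac bd =
  subst (λ z → ∣ z ∣ ℚ.< η ℚ.+ ζ) (sym (+-difference a b c d))
    (∣+∣-< (a ℚ.- c) (b ℚ.- d) η ζ ac bd)

*-close : ∀ a b c d B C δ → .{{Positive B}} → .{{Positive C}} →
          ∣ a ∣ ℚ.≤ B → ∣ d ∣ ℚ.≤ C → ∣ a ℚ.- c ∣ ℚ.< δ → ∣ b ℚ.- d ∣ ℚ.< δ →
          ∣ a ℚ.* b ℚ.- c ℚ.* d ∣ ℚ.< B ℚ.* δ ℚ.+ C ℚ.* δ
*-close a b c d B C δ a≤B d≤C ac bd =
  subst (λ z → ∣ z ∣ ℚ.< B ℚ.* δ ℚ.+ C ℚ.* δ) (sym (*-difference a b c d))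
    (∣+∣-< (a ℚ.* (b ℚ.- d)) (d ℚ.* (a ℚ.- c)) (B ℚ.* δ) (C ℚ.* δ)
      (∣*∣-< a (b ℚ.- d) B δ a≤B bd) (∣*∣-< d (a ℚ.- c) C δ d≤C ac))

⊔-≤ˡ : ∀ a b {n} → a ⊔ b ℕ.≤ n → a ℕ.≤ n
⊔-≤ˡ a b = ℕ.≤-trans (ℕ.m≤m⊔n a b)

⊔-≤ʳ : ∀ a b {n} → a ⊔ b ℕ.≤ n → b ℕ.≤ n
⊔-≤ʳ a b = ℕ.≤-trans (ℕ.m≤n⊔m a b)

eventually-bounded : ∀ x → ∃ λ B → Positive B × ∃ λ N → ∀ n → N ℕ.≤ n → ∣ seq x n ∣ ℚ.≤ B
eventually-bounded x with cauchy x 1ℚ (ℚ.positive⁻¹ 1ℚ)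
... | N , close = B , positive B-pos , N , bound
  where
  a : ℚ
  a = seq x N
  B : ℚ
  B = 1ℚ ℚ.+ ∣ a ∣
  B-pos : 0ℚ ℚ.< B
  B-pos = ℚ.+-mono-<-≤ (ℚ.positive⁻¹ 1ℚ) (ℚ.0≤∣p∣ a)
  bound : ∀ n → N ℕ.≤ n → ∣ seq x n ∣ ℚ.≤ B
  bound n N≤n = begin
    ∣ b ∣                     ≡⟨ cong ∣_∣ (cancel b a) ⟩
    ∣ (b ℚ.- a) ℚ.+ a ∣       ≤⟨ ℚ.∣p+q∣≤∣p∣+∣q∣ (b ℚ.- a) a ⟩
    ∣ b ℚ.- a ∣ ℚ.+ ∣ a ∣     ≤⟨ ℚ.+-monoˡ-≤ ∣ a ∣ (ℚ.<⇒≤ (close n N N≤n ℕ.≤-refl)) ⟩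
    1ℚ ℚ.+ ∣ a ∣              ∎
    where
    open ℚ.≤-Reasoning
    b : ℚ
    b = seq x n

fromℚ : ℚ → ℝ
fromℚ q = mkℝ (λ _ → q) λ ε 0<ε →
  0 , λ _ _ _ _ → subst (λ d → ∣ d ∣ ℚ.< ε) (sym (ℚ.+-inverseʳ q)) 0<ε

fromℤ : ℤ → ℝ
fromℤ z = fromℚ (z ℚ./ 1)

0ℝ 1ℝ ½ℝ : ℝ
0ℝ = fromℚ 0ℚ
1ℝ = fromℚ 1ℚ
½ℝ = fromℚ ½

infixl 6 _+ℝ_
infixl 7 _*ℝ_

_+ℝ_ : ℝ → ℝ → ℝ
x +ℝ y = mkℝ (λ n → seq x n ℚ.+ seq y n) λ ε 0<ε →
  let δ , 0<δ , δ+δ≡ε = halve ε 0<ε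
      M , closeˣ = cauchy x δ 0<δ
      N , closeʸ = cauchy y δ 0<δ
  in M ⊔ N , λ m n p q →
    subst (∣ (seq x m ℚ.+ seq y m) ℚ.- (seq x n ℚ.+ seq y n) ∣ ℚ.<_) δ+δ≡ε
      (+-close (seq x m) (seq y m) (seq x n) (seq y n) δ δ
        (closeˣ m n (⊔-≤ˡ M N p) (⊔-≤ˡ M N q))
        (closeʸ m n (⊔-≤ʳ M N p) (⊔-≤ʳ M N q)))

_*ℝ_ : ℝ → ℝ → ℝ
x *ℝ y = mkℝ (λ n → seq x n ℚ.* seq y n) λ ε 0<ε →
  let B , B-pos , Nᴮ , boundˣ = eventually-bounded x
      C , C-pos , Nᶜ , boundʸ = eventually-bounded y
      δ , 0<δ , Bδ+Cδ≡ε = divide B C ε {{B-pos}} {{C-pos}} 0<ε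
      M , closeˣ = cauchy x δ 0<δ
      N , closeʸ = cauchy y δ 0<δ
  in (Nᴮ ⊔ Nᶜ) ⊔ (M ⊔ N) , λ m n p q →
    let p₁ = ⊔-≤ˡ (Nᴮ ⊔ Nᶜ) (M ⊔ N) p
        p₂ = ⊔-≤ʳ (Nᴮ ⊔ Nᶜ) (M ⊔ N) p
        q₁ = ⊔-≤ˡ (Nᴮ ⊔ Nᶜ) (M ⊔ N) q
        q₂ = ⊔-≤ʳ (Nᴮ ⊔ Nᶜ) (M ⊔ N) q
    in
    subst (∣ seq x m ℚ.* seq y m ℚ.- seq x n ℚ.* seq y n ∣ ℚ.<_) Bδ+Cδ≡ε
      (*-close (seq x m) (seq y m) (seq x n) (seq y n) B C δ {{B-pos}} {{C-pos}}
        (boundˣ m (⊔-≤ˡ Nᴮ Nᶜ p₁)) (boundʸ n (⊔-≤ʳ Nᴮ Nᶜ q₁))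
        (closeˣ m n (⊔-≤ˡ M N p₂) (⊔-≤ˡ M N q₂))
        (closeʸ m n (⊔-≤ʳ M N p₂) (⊔-≤ʳ M N q₂)))

_IsSqrtOf_ : ℝ → ℝ → Set
s IsSqrtOf a = 0ℝ ≤ℝ s × s *ℝ s ≃ a

------------------------------------------------------------------------
-- Finite simple graphs

record Graph : Set₁ where
  field
    order    : ℕ
    Adj      : Rel (Fin order) 0ℓ
    adj?     : Decidable Adj
    adj-sym  : Symmetric Adj
    loopless : ∀ {i} → ¬ Adj i i

open Graph public

size : Graph → ℕ
size G = length (filter (λ (i , j) → (i Fin.<? j) ×-dec adj? G i j)
                        (cartesianProduct (allFin (order G)) (allFin (order G))))

K : ℕ → Graph
K n = record
  { order    = n
  ; Adj      = _≢_
  ; adj?     = λ i j → ¬? (i Fin.≟ j)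
  ; adj-sym  = λ i≢j j≡i → i≢j (sym j≡i)
  ; loopless = λ i≢i → i≢i refl
  }

edgeless : ℕ → Graph
edgeless n = record
  { order    = n
  ; Adj      = λ _ _ → ⊥
  ; adj?     = λ _ _ → no λ ()
  ; adj-sym  = λ ()
  ; loopless = λ ()
  }

P : ℕ → Graph
P k = record
  { order    = k
  ; Adj      = λ i j → toℕ j ≡ suc (toℕ i) ⊎ toℕ i ≡ suc (toℕ j)
  ; adj?     = λ i j → (toℕ j ℕ.≟ suc (toℕ i)) ⊎-dec (toℕ i ℕ.≟ suc (toℕ j))
  ; adj-sym  = swap
  ; loopless = λ { (inj₁ eq) → ℕ.1+n≢n (sym eq) ; (inj₂ eq) → ℕ.1+n≢n (sym eq) }
  }

-- A graph on the disjoint union of V(G) and V(H) that restricts to G and to H,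
-- with every cross pair adjacent (C = ⊤) or none (C = ⊥).
module Glue (G H : Graph) (C : Set) (C? : Dec C) where

  GlueAdj : Rel (Fin (order G) ⊎ Fin (order H)) 0ℓ
  GlueAdj (inj₁ i) (inj₁ j) = Adj G i j
  GlueAdj (inj₁ _) (inj₂ _) = C
  GlueAdj (inj₂ _) (inj₁ _) = C
  GlueAdj (inj₂ i) (inj₂ j) = Adj H i j

  glueAdj? : Decidable GlueAdj
  glueAdj? (inj₁ i) (inj₁ j) = adj? G i j
  glueAdj? (inj₁ _) (inj₂ _) = C?
  glueAdj? (inj₂ _) (inj₁ _) = C?
  glueAdj? (inj₂ i) (inj₂ j) = adj? H i j

  glue-sym : ∀ u v → GlueAdj u v → GlueAdj v u
  glue-sym (inj₁ _) (inj₁ _) e = adj-sym G e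
  glue-sym (inj₁ _) (inj₂ _) c = c
  glue-sym (inj₂ _) (inj₁ _) c = c
  glue-sym (inj₂ _) (inj₂ _) e = adj-sym H e

  glue-loopless : ∀ u → ¬ GlueAdj u u
  glue-loopless (inj₁ _) = loopless G
  glue-loopless (inj₂ _) = loopless H

  glue : Graph
  glue = record
    { order    = order G ℕ.+ order H
    ; Adj      = λ i j → GlueAdj (splitAt (order G) i) (splitAt (order G) j)
    ; adj?     = λ i j → glueAdj? (splitAt (order G) i) (splitAt (order G) j)
    ; adj-sym  = λ {i} {j} → glue-sym (splitAt (order G) i) (splitAt (order G) j)
    ; loopless = λ {i} → glue-loopless (splitAt (order G) i)
    }

infixr 6 _∨_ _∪_

_∨_ : Graph → Graph → Graph
G ∨ H = Glue.glue G H ⊤ (yes tt)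

_∪_ : Graph → Graph → Graph
G ∪ H = Glue.glue G H ⊥ (no λ ())

-- The fan on k ≥ 1 vertices.
V : ℕ → Graph
V k = K 1 ∨ P (k ∸ 1)

infix 4 _≅_ _⊑_

_≅_ : Graph → Graph → Set
G ≅ H = Σ (Fin (order G) ↔ Fin (order H)) λ f →
        ∀ i j → Adj G i j ⇔ Adj H (Inverse.to f i) (Inverse.to f j)

-- F is isomorphic to a (not necessarily induced) subgraph of G.
_⊑_ : Graph → Graph → Set
F ⊑ G = Σ (Fin (order F) → Fin (order G)) λ f →
        Injective _≡_ _≡_ f × (∀ i j → Adj F i j → Adj G (f i) (f j))

_-free : Graph → Graph → Set
(F -free) G = ¬ (F ⊑ G)

_≅_upToIsolatedVertices : Graph → Graph → Set
G ≅ H upToIsolatedVertices = ∃ λ a → ∃ λ b → G ∪ edgeless a ≅ H ∪ edgeless b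

------------------------------------------------------------------------
-- Spectral radius

adjacencyMatrix : (G : Graph) → Fin (order G) → Fin (order G) → ℝ
adjacencyMatrix G i j = if ⌊ adj? G i j ⌋ then 1ℝ else 0ℝ

∑ : ∀ {n} → (Fin n → ℝ) → ℝ
∑ = foldr _+ℝ_ 0ℝ

IsEigenvalue : ∀ {n} → (Fin n → Fin n → ℝ) → ℝ → Set
IsEigenvalue {n} A μ = Σ (Fin n → ℝ) λ x →
  ¬ (∀ i → x i ≃ 0ℝ) × (∀ i → ∑ (λ j → A i j *ℝ x j) ≃ μ *ℝ x i)

IsSpectralRadius : Graph → ℝ → Set
IsSpectralRadius G ρ =
  IsEigenvalue (adjacencyMatrix G) ρ ×
  (∀ μ → IsEigenvalue (adjacencyMatrix G) μ → μ ≤ℝ ρ)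

{-# OPTIONS --safe #-}

-- Let y be the modulus of an eigenvector for L, so that A y ≥ L y pointwise, and let y be largest at u, with value M.
-- Then (A² - A) y ≥ (L² - L) y at u.  Writing the left side as a sum over walks of length two and bounding y by M
-- expresses 2 M as a sum of nonnegative local terms when L² - L ≥ m - 1.  The neighbourhood of u contains no P₄, so its
-- components are stars, triangles and isolated vertices.  One star already contributes 2 M, every other term vanishes,
-- and this forces K₂ ∨ tK₁.  If there is no star, the eigenvalue inequality summed over the triangle vertices, together
-- with the fact that a vertex outside meets each triangle at most once, contradicts L² - L ≥ m - 1 ≥ 7.
-- The order of the Cauchy reals is total only up to ¬¬, but ≤ and the graph-theoretic conclusions are ¬¬-stable, so a
-- maximal vertex and the signs of the entries may be chosen.

module Submission where

open import Defs
open import Algebra.Bundles using (CommutativeRing; RawRing)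
import Algebra.Properties.Ring as RingProperties
import Algebra.Properties.Semiring.Mult as SemiringMult
import Algebra.Properties.Semiring.Sum as SemiringSum
import Algebra.Solver.Ring as RingSolver
open import Algebra.Solver.Ring.AlmostCommutativeRing using (fromCommutativeRing; _-Raw-AlmostCommutative⟶_)
open import Data.Bool.Base using (true; false; if_then_else_)
open import Data.Empty using (⊥; ⊥-elim)
open import Data.Fin.Base as Fin using (Fin; zero; suc; toℕ; splitAt; join; _↑ˡ_)
import Data.Fin.Properties as Fin
open import Data.Integer.Base as ℤ using (ℤ)
import Data.Integer.Properties as ℤ
import Data.Integer.Solver as ℤ-Solver
open import Data.List.Base as List using (_∷_; length; filter; tabulate; map; cartesianProduct)
import Data.List.Properties as List
open import Data.Maybe.Base using (Maybe; just; nothing; maybe)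
open import Data.Nat.Base as ℕ using (ℕ; zero; suc; z≤n; s≤s; _⊔_)
import Data.Nat.Properties as ℕ
import Data.Nat.Solver as ℕ-Solver
open import Data.Product.Base using (∃; _×_; _,_; proj₁; proj₂)
open import Data.Rational.Base as ℚ using (ℚ; 0ℚ; 1ℚ; ½; ∣_∣)
import Data.Rational.Properties as ℚ
import Data.Rational.Solver as ℚ-Solver
import Data.Rational.Unnormalised.Base as ℚᵘ
import Data.Rational.Unnormalised.Properties as ℚᵘ
open import Data.Sum.Base as Sum using (_⊎_; inj₁; inj₂)
import Data.Sum.Properties as Sum
open import Data.Unit.Base using (⊤; tt)
open import Data.Vec.Base as Vec using (Vec; []; _∷_)
open import Data.Vec.Relation.Unary.All using ([]; _∷_)
open import Data.Vec.Relation.Unary.AllPairs using ([]; _∷_)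
open import Data.Vec.Relation.Unary.Unique.Propositional using (Unique)
open import Data.Vec.Relation.Unary.Unique.Propositional.Properties using (lookup-injective)
open import Function.Base using (id; _∘_; case_of_)
open import Function.Bundles using (_⇔_; Inverse; Equivalence; mk⇔; mk↔ₛ′)
open import Level using (0ℓ)
open import Relation.Binary.Core using (Rel)
open import Relation.Binary.Definitions using (tri<; tri≈; tri>)
import Relation.Binary.PropositionalEquality as ≡
import Relation.Binary.Reasoning.Setoid as SetoidReasoning
open import Relation.Binary.PropositionalEquality using (_≡_; _≢_)
open import Relation.Nullary using (¬_; Dec; yes; no; does; contradiction)
open import Relation.Nullary.Decidable using (⌊_⌋; map′; _×-dec_; _⊎-dec_; _→-dec_; ¬?; decidable-stable; dec-true; dec-false)
open import Relation.Unary using (Pred; Decidable)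

-- The analysis is run with L = ρ, assuming that ρ is at least the root r of r² - r + 1 = m. It
-- returns both the extremal structure and ρ² - ρ + 1 ≤ m. If ρ > r, the inequality is
-- contradictory; if ρ = r, the structure is what remains. The obstacle is K₄. A triangle in the
-- neighbourhood of u whose vertices all have weight M adds nothing to the local terms, so counting
-- walks alone does not exclude it. Nor may it be excluded for every m: K₄ with a pendant edge has 7
-- edges, contains no V₅, and has spectral radius above 3 = (1 + √25)/2. The triangle case therefore
-- has to use m ≥ 8, which enters as L² - L ≥ 7, that is L > 3.19. The tightest configuration is a
-- single triangle with a single edge to the vertices outside the closed neighbourhood. It needs 3L²
-- - 8L - 5 > 0, and at L² - L = 7 this quantity is still below 0.04.

-- The order is classical only up to ¬¬, which is what the Cauchy reals satisfy constructively.
record OrderedRing : Set₁ where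
  infix 4 _≤_ _<_
  field
    commutativeRing : CommutativeRing 0ℓ 0ℓ
  open CommutativeRing commutativeRing public
  field
    _≤_         : Rel Carrier 0ℓ
    ≤-reflexive : ∀ {x y} → x ≈ y → x ≤ y
    ≤-trans     : ∀ {x y z} → x ≤ y → y ≤ z → x ≤ z
    ≤-antisym   : ∀ {x y} → x ≤ y → y ≤ x → x ≈ y
    ≤-stable    : ∀ {x y} → ¬ ¬ (x ≤ y) → x ≤ y
    ≤-total     : ∀ x y → ¬ ¬ (x ≤ y ⊎ y ≤ x)
    +-monoˡ-≤   : ∀ z {x y} → x ≤ y → x + z ≤ y + z
  _<_ : Rel Carrier 0ℓ
  x < y = ¬ (y ≤ x)
  field
    *-pos : ∀ {x y} → 0# < x → 0# < y → 0# < x * y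
    0<1   : 0# < 1#

-- The Cauchy reals as an ordered commutative ring

module RealOrder where

  open ≡ using (refl; sym; trans; cong; subst; subst₂)

  module _ where
    open ℚ-Solver.+-*-Solver

    ℚ-<-by-difference : ∀ {a b c d} → b ℚ.- a ≡ d ℚ.- c → a ℚ.< b → c ℚ.< d
    ℚ-<-by-difference {a} {b} {c} {d} eq a<b = subst₂ ℚ._<_ (lhs a c) rhs (ℚ.+-monoˡ-< (c ℚ.- a) a<b)
      where
      lhs : ∀ a c → a ℚ.+ (c ℚ.- a) ≡ c
      lhs = solve 2 (λ a c → a :+ (c :- a) := c) refl
      shift : ∀ a b c → b ℚ.+ (c ℚ.- a) ≡ (b ℚ.- a) ℚ.+ c
      shift = solve 3 (λ a b c → b :+ (c :- a) := (b :- a) :+ c) refl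
      rhs : b ℚ.+ (c ℚ.- a) ≡ d
      rhs = trans (shift a b c) (trans (cong (ℚ._+ c) eq) (sym (cancel d c)))

    ∣-∣<⇒<+ : ∀ a b ε → ∣ a ℚ.- b ∣ ℚ.< ε → a ℚ.< b ℚ.+ ε
    ∣-∣<⇒<+ a b ε p = ℚ-<-by-difference (eq a b ε) (ℚ.≤-<-trans (p≤∣p∣ (a ℚ.- b)) p)
      where
      eq : ∀ a b ε → ε ℚ.- (a ℚ.- b) ≡ (b ℚ.+ ε) ℚ.- a
      eq = solve 3 (λ a b ε → ε :- (a :- b) := (b :+ ε) :- a) refl
      p≤∣p∣ : ∀ p → p ℚ.≤ ∣ p ∣
      p≤∣p∣ p with ℚ.≤-total 0ℚ p
      ... | inj₁ 0≤p = ℚ.≤-reflexive (sym (ℚ.0≤p⇒∣p∣≡p 0≤p))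
      ... | inj₂ p≤0 = ℚ.≤-trans p≤0 (ℚ.0≤∣p∣ p)

    <+⇒∣-∣< : ∀ a b ε → a ℚ.< b ℚ.+ ε → b ℚ.< a ℚ.+ ε → ∣ a ℚ.- b ∣ ℚ.< ε
    <+⇒∣-∣< a b ε p q with ℚ.∣p∣≡p∨∣p∣≡-p (a ℚ.- b)
    ... | inj₁ eq = subst (ℚ._< ε) (sym eq) (ℚ-<-by-difference (e a b ε) p)
      where
      e : ∀ a b ε → (b ℚ.+ ε) ℚ.- a ≡ ε ℚ.- (a ℚ.- b)
      e = solve 3 (λ a b ε → (b :+ ε) :- a := ε :- (a :- b)) refl
    ... | inj₂ eq = subst (ℚ._< ε) (sym eq) (ℚ-<-by-difference (e a b ε) q)
      where
      e : ∀ a b ε → (a ℚ.+ ε) ℚ.- b ≡ ε ℚ.- (ℚ.- (a ℚ.- b))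
      e = solve 3 (λ a b ε → (a :+ ε) :- b := ε :- (:- (a :- b))) refl

    ∣-∣-sym : ∀ a b → ∣ a ℚ.- b ∣ ≡ ∣ b ℚ.- a ∣
    ∣-∣-sym a b = trans (sym (ℚ.∣-p∣≡∣p∣ (a ℚ.- b))) (cong ∣_∣ (e a b))
      where
      e : ∀ a b → ℚ.- (a ℚ.- b) ≡ b ℚ.- a
      e = solve 2 (λ a b → :- (a :- b) := b :- a) refl

    p<p+ε : ∀ p ε → 0ℚ ℚ.< ε → p ℚ.< p ℚ.+ ε
    p<p+ε p ε = ℚ-<-by-difference (e p ε)
      where
      e : ∀ p ε → ε ℚ.- 0ℚ ≡ (p ℚ.+ ε) ℚ.- p
      e = solve 2 (λ p ε → ε :- con 0ℚ := (p :+ ε) :- p) refl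

    <-+-chain : ∀ a b c δ ζ → a ℚ.< b ℚ.+ δ → b ℚ.< c ℚ.+ ζ → a ℚ.< c ℚ.+ (δ ℚ.+ ζ)
    <-+-chain a b c δ ζ p q = ℚ.<-trans p (ℚ-<-by-difference (e b c δ ζ) q)
      where
      e : ∀ b c δ ζ → (c ℚ.+ ζ) ℚ.- b ≡ (c ℚ.+ (δ ℚ.+ ζ)) ℚ.- (b ℚ.+ δ)
      e = solve 4 (λ b c δ ζ → (c :+ ζ) :- b := (c :+ (δ :+ ζ)) :- (b :+ δ)) refl

  ≤ℝ-trans : ∀ x y z → x ≤ℝ y → y ≤ℝ z → x ≤ℝ z
  ≤ℝ-trans x y z p q ε 0<ε =
    let δ , 0<δ , eq = halve ε 0<ε
        M , f = p δ 0<δ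
        N , g = q δ 0<δ
    in M ⊔ N , λ n k → subst (λ e → seq x n ℚ.< seq z n ℚ.+ e) eq
         (<-+-chain (seq x n) (seq y n) (seq z n) δ δ (f n (⊔-≤ˡ M N k)) (g n (⊔-≤ʳ M N k)))

  ≃⇒≤ℝ : ∀ x y → x ≃ y → x ≤ℝ y
  ≃⇒≤ℝ x y p ε 0<ε = let N , f = p ε 0<ε in N , λ n k → ∣-∣<⇒<+ (seq x n) (seq y n) ε (f n k)

  ≃-symmetric : ∀ x y → x ≃ y → y ≃ x
  ≃-symmetric x y p ε 0<ε = let N , f = p ε 0<ε in
    N , λ n k → subst (ℚ._< ε) (∣-∣-sym (seq x n) (seq y n)) (f n k)

  ≤ℝ-antisymmetric : ∀ x y → x ≤ℝ y → y ≤ℝ x → x ≃ y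
  ≤ℝ-antisymmetric x y p q ε 0<ε =
    let M , f = p ε 0<ε
        N , g = q ε 0<ε
    in M ⊔ N , λ n k → <+⇒∣-∣< (seq x n) (seq y n) ε (f n (⊔-≤ˡ M N k)) (g n (⊔-≤ʳ M N k))

  ≃-transitive : ∀ x y z → x ≃ y → y ≃ z → x ≃ z
  ≃-transitive x y z p q = ≤ℝ-antisymmetric x z
    (≤ℝ-trans x y z (≃⇒≤ℝ x y p) (≃⇒≤ℝ y z q))
    (≤ℝ-trans z y x (≃⇒≤ℝ z y (≃-symmetric y z q)) (≃⇒≤ℝ y x (≃-symmetric x y p)))

  pointwise⇒≃ : ∀ x y → (∀ n → seq x n ≡ seq y n) → x ≃ y
  pointwise⇒≃ x y eq ε 0<ε = 0 , λ n _ →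
    subst (λ d → ∣ d ∣ ℚ.< ε)
      (sym (trans (cong (ℚ._- seq y n) (eq n)) (ℚ.+-inverseʳ (seq y n)))) 0<ε

  infix 4 _⋖_

  -- x ≤ℝ y is equivalent to ¬ (y ⋖ x).
  _⋖_ : Rel ℝ 0ℓ
  x ⋖ y = ∃ λ ε → 0ℚ ℚ.< ε × ∃ λ N → ∀ n → N ℕ.≤ n → seq x n ℚ.+ ε ℚ.< seq y n

  ⋖⇒≤ℝ : ∀ x y → x ⋖ y → x ≤ℝ y
  ⋖⇒≤ℝ x y (δ , 0<δ , N , f) ε 0<ε = N , λ n k →
    ℚ.<-trans (p<p+ε (seq x n) δ 0<δ) (ℚ.<-trans (f n k) (p<p+ε (seq y n) ε 0<ε))

  ⋖⇒≰ℝ : ∀ x y → x ⋖ y → ¬ (y ≤ℝ x)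
  ⋖⇒≰ℝ x y (ε , 0<ε , N , f) p =
    let M , g = p ε 0<ε
    in ℚ.<-asym (f (M ⊔ N) (ℕ.m≤n⊔m M N)) (g (M ⊔ N) (ℕ.m≤m⊔n M N))

  -- Beyond `N` both sequences vary by less than δ = ε / 8, so one decidable comparison of rationals
  -- at index `N`, with margin 3δ, settles all later indices: either x stays below y + 5δ, or x
  -- stays above y by δ, which is the excluded `y ⋖ x`.
  ¬⋖⇒≤ℝ : ∀ x y → ¬ (y ⋖ x) → x ≤ℝ y
  ¬⋖⇒≤ℝ x y ¬y⋖x ε 0<ε = case
    where
    open ℚ-Solver.+-*-Solver
    η ζ δ : ℚ
    η = proj₁ (halve ε 0<ε)
    0<η : 0ℚ ℚ.< η
    0<η = proj₁ (proj₂ (halve ε 0<ε))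
    ζ = proj₁ (halve η 0<η)
    0<ζ : 0ℚ ℚ.< ζ
    0<ζ = proj₁ (proj₂ (halve η 0<η))
    δ = proj₁ (halve ζ 0<ζ)
    0<δ : 0ℚ ℚ.< δ
    0<δ = proj₁ (proj₂ (halve ζ 0<ζ))
    8δ : ε ≡ ((δ ℚ.+ δ) ℚ.+ (δ ℚ.+ δ)) ℚ.+ ((δ ℚ.+ δ) ℚ.+ (δ ℚ.+ δ))
    8δ = sym (trans (cong (λ z → (z ℚ.+ z) ℚ.+ (z ℚ.+ z)) (proj₂ (proj₂ (halve ζ 0<ζ))))
             (trans (cong (λ z → z ℚ.+ z) (proj₂ (proj₂ (halve η 0<η)))) (proj₂ (proj₂ (halve ε 0<ε)))))
    Nˣ Nʸ N : ℕ
    Nˣ = proj₁ (cauchy x δ 0<δ)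
    Nʸ = proj₁ (cauchy y δ 0<δ)
    N  = Nˣ ⊔ Nʸ
    closeˣ : ∀ m n → N ℕ.≤ m → N ℕ.≤ n → seq x m ℚ.< seq x n ℚ.+ δ
    closeˣ m n p q = ∣-∣<⇒<+ (seq x m) (seq x n) δ (proj₂ (cauchy x δ 0<δ) m n (⊔-≤ˡ Nˣ Nʸ p) (⊔-≤ˡ Nˣ Nʸ q))
    closeʸ : ∀ m n → N ℕ.≤ m → N ℕ.≤ n → seq y m ℚ.< seq y n ℚ.+ δ
    closeʸ m n p q = ∣-∣<⇒<+ (seq y m) (seq y n) δ (proj₂ (cauchy y δ 0<δ) m n (⊔-≤ʳ Nˣ Nʸ p) (⊔-≤ʳ Nˣ Nʸ q))
    3δ : ℚ
    3δ = δ ℚ.+ (δ ℚ.+ δ)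
    case : ∃ λ N → ∀ n → N ℕ.≤ n → seq x n ℚ.< seq y n ℚ.+ ε
    case with seq x N ℚ.<? seq y N ℚ.+ 3δ
    ... | yes p = N , λ n k →
      let step₁ = <-+-chain (seq x n) (seq x N) (seq y N) δ 3δ (closeˣ n N k ℕ.≤-refl) p
          step₂ = <-+-chain (seq x n) (seq y N) (seq y n) (δ ℚ.+ 3δ) δ step₁ (closeʸ N n ℕ.≤-refl k)
          -- The error so far is 5δ; another 3δ pads it to ε = 8δ.
          step₃ = <-+-chain (seq x n) (seq y n) (seq y n) ((δ ℚ.+ 3δ) ℚ.+ δ) 3δ step₂
                    (p<p+ε (seq y n) 3δ (ℚ.+-mono-< 0<δ (ℚ.+-mono-< 0<δ 0<δ)))
      in subst (λ e → seq x n ℚ.< seq y n ℚ.+ e) (trans (e δ) (sym 8δ)) step₃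
      where
      e : ∀ δ → ((δ ℚ.+ (δ ℚ.+ (δ ℚ.+ δ))) ℚ.+ δ) ℚ.+ (δ ℚ.+ (δ ℚ.+ δ))
              ≡ ((δ ℚ.+ δ) ℚ.+ (δ ℚ.+ δ)) ℚ.+ ((δ ℚ.+ δ) ℚ.+ (δ ℚ.+ δ))
      e = solve 1 (λ δ → ((δ :+ (δ :+ (δ :+ δ))) :+ δ) :+ (δ :+ (δ :+ δ))
                      := ((δ :+ δ) :+ (δ :+ δ)) :+ ((δ :+ δ) :+ (δ :+ δ))) refl
    ... | no p = contradiction (δ , 0<δ , N , λ n k → gap n k) ¬y⋖x
      where
      e₁ : ∀ a b δ → (a ℚ.+ δ) ℚ.- b ≡ (a ℚ.+ (δ ℚ.+ δ)) ℚ.- (b ℚ.+ δ)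
      e₁ = solve 3 (λ a b δ → (a :+ δ) :- b := (a :+ (δ :+ δ)) :- (b :+ δ)) refl
      e₂ : ∀ a δ → (a ℚ.+ (δ ℚ.+ (δ ℚ.+ δ))) ℚ.- δ ≡ a ℚ.+ (δ ℚ.+ δ)
      e₂ = solve 2 (λ a δ → (a :+ (δ :+ (δ :+ δ))) :- δ := a :+ (δ :+ δ)) refl
      e₃ : ∀ a δ → (a ℚ.+ δ) ℚ.- δ ≡ a
      e₃ = solve 2 (λ a δ → (a :+ δ) :- δ := a) refl
      gap : ∀ n → N ℕ.≤ n → seq y n ℚ.+ δ ℚ.< seq x n
      gap n k = ℚ.<-trans
        (ℚ-<-by-difference (e₁ (seq y N) (seq y n) δ) (closeʸ n N k ℕ.≤-refl))
        (subst₂ ℚ._<_ (e₂ (seq y N) δ) (e₃ (seq x n) δ)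
          (ℚ.+-monoˡ-< (ℚ.- δ) (ℚ.≤-<-trans (ℚ.≮⇒≥ p) (closeˣ N n ℕ.≤-refl k))))

  ≤ℝ-stable : ∀ x y → ¬ ¬ (x ≤ℝ y) → x ≤ℝ y
  ≤ℝ-stable x y ¬¬p = ¬⋖⇒≤ℝ x y (λ y⋖x → ¬¬p (⋖⇒≰ℝ y x y⋖x))

  -- Refuting `y ≤ℝ x` refutes `y ⋖ x`, and that is all `x ≤ℝ y` requires.
  ≤ℝ-total : ∀ x y → ¬ ¬ (x ≤ℝ y ⊎ y ≤ℝ x)
  ≤ℝ-total x y k = k (inj₁ (¬⋖⇒≤ℝ x y (λ y⋖x → k (inj₂ (⋖⇒≤ℝ y x y⋖x)))))

  +ℝ-cong : ∀ x y u v → x ≃ y → u ≃ v → x +ℝ u ≃ y +ℝ v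
  +ℝ-cong x y u v p q ε 0<ε =
    let δ , 0<δ , eq = halve ε 0<ε
        M , f = p δ 0<δ
        N , g = q δ 0<δ
    in M ⊔ N , λ n k → subst (∣ (seq x n ℚ.+ seq u n) ℚ.- (seq y n ℚ.+ seq v n) ∣ ℚ.<_) eq
         (+-close (seq x n) (seq u n) (seq y n) (seq v n) δ δ (f n (⊔-≤ˡ M N k)) (g n (⊔-≤ʳ M N k)))

  *ℝ-cong : ∀ x y u v → x ≃ y → u ≃ v → x *ℝ u ≃ y *ℝ v
  *ℝ-cong x y u v p q ε 0<ε =
    let B , B-pos , Nᴮ , boundˣ = eventually-bounded x
        C , C-pos , Nᶜ , boundᵛ = eventually-bounded v
        δ , 0<δ , eq = divide B C ε {{B-pos}} {{C-pos}} 0<ε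
        M , f = p δ 0<δ
        N , g = q δ 0<δ
    in (Nᴮ ⊔ Nᶜ) ⊔ (M ⊔ N) , λ n k →
      let k₁ = ⊔-≤ˡ (Nᴮ ⊔ Nᶜ) (M ⊔ N) k
          k₂ = ⊔-≤ʳ (Nᴮ ⊔ Nᶜ) (M ⊔ N) k
      in subst (∣ seq x n ℚ.* seq u n ℚ.- seq y n ℚ.* seq v n ∣ ℚ.<_) eq
           (*-close (seq x n) (seq u n) (seq y n) (seq v n) B C δ {{B-pos}} {{C-pos}}
             (boundˣ n (⊔-≤ˡ Nᴮ Nᶜ k₁)) (boundᵛ n (⊔-≤ʳ Nᴮ Nᶜ k₁))
             (f n (⊔-≤ˡ M N k₂)) (g n (⊔-≤ʳ M N k₂)))

  ∣-∣-neg : ∀ a b → ∣ a ℚ.- b ∣ ≡ ∣ (ℚ.- a) ℚ.- (ℚ.- b) ∣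
  ∣-∣-neg a b = trans (∣-∣-sym a b) (cong ∣_∣ (solve 2 (λ a b → b :- a := (:- a) :- (:- b)) refl a b))
    where open ℚ-Solver.+-*-Solver

  -ℝ_ : ℝ → ℝ
  -ℝ x = mkℝ (λ n → ℚ.- seq x n) λ ε 0<ε →
    let N , close = cauchy x ε 0<ε
    in N , λ m n p q → subst (ℚ._< ε) (∣-∣-neg (seq x m) (seq x n)) (close m n p q)

  -ℝ-cong : ∀ x y → x ≃ y → -ℝ x ≃ -ℝ y
  -ℝ-cong x y p ε 0<ε =
    let N , f = p ε 0<ε
    in N , λ n k → subst (ℚ._< ε) (∣-∣-neg (seq x n) (seq y n)) (f n k)

  +ℝ-monoˡ-≤ℝ : ∀ z x y → x ≤ℝ y → x +ℝ z ≤ℝ y +ℝ z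
  +ℝ-monoˡ-≤ℝ z x y p ε 0<ε =
    let N , f = p ε 0<ε
    in N , λ n k → ℚ-<-by-difference (e (seq x n) (seq y n) (seq z n) ε) (f n k)
    where
    open ℚ-Solver.+-*-Solver
    e : ∀ a b c ε → (b ℚ.+ ε) ℚ.- a ≡ ((b ℚ.+ c) ℚ.+ ε) ℚ.- (a ℚ.+ c)
    e = solve 4 (λ a b c ε → (b :+ ε) :- a := ((b :+ c) :+ ε) :- (a :+ c)) refl

  0⋖-* : ∀ x y → 0ℝ ⋖ x → 0ℝ ⋖ y → 0ℝ ⋖ x *ℝ y
  0⋖-* x y (δ , 0<δ , M , f) (ζ , 0<ζ , N , g) =
    δ ℚ.* ζ ,
    subst (ℚ._< δ ℚ.* ζ) (ℚ.*-zeroʳ δ) (ℚ.*-monoʳ-<-pos δ {{ℚ.positive 0<δ}} 0<ζ) ,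
    M ⊔ N , λ n k →
      subst (ℚ._< seq x n ℚ.* seq y n) (sym (ℚ.+-identityˡ (δ ℚ.* ζ)))
        (product (seq x n) (seq y n)
          (subst (ℚ._< seq x n) (ℚ.+-identityˡ δ) (f n (⊔-≤ˡ M N k)))
          (subst (ℚ._< seq y n) (ℚ.+-identityˡ ζ) (g n (⊔-≤ʳ M N k))))
    where
    product : ∀ a b → δ ℚ.< a → ζ ℚ.< b → δ ℚ.* ζ ℚ.< a ℚ.* b
    product a b δ<a ζ<b = ℚ.<-trans
      (ℚ.*-monoʳ-<-pos δ {{ℚ.positive 0<δ}} ζ<b)
      (ℚ.*-monoˡ-<-pos b {{ℚ.positive (ℚ.<-trans 0<ζ ζ<b)}} δ<a)

  ℝ-commutativeRing : CommutativeRing 0ℓ 0ℓ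
  ℝ-commutativeRing = record
    { Carrier = ℝ
    ; _≈_ = _≃_
    ; _+_ = _+ℝ_
    ; _*_ = _*ℝ_
    ; -_  = -ℝ_
    ; 0#  = 0ℝ
    ; 1#  = 1ℝ
    ; isCommutativeRing = record
      { isRing = record
        { +-isAbelianGroup = record
          { isGroup = record
            { isMonoid = record
              { isSemigroup = record
                { isMagma = record
                  { isEquivalence = record
                    { refl  = λ {x} → pointwise⇒≃ x x (λ _ → refl)
                    ; sym   = λ {x} {y} → ≃-symmetric x y
                    ; trans = λ {x} {y} {z} → ≃-transitive x y z
                    }
                  ; ∙-cong = λ {x} {y} {u} {v} → +ℝ-cong x y u v
                  }
                ; assoc = λ x y z → pointwise⇒≃ ((x +ℝ y) +ℝ z) (x +ℝ (y +ℝ z)) (λ n → ℚ.+-assoc (seq x n) (seq y n) (seq z n))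
                }
              ; identity = (λ x → pointwise⇒≃ (0ℝ +ℝ x) x (λ n → ℚ.+-identityˡ (seq x n)))
                         , (λ x → pointwise⇒≃ (x +ℝ 0ℝ) x (λ n → ℚ.+-identityʳ (seq x n)))
              }
            ; inverse = (λ x → pointwise⇒≃ ((-ℝ x) +ℝ x) 0ℝ (λ n → ℚ.+-inverseˡ (seq x n)))
                      , (λ x → pointwise⇒≃ (x +ℝ (-ℝ x)) 0ℝ (λ n → ℚ.+-inverseʳ (seq x n)))
            ; ⁻¹-cong = λ {x} {y} → -ℝ-cong x y
            }
          ; comm = λ x y → pointwise⇒≃ (x +ℝ y) (y +ℝ x) (λ n → ℚ.+-comm (seq x n) (seq y n))
          }
        ; *-cong = λ {x} {y} {u} {v} → *ℝ-cong x y u v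
        ; *-assoc = λ x y z → pointwise⇒≃ ((x *ℝ y) *ℝ z) (x *ℝ (y *ℝ z)) (λ n → ℚ.*-assoc (seq x n) (seq y n) (seq z n))
        ; *-identity = (λ x → pointwise⇒≃ (1ℝ *ℝ x) x (λ n → ℚ.*-identityˡ (seq x n)))
                     , (λ x → pointwise⇒≃ (x *ℝ 1ℝ) x (λ n → ℚ.*-identityʳ (seq x n)))
        ; distrib = (λ x y z → pointwise⇒≃ (x *ℝ (y +ℝ z)) ((x *ℝ y) +ℝ (x *ℝ z)) (λ n → ℚ.*-distribˡ-+ (seq x n) (seq y n) (seq z n)))
                  , (λ x y z → pointwise⇒≃ ((y +ℝ z) *ℝ x) ((y *ℝ x) +ℝ (z *ℝ x)) (λ n → ℚ.*-distribʳ-+ (seq x n) (seq y n) (seq z n)))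
        }
      ; *-comm = λ x y → pointwise⇒≃ (x *ℝ y) (y *ℝ x) (λ n → ℚ.*-comm (seq x n) (seq y n))
      }
    }

  ℝ-orderedRing : OrderedRing
  ℝ-orderedRing = record
    { commutativeRing = ℝ-commutativeRing
    ; _≤_         = _≤ℝ_
    ; ≤-reflexive = λ {x} {y} → ≃⇒≤ℝ x y
    ; ≤-trans     = λ {x} {y} {z} → ≤ℝ-trans x y z
    ; ≤-antisym   = λ {x} {y} → ≤ℝ-antisymmetric x y
    ; ≤-stable    = λ {x} {y} → ≤ℝ-stable x y
    ; ≤-total     = ≤ℝ-total
    ; +-monoˡ-≤   = λ z {x} {y} → +ℝ-monoˡ-≤ℝ z x y
    -- Strict positivity here is only a negation. The goal is ⊥, so each hypothesis may be traded
    -- for a rational gap `0ℝ ⋖ x`, where products can be estimated.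
    ; *-pos       = λ {x} {y} x≰0 y≰0 xy≤0 →
        x≰0 (¬⋖⇒≤ℝ x 0ℝ λ 0⋖x → y≰0 (¬⋖⇒≤ℝ y 0ℝ λ 0⋖y → ⋖⇒≰ℝ 0ℝ (x *ℝ y) (0⋖-* x y 0⋖x 0⋖y) xy≤0))
    ; 0<1         = ⋖⇒≰ℝ 0ℝ 1ℝ (½ , ℚ.positive⁻¹ ½ , 0 , λ _ _ → subst (ℚ._< 1ℚ) (sym (ℚ.+-identityˡ ½)) (½<1))
    }
    where
    ½<1 : ½ ℚ.< 1ℚ
    ½<1 = ℚ.*<* (ℤ.+<+ (ℕ.s≤s (ℕ.s≤s ℕ.z≤n)))

  -- Before normalisation all denominators are 1, so among unnormalised rationals the claim is a
  -- single integer identity.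
  fromℤ-+ : ∀ i j → fromℤ (i ℤ.+ j) ≃ fromℤ i +ℝ fromℤ j
  fromℤ-+ i j = pointwise⇒≃ (fromℤ (i ℤ.+ j)) (fromℤ i +ℝ fromℤ j) λ _ → ℚ.toℚᵘ-injective (begin
    ℚ.toℚᵘ ((i ℤ.+ j) ℚ./ 1)                         ≈⟨ ℚ.toℚᵘ-fromℚᵘ (ℚᵘ.mkℚᵘ (i ℤ.+ j) 0) ⟩
    ℚᵘ.mkℚᵘ (i ℤ.+ j) 0                              ≈⟨ ℚᵘ.*≡* (numerators i j) ⟩
    ℚᵘ.mkℚᵘ i 0 ℚᵘ.+ ℚᵘ.mkℚᵘ j 0                     ≈⟨ ℚᵘ.+-cong (ℚ.toℚᵘ-fromℚᵘ (ℚᵘ.mkℚᵘ i 0)) (ℚ.toℚᵘ-fromℚᵘ (ℚᵘ.mkℚᵘ j 0)) ⟨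
    ℚ.toℚᵘ (i ℚ./ 1) ℚᵘ.+ ℚ.toℚᵘ (j ℚ./ 1)           ≈⟨ ℚ.toℚᵘ-homo-+ (i ℚ./ 1) (j ℚ./ 1) ⟨
    ℚ.toℚᵘ (i ℚ./ 1 ℚ.+ j ℚ./ 1)                     ∎)
    where
    open ℚᵘ.≃-Reasoning
    open ℤ-Solver.+-*-Solver
    numerators : ∀ i j → (i ℤ.+ j) ℤ.* (ℤ.+ 1 ℤ.* ℤ.+ 1) ≡ (i ℤ.* ℤ.+ 1 ℤ.+ j ℤ.* ℤ.+ 1) ℤ.* ℤ.+ 1
    numerators = solve 2 (λ i j → (i :+ j) :* (con (ℤ.+ 1) :* con (ℤ.+ 1)) := (i :* con (ℤ.+ 1) :+ j :* con (ℤ.+ 1)) :* con (ℤ.+ 1)) refl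

open RealOrder

-- Integers in a commutative ring, as coefficients for polynomial identities

module IntegerEmbedding (R : CommutativeRing 0ℓ 0ℓ) where

  open import Data.Integer.Base using (+_; -[1+_])
  open CommutativeRing R hiding (zero)
  open RingProperties ring using (-‿distribˡ-*; -‿involutive; -0#≈0#)
  open SemiringMult semiring using (×-homo-+; ×1-homo-*; ×-homo-1) renaming (_×_ to _⨯_)
  open SetoidReasoning setoid

  ι : ℕ → Carrier
  ι n = n ⨯ 1#

  ι-+ : ∀ m n → ι (m ℕ.+ n) ≈ ι m + ι n
  ι-+ = ×-homo-+ 1#

  ι-* : ∀ m n → ι (m ℕ.* n) ≈ ι m * ι n
  ι-* = ×1-homo-*

  ι-1 : ι 1 ≈ 1#
  ι-1 = ×-homo-1 1#

  ⟦_⟧ℤ : ℤ → Carrier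
  ⟦ + n ⟧ℤ      = ι n
  ⟦ -[1+ n ] ⟧ℤ = - ι (suc n)

  ⟦⟧-neg : ∀ i → ⟦ ℤ.- i ⟧ℤ ≈ - ⟦ i ⟧ℤ
  ⟦⟧-neg (+ zero)  = sym -0#≈0#
  ⟦⟧-neg (+ suc n) = refl
  ⟦⟧-neg -[1+ n ]  = sym (-‿involutive (ι (suc n)))

  private
    1+cancel : ∀ x y → (1# + x) - (1# + y) ≈ x - y
    1+cancel x y = begin
      (1# + x) + - (1# + y)     ≈⟨ +-cong (+-comm 1# x) (sym (⁻¹-∙-comm 1# y)) ⟩
      (x + 1#) + (- 1# + - y)   ≈⟨ +-assoc x 1# (- 1# + - y) ⟩
      x + (1# + (- 1# + - y))   ≈⟨ +-congˡ (+-assoc 1# (- 1#) (- y)) ⟨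
      x + ((1# + - 1#) + - y)   ≈⟨ +-congˡ (+-congʳ (-‿inverseʳ 1#)) ⟩
      x + (0# + - y)            ≈⟨ +-congˡ (+-identityˡ (- y)) ⟩
      x + - y                   ∎
      where open import Algebra.Properties.AbelianGroup +-abelianGroup using (⁻¹-∙-comm)

  ⟦⟧-⊖ : ∀ m n → ⟦ m ℤ.⊖ n ⟧ℤ ≈ ι m - ι n
  ⟦⟧-⊖ zero    zero    = sym (-‿inverseʳ 0#)
  ⟦⟧-⊖ (suc m) zero    = sym (trans (+-congˡ -0#≈0#) (+-identityʳ (ι (suc m))))
  ⟦⟧-⊖ zero    (suc n) = sym (+-identityˡ (- ι (suc n)))
  ⟦⟧-⊖ (suc m) (suc n) = begin
    ⟦ suc m ℤ.⊖ suc n ⟧ℤ  ≡⟨ ≡.cong ⟦_⟧ℤ (ℤ.[1+m]⊖[1+n]≡m⊖n m n) ⟩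
    ⟦ m ℤ.⊖ n ⟧ℤ          ≈⟨ ⟦⟧-⊖ m n ⟩
    ι m - ι n             ≈⟨ 1+cancel (ι m) (ι n) ⟨
    ι (suc m) - ι (suc n) ∎

  ⟦⟧-+ : ∀ i j → ⟦ i ℤ.+ j ⟧ℤ ≈ ⟦ i ⟧ℤ + ⟦ j ⟧ℤ
  ⟦⟧-+ (+ m)    (+ n)    = ι-+ m n
  ⟦⟧-+ (+ m)    -[1+ n ] = ⟦⟧-⊖ m (suc n)
  ⟦⟧-+ -[1+ m ] (+ n)    = trans (⟦⟧-⊖ n (suc m)) (+-comm (ι n) (- ι (suc m)))
  ⟦⟧-+ -[1+ m ] -[1+ n ] = begin
    - ι (suc (suc (m ℕ.+ n)))    ≡⟨ ≡.cong (λ k → - ι (suc k)) (ℕ.+-suc m n) ⟨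
    - ι (suc m ℕ.+ suc n)        ≈⟨ -‿cong (ι-+ (suc m) (suc n)) ⟩
    - (ι (suc m) + ι (suc n))    ≈⟨ ⁻¹-∙-comm (ι (suc m)) (ι (suc n)) ⟨
    - ι (suc m) + - ι (suc n)    ∎
    where open import Algebra.Properties.AbelianGroup +-abelianGroup using (⁻¹-∙-comm)

  private
    pos-* : ∀ m j → ⟦ + m ℤ.* j ⟧ℤ ≈ ι m * ⟦ j ⟧ℤ
    pos-* m (+ n)    = trans (reflexive (≡.cong ⟦_⟧ℤ (≡.sym (ℤ.pos-* m n)))) (ι-* m n)
    pos-* m -[1+ n ] = begin
      ⟦ + m ℤ.* -[1+ n ] ⟧ℤ        ≡⟨ ≡.cong ⟦_⟧ℤ (ℤ.neg-distribʳ-* (+ m) (+ suc n)) ⟨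
      ⟦ ℤ.- (+ m ℤ.* + suc n) ⟧ℤ   ≈⟨ ⟦⟧-neg (+ m ℤ.* + suc n) ⟩
      - ⟦ + m ℤ.* + suc n ⟧ℤ       ≈⟨ -‿cong (pos-* m (+ suc n)) ⟩
      - (ι m * ι (suc n))          ≈⟨ -‿distribʳ-* (ι m) (ι (suc n)) ⟩
      ι m * - ι (suc n)            ∎
      where open RingProperties ring using (-‿distribʳ-*)

  ⟦⟧-* : ∀ i j → ⟦ i ℤ.* j ⟧ℤ ≈ ⟦ i ⟧ℤ * ⟦ j ⟧ℤ
  ⟦⟧-* (+ m)    j = pos-* m j
  ⟦⟧-* -[1+ m ] j = begin
    ⟦ -[1+ m ] ℤ.* j ⟧ℤ          ≡⟨ ≡.cong ⟦_⟧ℤ (ℤ.neg-distribˡ-* (+ suc m) j) ⟨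
    ⟦ ℤ.- (+ suc m ℤ.* j) ⟧ℤ     ≈⟨ ⟦⟧-neg (+ suc m ℤ.* j) ⟩
    - ⟦ + suc m ℤ.* j ⟧ℤ         ≈⟨ -‿cong (pos-* (suc m) j) ⟩
    - (ι (suc m) * ⟦ j ⟧ℤ)       ≈⟨ -‿distribˡ-* (ι (suc m)) ⟦ j ⟧ℤ ⟩
    - ι (suc m) * ⟦ j ⟧ℤ         ∎

  private
    ℤ-rawRing : RawRing 0ℓ 0ℓ
    ℤ-rawRing = CommutativeRing.rawRing ℤ.+-*-commutativeRing

    morphism : ℤ-rawRing -Raw-AlmostCommutative⟶ fromCommutativeRing R
    morphism = record
      { ⟦_⟧    = ⟦_⟧ℤ
      ; +-homo = ⟦⟧-+
      ; *-homo = ⟦⟧-*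
      ; -‿homo = ⟦⟧-neg
      ; 0-homo = refl
      ; 1-homo = ι-1
      }

    -- Equality in the ring is not decidable, so the solver takes its coefficients in ℤ and compares
    -- them there.
    decide : ∀ i j → Maybe (⟦ i ⟧ℤ ≈ ⟦ j ⟧ℤ)
    decide i j with i ℤ.≟ j
    ... | yes i≡j = just (reflexive (≡.cong ⟦_⟧ℤ i≡j))
    ... | no _    = nothing

  open RingSolver ℤ-rawRing (fromCommutativeRing R) morphism decide public
    using (Polynomial; solve; con; _:=_; _:+_; _:*_; _:-_; :-_)

  :ι : ∀ {n} → ℕ → Polynomial n
  :ι k = con (+ k)

-- Inequalities in an ordered ring whose order is total up to ¬¬

module OrderedRingProperties (O : OrderedRing) where

  open OrderedRing O public hiding (zero)
  open IntegerEmbedding commutativeRing public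
    using (ι; ι-+; ι-*; ι-1; solve; :ι; _:=_; _:+_; _:*_; _:-_; :-_)
  open SemiringSum semiring public
    using (sum; sum-cong-≋; ∑-distrib-+; ∑-comm; *-distribˡ-sum; *-distribʳ-sum)

  module ≈-Reasoning = SetoidReasoning setoid

  ≤-refl : ∀ {x} → x ≤ x
  ≤-refl = ≤-reflexive refl

  <⇒≤ : ∀ {x y} → x < y → x ≤ y
  <⇒≤ {x} {y} y≰x = ≤-stable λ x≰y → ≤-total x y λ
    { (inj₁ x≤y) → x≰y x≤y ; (inj₂ y≤x) → y≰x y≤x }

  <-≤-trans : ∀ {x y z} → x < y → y ≤ z → x < z
  <-≤-trans x<y y≤z z≤x = x<y (≤-trans y≤z z≤x)

  ≤-<-trans : ∀ {x y z} → x ≤ y → y < z → x < z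
  ≤-<-trans x≤y y<z z≤x = y<z (≤-trans z≤x x≤y)

  ≤-respˡ : ∀ {x y z} → x ≈ y → x ≤ z → y ≤ z
  ≤-respˡ x≈y = ≤-trans (≤-reflexive (sym x≈y))

  ≤-respʳ : ∀ {x y z} → y ≈ z → x ≤ y → x ≤ z
  ≤-respʳ y≈z x≤y = ≤-trans x≤y (≤-reflexive y≈z)

  ≤⇒0≤- : ∀ {x y} → x ≤ y → 0# ≤ y - x
  ≤⇒0≤- {x} {y} x≤y = ≤-respˡ (-‿inverseʳ x) (+-monoˡ-≤ (- x) x≤y)

  0≤-⇒≤ : ∀ {x y} → 0# ≤ y - x → x ≤ y
  0≤-⇒≤ {x} {y} p = ≤-respˡ (+-identityˡ x)
    (≤-respʳ (solve 2 (λ x y → (y :- x) :+ x := y) refl x y) (+-monoˡ-≤ x p))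

  ≤-by : ∀ {x y e} → 0# ≤ e → y - x ≈ e → x ≤ y
  ≤-by 0≤e eq = 0≤-⇒≤ (≤-respʳ (sym eq) 0≤e)

  +-mono-≤ : ∀ {x y u v} → x ≤ y → u ≤ v → x + u ≤ y + v
  +-mono-≤ {x} {y} {u} {v} x≤y u≤v = ≤-trans (+-monoˡ-≤ u x≤y)
    (≤-respˡ (+-comm u y) (≤-respʳ (+-comm v y) (+-monoˡ-≤ y u≤v)))

  +-nonNeg : ∀ {x y} → 0# ≤ x → 0# ≤ y → 0# ≤ x + y
  +-nonNeg p q = ≤-respˡ (+-identityˡ 0#) (+-mono-≤ p q)

  -- The axioms speak of strictly positive factors. If the product were not nonnegative, neither
  -- factor could vanish, so both would be positive and the product with them.
  *-nonNeg : ∀ {x y} → 0# ≤ x → 0# ≤ y → 0# ≤ x * y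
  *-nonNeg {x} {y} 0≤x 0≤y = ≤-stable λ xy≱0 →
    xy≱0 (<⇒≤ (*-pos
      (λ x≤0 → xy≱0 (≤-reflexive (sym (trans (*-congʳ (≤-antisym x≤0 0≤x)) (zeroˡ y)))))
      (λ y≤0 → xy≱0 (≤-reflexive (sym (trans (*-congˡ (≤-antisym y≤0 0≤y)) (zeroʳ x)))))))

  +-pos-nonNeg : ∀ {x y} → 0# < x → 0# ≤ y → 0# < x + y
  +-pos-nonNeg {x} {y} 0<x 0≤y = <-≤-trans 0<x (≤-respˡ (+-identityʳ x) (+-mono-≤ ≤-refl 0≤y))

  *-monoˡ-≤ : ∀ {z x y} → 0# ≤ z → x ≤ y → z * x ≤ z * y
  *-monoˡ-≤ {z} {x} {y} 0≤z x≤y = ≤-by (*-nonNeg 0≤z (≤⇒0≤- x≤y))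
    (solve 3 (λ z x y → z :* y :- z :* x := z :* (y :- x)) refl z x y)

  -- Inequalities are refuted by Positivstellensatz certificates: the ring solver checks that a
  -- positive term plus a combination of nonnegative hypotheses vanishes.
  pos+nonNeg≉0 : ∀ {p q} → 0# < p → 0# ≤ q → p + q ≈ 0# → ⊥
  pos+nonNeg≉0 0<p 0≤q eq = +-pos-nonNeg 0<p 0≤q (≤-reflexive eq)

  -- If y were negative, the positive x(-y) would cancel against the nonnegative xy.
  *-cancelˡ-nonNeg : ∀ {x y} → 0# < x → 0# ≤ x * y → 0# ≤ y
  *-cancelˡ-nonNeg {x} {y} 0<x 0≤xy = ≤-stable λ y≱0 →
    pos+nonNeg≉0 (*-pos 0<x (λ -y≤0 → y≱0 (0≤-⇒≤ (≤-respʳ (sym (trans (+-congˡ -0#≈0#) (+-identityʳ y)))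
      (≤-respʳ (-‿involutive y) (≤-respʳ (+-identityˡ (- - y)) (≤⇒0≤- -y≤0)))))))
      0≤xy (solve 2 (λ x y → x :* (:- y) :+ x :* y := :ι 0) refl x y)
    where open RingProperties ring using (-0#≈0#; -‿involutive)

  *-cancelˡ-pos : ∀ {x y} → 0# < x → 0# < x * y → 0# < y
  *-cancelˡ-pos {x} {y} 0<x 0<xy y≤0 = 0<xy (≤-respʳ (zeroʳ x) (*-monoˡ-≤ (<⇒≤ 0<x) y≤0))

  0≤ι : ∀ n → 0# ≤ ι n
  0≤ι zero    = ≤-refl
  0≤ι (suc n) = +-nonNeg (<⇒≤ 0<1) (0≤ι n)

  0<ι : ∀ n → 0# < ι (suc n)
  0<ι n = +-pos-nonNeg 0<1 (0≤ι n)

  ι-mono-≤ : ∀ {m n} → m ℕ.≤ n → ι m ≤ ι n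
  ι-mono-≤ {n = n} ℕ.z≤n = 0≤ι n
  ι-mono-≤ (ℕ.s≤s p)      = +-mono-≤ ≤-refl (ι-mono-≤ p)

  ι-cong : ∀ {m n} → m ≡ n → ι m ≈ ι n
  ι-cong eq = reflexive (≡.cong ι eq)

  sum-mono-≤ : ∀ {n} {f g : Fin n → Carrier} → (∀ i → f i ≤ g i) → sum f ≤ sum g
  sum-mono-≤ {zero}  p = ≤-refl
  sum-mono-≤ {suc n} p = +-mono-≤ (p zero) (sum-mono-≤ (λ i → p (suc i)))

  sum-nonNeg : ∀ {n} {f : Fin n → Carrier} → (∀ i → 0# ≤ f i) → 0# ≤ sum f
  sum-nonNeg {zero}  p = ≤-refl
  sum-nonNeg {suc n} p = +-nonNeg (p zero) (sum-nonNeg (λ i → p (suc i)))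

  ¬¬-maximum : ∀ {n} (f : Fin n → Carrier) → Fin n → ¬ ¬ (∃ λ i → ∀ j → f j ≤ f i)
  ¬¬-maximum {suc zero}    f _ k = k (zero , λ { zero → ≤-refl })
  ¬¬-maximum {suc (suc n)} f _ k = ¬¬-maximum (λ i → f (suc i)) zero λ (i , max) → ≤-total (f zero) (f (suc i)) λ
    { (inj₁ f₀≤) → k (suc i , λ { zero → f₀≤ ; (suc j) → max j })
    ; (inj₂ ≤f₀) → k (zero , λ { zero → ≤-refl ; (suc j) → ≤-trans (max j) ≤f₀ })
    }

-- ¬¬ commutes with finite products; this allows a sign to be chosen for all entries of a vector at
-- once.
¬¬-finite-choice : ∀ {n} {P : Fin n → Set} → (∀ i → ¬ ¬ P i) → ¬ ¬ (∀ i → P i)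
¬¬-finite-choice {zero}  p k = k λ ()
¬¬-finite-choice {suc n} p k = p zero λ p₀ → ¬¬-finite-choice (λ i → p (suc i)) λ p₊ →
  k λ { zero → p₀ ; (suc i) → p₊ i }

-- Finite sums of naturals and pigeonhole arguments

module NatSum where

  open ≡ using (refl; sym; trans; cong; cong₂; subst; subst₂; module ≡-Reasoning)
  open import Data.Nat.Base using (_+_; _*_; _≤_; _<_)

  open SemiringSum ℕ.+-*-semiring public
    using (sum; sum-cong-≗; ∑-distrib-+; ∑-comm; *-distribˡ-sum; *-distribʳ-sum)

  sum-mono-≤ : ∀ {n} {f g : Fin n → ℕ} → (∀ i → f i ≤ g i) → sum f ≤ sum g
  sum-mono-≤ {zero}  p = z≤n
  sum-mono-≤ {suc n} p = ℕ.+-mono-≤ (p zero) (sum-mono-≤ (λ i → p (suc i)))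

  -- Pigeonhole: either the head is a witness, or dropping it from both sums keeps the inequality
  -- strict.
  sum-<-witness : ∀ {n} (f g : Fin n → ℕ) → sum f < sum g → ∃ λ i → f i < g i
  sum-<-witness {suc n} f g p with f zero ℕ.<? g zero
  ... | yes q = zero , q
  ... | no ¬q with sum-<-witness (λ i → f (suc i)) (λ i → g (suc i))
                     (ℕ.≰⇒> λ r → ℕ.<⇒≱ p (ℕ.+-mono-≤ (ℕ.≮⇒≥ ¬q) r))
  ...   | i , q = suc i , q

  sum-zero : ∀ {n} (f : Fin n → ℕ) → (∀ i → f i ≡ 0) → sum f ≡ 0
  sum-zero {zero}  f p = refl
  sum-zero {suc n} f p = cong₂ _+_ (p zero) (sum-zero (λ i → f (suc i)) (λ i → p (suc i)))

  -- Recursive instead of through decidable equality, so that `sum-δ` computes along the index.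
  δ : ∀ {n} → Fin n → Fin n → ℕ
  δ zero    zero    = 1
  δ zero    (suc _) = 0
  δ (suc _) zero    = 0
  δ (suc i) (suc j) = δ i j

  δ-refl : ∀ {n} (i : Fin n) → δ i i ≡ 1
  δ-refl zero    = refl
  δ-refl (suc i) = δ-refl i

  δ-≡ : ∀ {n} {i j : Fin n} → i ≡ j → δ i j ≡ 1
  δ-≡ {i = i} refl = δ-refl i

  δ-≢ : ∀ {n} (i j : Fin n) → i ≢ j → δ i j ≡ 0
  δ-≢ zero    zero    p = contradiction refl p
  δ-≢ zero    (suc j) p = refl
  δ-≢ (suc i) zero    p = refl
  δ-≢ (suc i) (suc j) p = δ-≢ i j (λ e → p (cong suc e))

  sum-δ : ∀ {n} (i : Fin n) (f : Fin n → ℕ) → sum (λ j → δ i j * f j) ≡ f i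
  sum-δ {suc n} zero f = trans (cong (f zero + 0 +_) (sum-zero {n} (λ _ → 0) λ _ → refl)) (trans (ℕ.+-identityʳ (f zero + 0)) (ℕ.+-identityʳ (f zero)))
  sum-δ (suc i) f = sum-δ i (λ j → f (suc j))

  sum-δ₁ : ∀ {n} (i : Fin n) → sum (δ i) ≡ 1
  sum-δ₁ i = trans (sum-cong-≗ (λ j → sym (ℕ.*-identityʳ (δ i j)))) (sum-δ i (λ _ → 1))

  term≤sum : ∀ {n} (f : Fin n → ℕ) i → f i ≤ sum f
  term≤sum f zero    = ℕ.m≤m+n (f zero) _
  term≤sum f (suc i) = ℕ.≤-trans (term≤sum (λ j → f (suc j)) i) (ℕ.m≤n+m _ (f zero))

  -- The indicator of a first witness has total 1, so a larger sum of 0-1 values exceeds it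
  -- somewhere else.
  two-terms : ∀ {n} (f : Fin n → ℕ) → (∀ i → f i ≤ 1) → 2 ≤ sum f →
              ∃ λ i → ∃ λ j → i ≢ j × 0 < f i × 0 < f j
  two-terms {n} f f≤1 p with sum-<-witness (λ _ → 0) f (subst (_< sum f) (sym (sum-zero {n} (λ _ → 0) λ _ → refl)) (ℕ.<-trans (s≤s z≤n) p))
  ... | i , 0<fi with sum-<-witness (δ i) f (subst (_< sum f) (sym (sum-δ₁ i)) p)
  ...   | j , δ<fj = i , j , i≢j , 0<fi , ℕ.≤-<-trans z≤n δ<fj
    where
    i≢j : i ≢ j
    i≢j refl = ℕ.<-irrefl refl (ℕ.<-≤-trans (subst (_< f i) (δ-refl i) δ<fj) (f≤1 i))

  δ≤1 : ∀ {n} (i j : Fin n) → δ i j ≤ 1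
  δ≤1 zero    zero    = ℕ.≤-refl
  δ≤1 zero    (suc j) = z≤n
  δ≤1 (suc i) zero    = z≤n
  δ≤1 (suc i) (suc j) = δ≤1 i j

  δ-disjoint₂ : ∀ {n} {i j : Fin n} → i ≢ j → ∀ k → δ i k + δ j k ≤ 1
  δ-disjoint₂ {i = i} {j} i≢j k with i Fin.≟ k
  ... | yes refl = ℕ.≤-reflexive (cong₂ _+_ (δ-refl i) (δ-≢ j i (λ e → i≢j (sym e))))
  ... | no i≢k   = subst (λ d → d + δ j k ≤ 1) (sym (δ-≢ i k i≢k)) (δ≤1 j k)

  δ-disjoint₃ : ∀ {n} {i j k : Fin n} → i ≢ j → i ≢ k → j ≢ k → ∀ l → δ i l + δ j l + δ k l ≤ 1
  δ-disjoint₃ {i = i} {j} {k} i≢j i≢k j≢k l with k Fin.≟ l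
  ... | yes refl = ℕ.≤-reflexive (cong₂ _+_ (cong₂ _+_ (δ-≢ i k i≢k) (δ-≢ j k j≢k)) (δ-refl k))
  ... | no k≢l   = subst (_≤ 1) (sym (trans (cong (δ i l + δ j l +_) (δ-≢ k l k≢l)) (ℕ.+-identityʳ _))) (δ-disjoint₂ i≢j l)

  two-terms≤sum : ∀ {n} (f : Fin n → ℕ) {i j} → i ≢ j → f i + f j ≤ sum f
  two-terms≤sum f {i} {j} i≢j = subst (_≤ sum f) total (sum-mono-≤ λ k →
    ℕ.≤-trans (ℕ.*-monoˡ-≤ (f k) (δ-disjoint₂ i≢j k)) (ℕ.≤-reflexive (ℕ.*-identityˡ (f k))))
    where
    total : sum (λ k → (δ i k + δ j k) * f k) ≡ f i + f j
    total = trans (sum-cong-≗ (λ k → ℕ.*-distribʳ-+ (f k) (δ i k) (δ j k)))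
      (trans (∑-distrib-+ (λ k → δ i k * f k) (λ k → δ j k * f k)) (cong₂ _+_ (sum-δ i f) (sum-δ j f)))

  -- The indicator of i has total 1 < 2, so some k has `δ i k < f k`; as `f k` is at most 1, this
  -- forces `δ i k` to be 0.
  outside-one : ∀ {n} (f : Fin n → ℕ) → (∀ k → f k ≤ 1) → 2 ≤ sum f → ∀ i → ∃ λ k → 0 < f k × k ≢ i
  outside-one f f≤1 2≤ i = k , ℕ.≤-<-trans z≤n p , k≢i
    where
    witness : ∃ λ k → δ i k < f k
    witness = sum-<-witness (δ i) f (subst (_< sum f) (sym (sum-δ₁ i)) 2≤)
    k : _
    k = proj₁ witness
    p : δ i k < f k
    p = proj₂ witness
    k≢i : k ≢ i
    k≢i e = ℕ.<⇒≱ (subst (_< f k) (δ-≡ (sym e)) p) (f≤1 k)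

  outside-two : ∀ {n} (f : Fin n → ℕ) → (∀ k → f k ≤ 1) → 3 ≤ sum f → ∀ i j → ∃ λ k → 0 < f k × k ≢ i × k ≢ j
  outside-two f f≤1 3≤ i j = k , ℕ.≤-<-trans z≤n p , k≢i , k≢j
    where
    witness : ∃ λ k → δ i k + δ j k < f k
    witness = sum-<-witness (λ k → δ i k + δ j k) f
      (subst (_< sum f) (sym (trans (∑-distrib-+ (δ i) (δ j)) (cong₂ _+_ (sum-δ₁ i) (sum-δ₁ j)))) 3≤)
    k : _
    k = proj₁ witness
    p : δ i k + δ j k < f k
    p = proj₂ witness
    k≢i : k ≢ i
    k≢i e = ℕ.<⇒≱ (ℕ.≤-<-trans (ℕ.m≤m+n 1 (δ j k)) (subst (λ d → d + δ j k < f k) (δ-≡ (sym e)) p)) (f≤1 k)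
    k≢j : k ≢ j
    k≢j e = ℕ.<⇒≱ (ℕ.≤-<-trans (ℕ.m≤n+m 1 (δ i k)) (subst (λ d → δ i k + d < f k) (δ-≡ (sym e)) p)) (f≤1 k)

-- Edge counts relative to the neighbourhood N(u) of a vertex u

module Link (G : Graph) (u : Fin (order G)) where

  open ≡ using (refl; sym; trans; cong; cong₂; subst; subst₂; module ≡-Reasoning)
  open import Data.Nat.Base using (_+_; _*_; _∸_; _≤_; _<_)
  open NatSum

  Vertex : Set
  Vertex = Fin (order G)

  infix 4 _~_
  _~_ : Vertex → Vertex → Set
  _~_ = Adj G

  ~⇒≢ : ∀ {x y} → x ~ y → x ≢ y
  ~⇒≢ x~x refl = loopless G x~x

  a : Vertex → Vertex → ℕ
  a i j = if ⌊ adj? G i j ⌋ then 1 else 0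

  a-~ : ∀ {x y} → x ~ y → a x y ≡ 1
  a-~ {x} {y} p with adj? G x y
  ... | yes _ = refl
  ... | no ¬p = contradiction p ¬p

  a-≁ : ∀ {x y} → ¬ x ~ y → a x y ≡ 0
  a-≁ {x} {y} ¬p with adj? G x y
  ... | yes p = contradiction p ¬p
  ... | no _  = refl

  0<a⇒~ : ∀ {x y} → 0 < a x y → x ~ y
  0<a⇒~ {x} {y} p with adj? G x y
  ... | yes q = q
  0<a⇒~ () | no _

  a≤1 : ∀ x y → a x y ≤ 1
  a≤1 x y with adj? G x y
  ... | yes _ = ℕ.≤-refl
  ... | no _  = z≤n

  a-sym : ∀ x y → a x y ≡ a y x
  a-sym x y with adj? G x y
  ... | yes p = sym (a-~ (adj-sym G p))
  ... | no ¬p = sym (a-≁ (λ q → ¬p (adj-sym G q)))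

  a-loop : ∀ x → a x x ≡ 0
  a-loop x = a-≁ (loopless G)

  data Place (x : Vertex) : Set where
    centre : u ≡ x → Place x
    near   : u ~ x → Place x
    far    : u ≢ x → ¬ u ~ x → Place x

  place : ∀ x → Place x
  place x with u Fin.≟ x | adj? G u x
  ... | yes p | _     = centre p
  ... | no _  | yes q = near q
  ... | no p  | no q  = far p q

  -- Numeric indicators of N(u) and of the complement of the closed neighbourhood, so that edge
  -- counts become sums.
  ν ω : Vertex → ℕ
  ν = a u
  ω x = 1 ∸ (δ u x + ν x)

  Near Far : Vertex → Set
  Near x = u ~ x
  Far x = u ≢ x × ¬ u ~ x

  ω-centre : ω u ≡ 0
  ω-centre = cong (1 ∸_) (cong₂ _+_ (δ-refl u) (a-loop u))

  ω-near : ∀ {x} → Near x → ω x ≡ 0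
  ω-near {x} p = cong (1 ∸_) (cong₂ _+_ (δ-≢ u x (~⇒≢ p)) (a-~ p))

  ω-far : ∀ {x} → Far x → ω x ≡ 1
  ω-far {x} (p , q) = cong (1 ∸_) (cong₂ _+_ (δ-≢ u x p) (a-≁ q))

  partition : ∀ x → δ u x + ν x + ω x ≡ 1
  partition x with place x
  ... | centre refl = cong₂ _+_ (cong₂ _+_ (δ-refl u) (a-loop u)) ω-centre
  ... | near p      = cong₂ _+_ (cong₂ _+_ (δ-≢ u x (~⇒≢ p)) (a-~ p)) (ω-near p)
  ... | far p q     = cong₂ _+_ (cong₂ _+_ (δ-≢ u x p) (a-≁ q)) (ω-far (p , q))

  -- For a vertex of the neighbourhood of u, c is the degree inside it.
  c b degree : Vertex → ℕ
  c x      = sum (λ v → a x v * ν v)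
  b x      = sum (λ v → a x v * ω v)
  degree x = sum (a x)

  -- Twice the number of edges with both ends outside the closed neighbourhood.
  farEdgeEnds : ℕ
  farEdgeEnds = sum (λ x → ω x * b x)

  sum-partition : ∀ (f : Vertex → ℕ) → sum f ≡ f u + sum (λ x → ν x * f x) + sum (λ x → ω x * f x)
  sum-partition f = begin
    sum f
      ≡⟨ sum-cong-≗ (λ x → trans (sym (ℕ.*-identityˡ (f x))) (trans (cong (_* f x) (sym (partition x)))
           (trans (ℕ.*-distribʳ-+ (f x) (δ u x + ν x) (ω x)) (cong (_+ ω x * f x) (ℕ.*-distribʳ-+ (f x) (δ u x) (ν x)))))) ⟩
    sum (λ x → δ u x * f x + ν x * f x + ω x * f x)
      ≡⟨ ∑-distrib-+ (λ x → δ u x * f x + ν x * f x) (λ x → ω x * f x) ⟩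
    sum (λ x → δ u x * f x + ν x * f x) + sum (λ x → ω x * f x)
      ≡⟨ cong (_+ sum (λ x → ω x * f x)) (∑-distrib-+ (λ x → δ u x * f x) (λ x → ν x * f x)) ⟩
    sum (λ x → δ u x * f x) + sum (λ x → ν x * f x) + sum (λ x → ω x * f x)
      ≡⟨ cong (λ z → z + sum (λ x → ν x * f x) + sum (λ x → ω x * f x)) (sum-δ u f) ⟩
    f u + sum (λ x → ν x * f x) + sum (λ x → ω x * f x) ∎
    where open ≡-Reasoning

  degree-split : ∀ x → degree x ≡ ν x + c x + b x
  degree-split x = trans (sum-partition (a x)) (cong₂ _+_ (cong₂ _+_ (a-sym x u)
    (sum-cong-≗ (λ v → ℕ.*-comm (ν v) (a x v)))) (sum-cong-≗ (λ v → ℕ.*-comm (ω v) (a x v))))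

  ων≡0 : ∀ x → ω x * ν x ≡ 0
  ων≡0 x with place x
  ... | centre refl = cong (_* ν x) ω-centre
  ... | near p      = cong (_* ν x) (ω-near p)
  ... | far _ q     = trans (cong (ω x *_) (a-≁ q)) (ℕ.*-zeroʳ (ω x))

  νν≡ν : ∀ x → ν x * ν x ≡ ν x
  νν≡ν x with adj? G u x
  ... | yes _ = refl
  ... | no _  = refl

  -- Counted from the other end, `sum b` is the sum of degrees over the far vertices, none of which
  -- is adjacent to u.
  sum-b : sum b ≡ sum (λ x → ω x * c x) + farEdgeEnds
  sum-b = begin
    sum (λ x → sum (λ v → a x v * ω v))   ≡⟨ ∑-comm (λ x v → a x v * ω v) ⟩
    sum (λ v → sum (λ x → a x v * ω v))   ≡⟨ sum-cong-≗ (λ v → trans (sum-cong-≗ (λ x → trans (cong (_* ω v) (a-sym x v)) (ℕ.*-comm (a v x) (ω v))))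
                                               (sym (*-distribˡ-sum (ω v) (a v)))) ⟩
    sum (λ v → ω v * degree v)            ≡⟨ sum-cong-≗ expand ⟩
    sum (λ v → ω v * c v + ω v * b v)     ≡⟨ ∑-distrib-+ (λ v → ω v * c v) (λ v → ω v * b v) ⟩
    sum (λ x → ω x * c x) + farEdgeEnds   ∎
    where
    open ≡-Reasoning
    expand : ∀ v → ω v * degree v ≡ ω v * c v + ω v * b v
    expand v = begin
      ω v * degree v                        ≡⟨ cong (ω v *_) (degree-split v) ⟩
      ω v * (ν v + c v + b v)               ≡⟨ distribute (ω v) (ν v) (c v) (b v) ⟩
      ω v * ν v + (ω v * c v + ω v * b v)   ≡⟨ cong (_+ (ω v * c v + ω v * b v)) (ων≡0 v) ⟩
      ω v * c v + ω v * b v                 ∎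
      where
      open ℕ-Solver.+-*-Solver
      distribute : ∀ w p q r → w * (p + q + r) ≡ w * p + (w * q + w * r)
      distribute = solve 4 (λ w p q r → w :* (p :+ q :+ r) := w :* p :+ (w :* q :+ w :* r)) refl

  sum-c : sum c ≡ sum ν + sum (λ x → ν x * c x) + sum (λ x → ω x * c x)
  sum-c = trans (sum-partition c) (cong (λ z → z + sum (λ x → ν x * c x) + sum (λ x → ω x * c x)) (sum-cong-≗ νν≡ν))

  -- `sum c` is the sum of degrees over N(u), so it counts an edge once for each end in N(u). Its
  -- double exceeds the degree sum by one for each ordered adjacent pair in N(u) and misses exactly
  -- the edges between far vertices, since every edge at u ends in N(u).
  sum-degree : sum degree + sum (λ x → ν x * c x) ≡ 2 * sum c + farEdgeEnds
  sum-degree = begin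
    sum degree + Νc                              ≡⟨ cong (_+ Νc) (sum-cong-≗ degree-split) ⟩
    sum (λ x → ν x + c x + b x) + Νc             ≡⟨ cong (_+ Νc) (trans (∑-distrib-+ (λ x → ν x + c x) b) (cong (_+ sum b) (∑-distrib-+ ν c))) ⟩
    sum ν + sum c + sum b + Νc                   ≡⟨ cong (λ z → sum ν + sum c + z + Νc) sum-b ⟩
    sum ν + sum c + (Ωc + farEdgeEnds) + Νc      ≡⟨ regroup (sum ν) (sum c) Ωc farEdgeEnds Νc ⟩
    (sum ν + Νc + Ωc) + sum c + farEdgeEnds      ≡⟨ cong (λ z → z + sum c + farEdgeEnds) sum-c ⟨
    sum c + sum c + farEdgeEnds                  ≡⟨ cong (λ z → sum c + z + farEdgeEnds) (ℕ.+-identityʳ (sum c)) ⟨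
    2 * sum c + farEdgeEnds                      ∎
    where
    open ≡-Reasoning
    Νc Ωc : ℕ
    Νc = sum (λ x → ν x * c x)
    Ωc = sum (λ x → ω x * c x)
    open ℕ-Solver.+-*-Solver
    regroup : ∀ p q r e s → p + q + (r + e) + s ≡ (p + s + r) + q + e
    regroup = solve 5 (λ p q r e s → p :+ q :+ (r :+ e) :+ s := (p :+ s :+ r) :+ q :+ e) refl

  -- Each edge from w to a far vertex is counted from both ends: row w and column w of the symmetric
  -- table `f` meet only on the diagonal, where it vanishes.
  2b≤farEdgeEnds : ∀ {w} → Far w → b w + b w ≤ farEdgeEnds
  2b≤farEdgeEnds {w} w-far = subst₂ _≤_ lhs rhs (sum-mono-≤ λ x → sum-mono-≤ (pointwise x))
    where
    open ≡-Reasoning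
    f : Vertex → Vertex → ℕ
    f x z = ω x * (a x z * ω z)
    f-row : sum (f w) ≡ b w
    f-row = sum-cong-≗ λ z → trans (cong (_* (a w z * ω z)) (ω-far w-far)) (ℕ.*-identityˡ _)
    f-sym : ∀ x z → f x z ≡ f z x
    f-sym x z = trans (cong (λ k → ω x * (k * ω z)) (a-sym x z))
      (solve 3 (λ p q r → p :* (q :* r) := r :* (q :* p)) refl (ω x) (a z x) (ω z))
      where open ℕ-Solver.+-*-Solver
    pointwise : ∀ x z → δ w x * f w z + δ w z * f x w ≤ f x z
    pointwise x z with w Fin.≟ x | w Fin.≟ z
    ... | yes refl | yes refl = ℕ.≤-reflexive (trans
            (cong₂ _+_ (trans (cong (δ w w *_) f-loop) (ℕ.*-zeroʳ (δ w w))) (trans (cong (δ w w *_) f-loop) (ℕ.*-zeroʳ (δ w w)))) (sym f-loop))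
      where
      f-loop : f w w ≡ 0
      f-loop = trans (cong (λ k → ω w * (k * ω w)) (a-loop w)) (ℕ.*-zeroʳ (ω w))
    ... | yes refl | no p     = ℕ.≤-reflexive (trans (cong₂ _+_ (cong (_* f w z) (δ-refl w)) (cong (_* f w w) (δ-≢ w z p)))
                                  (trans (ℕ.+-identityʳ _) (ℕ.*-identityˡ _)))
    ... | no p     | yes refl = ℕ.≤-reflexive (trans (cong₂ _+_ (cong (_* f w w) (δ-≢ w x p)) (cong (_* f x w) (δ-refl w))) (ℕ.*-identityˡ _))
    ... | no p     | no q     = subst (_≤ f x z) (sym (cong₂ _+_ (cong (_* f w z) (δ-≢ w x p)) (cong (_* f x w) (δ-≢ w z q)))) z≤n
    lhs : sum (λ x → sum (λ z → δ w x * f w z + δ w z * f x w)) ≡ b w + b w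
    lhs = begin
      sum (λ x → sum (λ z → δ w x * f w z + δ w z * f x w))
        ≡⟨ sum-cong-≗ (λ x → trans (∑-distrib-+ (λ z → δ w x * f w z) (λ z → δ w z * f x w))
             (cong₂ _+_ (sym (*-distribˡ-sum (δ w x) (f w))) (sum-δ w (λ _ → f x w)))) ⟩
      sum (λ x → δ w x * sum (f w) + f x w)
        ≡⟨ ∑-distrib-+ (λ x → δ w x * sum (f w)) (λ x → f x w) ⟩
      sum (λ x → δ w x * sum (f w)) + sum (λ x → f x w)
        ≡⟨ cong₂ _+_ (trans (sum-δ w (λ _ → sum (f w))) f-row) (trans (sum-cong-≗ (λ x → f-sym x w)) f-row) ⟩
      b w + b w ∎
    rhs : sum (λ x → sum (f x)) ≡ farEdgeEnds
    rhs = sum-cong-≗ λ x → sym (*-distribˡ-sum (ω x) (λ z → a x z * ω z))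

-- Stars and leaves in a P₄-free neighbourhood

module FanFree (G : Graph) (free : (V 5 -free) G) (u : Fin (order G)) where

  open ≡ using (refl; sym; trans; cong; cong₂; subst; subst₂; module ≡-Reasoning)
  open import Data.Nat.Base using (_+_; _*_; _≤_; _<_)
  open NatSum

  open Link G u

  no-fan : ∀ {h p q r s} → h ~ p → h ~ q → h ~ r → h ~ s → p ~ q → q ~ r → r ~ s →
           p ≢ r → p ≢ s → q ≢ s → ⊥
  no-fan {h} {p} {q} {r} {s} hp hq hr hs pq qr rs p≢r p≢s q≢s =
    free (embed , (λ {i} {j} → lookup-injective distinct i j) , adjacent)
    where
      vertices : Vec Vertex 5
      vertices = h ∷ p ∷ q ∷ r ∷ s ∷ []
      embed : Fin 5 → Vertex
      embed = Vec.lookup vertices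
      distinct : Unique vertices
      distinct = (~⇒≢ hp ∷ ~⇒≢ hq ∷ ~⇒≢ hr ∷ ~⇒≢ hs ∷ []) ∷ (~⇒≢ pq ∷ p≢r ∷ p≢s ∷ [])
        ∷ (~⇒≢ qr ∷ q≢s ∷ []) ∷ (~⇒≢ rs ∷ []) ∷ [] ∷ []
      onPath : Fin 4 → Vertex
      onPath i = embed (suc i)
      path : ∀ i j → toℕ j ≡ suc (toℕ i) → onPath i ~ onPath j
      path i                   zero                         ()
      path zero                (suc zero)                   _ = pq
      path (suc i)             (suc zero)                   ()
      path zero                (suc (suc j))                ()
      path (suc zero)          (suc (suc zero))             _ = qr
      path (suc (suc i))       (suc (suc zero))             ()
      path (suc zero)          (suc (suc (suc zero)))       ()
      path (suc (suc zero))    (suc (suc (suc zero)))       _ = rs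
      path (suc (suc (suc i))) (suc (suc (suc zero)))       ()
      spoke : ∀ i → h ~ onPath i
      spoke zero                   = hp
      spoke (suc zero)             = hq
      spoke (suc (suc zero))       = hr
      spoke (suc (suc (suc zero))) = hs
      adjacent : ∀ i j → Adj (V 5) i j → embed i ~ embed j
      adjacent zero    zero    e        = contradiction refl e
      adjacent zero    (suc j) _        = spoke j
      adjacent (suc i) zero    _        = adj-sym G (spoke i)
      adjacent (suc i) (suc j) (inj₁ e) = path i j e
      adjacent (suc i) (suc j) (inj₂ e) = adj-sym G (path j i e)

  no-path : ∀ {p q r s} → Near p → Near q → Near r → Near s → p ~ q → q ~ r → r ~ s →
            p ≢ r → p ≢ s → q ≢ s → ⊥
  no-path = no-fan

  private
    aν : Vertex → Vertex → ℕ
    aν x z = a x z * ν z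

    aν≤1 : ∀ x z → aν x z ≤ 1
    aν≤1 x z = ℕ.*-mono-≤ (a≤1 x z) (a≤1 u z)

    aν-near : ∀ {x z} → x ~ z → Near z → aν x z ≡ 1
    aν-near x~z nz = cong₂ _*_ (a-~ x~z) (a-~ nz)

    0<aν : ∀ x z → 0 < aν x z → x ~ z × Near z
    0<aν x z p with adj? G x z | adj? G u z
    ... | yes q | yes r = q , r
    0<aν x z () | yes q | no r
    0<aν x z () | no q  | _

  neighbour : ∀ x → 1 ≤ c x → ∃ λ z → x ~ z × Near z
  neighbour x 1≤c with sum-<-witness (λ _ → 0) (aν x) (subst (_< c x) (sym (sum-zero {order G} (λ _ → 0) λ _ → refl)) 1≤c)
  ... | z , p = z , 0<aν x z p

  second-neighbour : ∀ x → 2 ≤ c x → ∀ v → ∃ λ z → x ~ z × Near z × z ≢ v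
  second-neighbour x 2≤c v =
    let z , p , z≢v = outside-one (aν x) (aν≤1 x) 2≤c v
        x~z , nz = 0<aν x z p
    in z , x~z , nz , z≢v

  third-neighbour : ∀ x → 3 ≤ c x → ∀ v w → ∃ λ z → x ~ z × Near z × z ≢ v × z ≢ w
  third-neighbour x 3≤c v w =
    let z , p , z≢v , z≢w = outside-two (aν x) (aν≤1 x) 3≤c v w
        x~z , nz = 0<aν x z p
    in z , x~z , nz , z≢v , z≢w

  1≤c : ∀ {x z} → x ~ z → Near z → 1 ≤ c x
  1≤c {x} {z} x~z nz = subst (_≤ c x) (aν-near x~z nz) (term≤sum (aν x) z)

  2≤c : ∀ {x y z} → y ≢ z → x ~ y → Near y → x ~ z → Near z → 2 ≤ c x
  2≤c {x} y≢z x~y ny x~z nz =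
    subst (_≤ c x) (cong₂ _+_ (aν-near x~y ny) (aν-near x~z nz)) (two-terms≤sum (aν x) y≢z)

  c≡1⇒unique : ∀ {x y z} → c x ≡ 1 → x ~ y → Near y → x ~ z → Near z → y ≡ z
  c≡1⇒unique {x} {y} {z} c≡1 x~y ny x~z nz with y Fin.≟ z
  ... | yes y≡z = y≡z
  ... | no y≢z  = contradiction (subst (2 ≤_) c≡1 (2≤c y≢z x~y ny x~z nz)) λ { (s≤s ()) }

  -- Two different further neighbours, p of x and z of y, would form the path p x y z.
  common-neighbour : ∀ {x y} → Near x → Near y → x ~ y → 2 ≤ c x → 2 ≤ c y → ∃ λ z → x ~ z × y ~ z × Near z
  common-neighbour {x} {y} nx ny x~y 2≤cx 2≤cy with second-neighbour x 2≤cx y | second-neighbour y 2≤cy x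
  ... | p , x~p , np , p≢y | z , y~z , nz , z≢x with p Fin.≟ z
  ...   | yes refl = p , x~p , y~z , np
  ...   | no p≢z   = ⊥-elim (no-path np nx ny nz (adj-sym G x~p) x~y y~z p≢y p≢z (λ e → z≢x (sym e)))

  -- A third neighbour p of x, avoiding y and a neighbour z of y, starts the path p x y z.
  c≤2 : ∀ {x y} → Near x → Near y → x ~ y → 2 ≤ c x → 2 ≤ c y → c x ≤ 2
  c≤2 {x} {y} nx ny x~y 2≤cx 2≤cy = ℕ.≮⇒≥ λ 3≤cx →
    let z , y~z , nz , z≢x = second-neighbour y 2≤cy x
        p , x~p , np , p≢y , p≢z = third-neighbour x 3≤cx y z
    in no-path np nx ny nz (adj-sym G x~p) x~y y~z p≢y p≢z (λ e → z≢x (sym e))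

  large⇒leaves : ∀ {x y} → Near x → 3 ≤ c x → x ~ y → Near y → c y ≡ 1
  large⇒leaves {x} {y} nx 3≤cx x~y ny with c y ℕ.≟ 1
  ... | yes e = e
  ... | no c≢1 = contradiction (c≤2 nx ny x~y (ℕ.≤-trans (s≤s (s≤s z≤n)) 3≤cx)
                   (ℕ.≤∧≢⇒< (1≤c (adj-sym G x~y) nx) (λ e → c≢1 (sym e)))) (ℕ.<⇒≱ 3≤cx)

  -- A further neighbour z of y gives the path l x y z; z = l is impossible because x is the only
  -- neighbour of l in N(u).
  star⇒leaves : ∀ {l x y} → Near l → c l ≡ 1 → l ~ x → Near x → x ~ y → Near y → c y ≡ 1
  star⇒leaves {l} {x} {y} nl cl≡1 l~x nx x~y ny with c y ℕ.≟ 1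
  ... | yes e  = e
  ... | no c≢1 = ⊥-elim contra
    where
    2≤cy : 2 ≤ c y
    2≤cy = ℕ.≤∧≢⇒< (1≤c (adj-sym G x~y) nx) (λ e → c≢1 (sym e))
    l≢y : l ≢ y
    l≢y refl = c≢1 cl≡1
    contra : ⊥
    contra with second-neighbour y 2≤cy x
    ... | z , y~z , nz , z≢x = no-path nl nx ny nz l~x x~y y~z l≢y
            (λ { refl → ~⇒≢ x~y (c≡1⇒unique cl≡1 l~x nx (adj-sym G y~z) ny) })
            (λ e → z≢x (sym e))

  leaf leaves : Vertex → ℕ
  leaf x   = if ⌊ c x ℕ.≟ 1 ⌋ then ν x else 0
  leaves x = sum (λ z → a x z * leaf z)

  leaf-≡1 : ∀ {x} → Near x → c x ≡ 1 → leaf x ≡ 1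
  leaf-≡1 {x} nx e with c x ℕ.≟ 1
  ... | yes _ = a-~ nx
  ... | no ¬e = contradiction e ¬e

  leaf-≢1 : ∀ {x} → c x ≢ 1 → leaf x ≡ 0
  leaf-≢1 {x} ¬e with c x ℕ.≟ 1
  ... | yes e = contradiction e ¬e
  ... | no _  = refl

  leaf-not-near : ∀ {x} → ¬ Near x → leaf x ≡ 0
  leaf-not-near {x} ¬nx with c x ℕ.≟ 1
  ... | yes _ = a-≁ ¬nx
  ... | no _  = refl

  leaf*c : ∀ x → leaf x * c x ≡ leaf x
  leaf*c x with c x ℕ.≟ 1
  ... | yes e = trans (cong (ν x *_) e) (ℕ.*-identityʳ (ν x))
  ... | no _  = refl

  -- Double counting: by `leaf*c` a leaf has exactly one neighbour in N(u). This is why the transfer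
  -- of weight along leaves in `Φ` costs nothing.
  sum-leaves : sum (λ x → ν x * leaves x) ≡ sum leaf
  sum-leaves = begin
    sum (λ x → ν x * leaves x)                      ≡⟨ sum-cong-≗ (λ x → *-distribˡ-sum (ν x) (λ z → a x z * leaf z)) ⟩
    sum (λ x → sum (λ z → ν x * (a x z * leaf z)))  ≡⟨ ∑-comm (λ x z → ν x * (a x z * leaf z)) ⟩
    sum (λ z → sum (λ x → ν x * (a x z * leaf z)))  ≡⟨ sum-cong-≗ (λ z → trans (sum-cong-≗ (λ x → swap x z))
                                                         (trans (sym (*-distribˡ-sum (leaf z) (aν z))) (leaf*c z))) ⟩
    sum leaf ∎
    where
    open ≡-Reasoning
    open ℕ-Solver.+-*-Solver
    swap : ∀ x z → ν x * (a x z * leaf z) ≡ leaf z * aν z x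
    swap x z = trans (cong (λ k → ν x * (k * leaf z)) (a-sym x z))
      (solve 3 (λ p q r → p :* (q :* r) := r :* (q :* p)) refl (ν x) (a z x) (leaf z))

  all-leaves : ∀ {x} → (∀ {y} → x ~ y → Near y → c y ≡ 1) → leaves x ≡ c x
  all-leaves {x} h = sum-cong-≗ pointwise
    where
    pointwise : ∀ z → a x z * leaf z ≡ aν x z
    pointwise z = by-cases (adj? G x z) (adj? G u z)
      where
      by-cases : Dec (x ~ z) → Dec (Near z) → a x z * leaf z ≡ aν x z
      by-cases (no x≁z)  _        = trans (cong (_* leaf z) (a-≁ x≁z)) (sym (cong (_* ν z) (a-≁ x≁z)))
      by-cases (yes x~z) (yes nz) = cong (a x z *_) (trans (leaf-≡1 nz (h x~z nz)) (sym (a-~ nz)))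
      by-cases (yes _)   (no ¬nz) = cong (a x z *_) (trans (leaf-not-near ¬nz) (sym (a-≁ ¬nz)))

  leaf-neighbour : ∀ {x y} → x ~ y → Near y → c y ≡ 1 → 1 ≤ leaves x
  leaf-neighbour {x} {y} x~y ny e = subst (_≤ leaves x) (cong₂ _*_ (a-~ x~y) (leaf-≡1 ny e)) (term≤sum (λ z → a x z * leaf z) y)

  no-leaf-neighbours : (∀ x → Near x → c x ≢ 1) → ∀ x → leaves x ≡ 0
  no-leaf-neighbours h x = sum-zero (λ z → a x z * leaf z) λ z → trans (cong (a x z *_) (no-leaf z)) (ℕ.*-zeroʳ (a x z))
    where
    no-leaf : ∀ z → leaf z ≡ 0
    no-leaf z = by-cases (adj? G u z)
      where
      by-cases : Dec (Near z) → leaf z ≡ 0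
      by-cases (yes nz) = leaf-≢1 (h z nz)
      by-cases (no ¬nz) = leaf-not-near ¬nz

  c≡0⇒leaves≡0 : ∀ {x} → c x ≡ 0 → leaves x ≡ 0
  c≡0⇒leaves≡0 {x} e = ℕ.n≤0⇒n≡0 (subst (leaves x ≤_) e (sum-mono-≤ λ z → ℕ.*-monoʳ-≤ (a x z) (leaf≤ν z)))
    where
    leaf≤ν : ∀ z → leaf z ≤ ν z
    leaf≤ν z with c z ℕ.≟ 1
    ... | yes _ = ℕ.≤-refl
    ... | no _  = z≤n

-- With no vertex of degree one, the P₄-free neighbourhood of u is a disjoint
-- union of triangles and isolated vertices.
module Triangles (G : Graph) (free : (V 5 -free) G) (u : Fin (order G)) (no-leaf : ∀ x → Adj G u x → Link.c G u x ≢ 1) where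

  open ≡ using (refl; sym; trans; cong; cong₂; subst; subst₂; module ≡-Reasoning)
  open import Data.Nat.Base using (_+_; _*_; _≤_; _<_)
  open NatSum

  open Link G u
  open FanFree G free u

  tri iso : Vertex → ℕ
  tri x = if ⌊ c x ℕ.≟ 2 ⌋ then ν x else 0
  iso x = if ⌊ c x ℕ.≟ 0 ⌋ then ν x else 0

  OnTriangle : Vertex → Set
  OnTriangle x = Near x × c x ≡ 2

  -- Degree one is excluded by hypothesis, and degree three or more would produce neighbours of
  -- degree one.
  c-cases : ∀ {x} → Near x → c x ≡ 0 ⊎ c x ≡ 2
  c-cases {x} nx = go (c x) refl
    where
    go : ∀ k → c x ≡ k → c x ≡ 0 ⊎ c x ≡ 2
    go 0 e = inj₁ e
    go 1 e = contradiction e (no-leaf x nx)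
    go 2 e = inj₂ e
    go (suc (suc (suc k))) e =
      let 3≤c = subst (3 ≤_) (sym e) (s≤s (s≤s (s≤s z≤n)))
          y , x~y , ny = neighbour x (ℕ.≤-trans (s≤s z≤n) 3≤c)
      in contradiction (large⇒leaves nx 3≤c x~y ny) (no-leaf y ny)

  adjacent⇒onTriangle : ∀ {x y} → Near x → x ~ y → Near y → OnTriangle x
  adjacent⇒onTriangle {x} nx x~y ny with c-cases nx
  ... | inj₁ e = contradiction (subst (1 ≤_) e (1≤c x~y ny)) λ ()
  ... | inj₂ e = nx , e

  tri-≡1 : ∀ {x} → OnTriangle x → tri x ≡ 1
  tri-≡1 {x} (nx , e) with c x ℕ.≟ 2
  ... | yes _ = a-~ nx
  ... | no ¬e = contradiction e ¬e

  0<tri : ∀ {x} → 0 < tri x → OnTriangle x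
  0<tri {x} p with c x ℕ.≟ 2
  ... | yes e = 0<a⇒~ p , e
  0<tri () | no _

  tri-≢2 : ∀ {x} → c x ≢ 2 → tri x ≡ 0
  tri-≢2 {x} ¬e with c x ℕ.≟ 2
  ... | yes e = contradiction e ¬e
  ... | no _  = refl

  tri-not-near : ∀ {x} → ¬ Near x → tri x ≡ 0
  tri-not-near {x} ¬nx with c x ℕ.≟ 2
  ... | yes _ = a-≁ ¬nx
  ... | no _  = refl

  tri≤ν : ∀ x → tri x ≤ ν x
  tri≤ν x with c x ℕ.≟ 2
  ... | yes _ = ℕ.≤-refl
  ... | no _  = z≤n

  tri≤1 : ∀ x → tri x ≤ 1
  tri≤1 x = ℕ.≤-trans (tri≤ν x) (a≤1 u x)

  iso-≡1 : ∀ {x} → Near x → c x ≡ 0 → iso x ≡ 1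
  iso-≡1 {x} nx e with c x ℕ.≟ 0
  ... | yes _ = a-~ nx
  ... | no ¬e = contradiction e ¬e

  iso-≢0 : ∀ {x} → c x ≢ 0 → iso x ≡ 0
  iso-≢0 {x} ¬e with c x ℕ.≟ 0
  ... | yes e = contradiction e ¬e
  ... | no _  = refl

  iso-not-near : ∀ {x} → ¬ Near x → iso x ≡ 0
  iso-not-near {x} ¬nx with c x ℕ.≟ 0
  ... | yes _ = a-≁ ¬nx
  ... | no _  = refl

  n : ℕ
  n = sum tri

  g : Vertex → ℕ
  g w = sum (λ x → a w x * tri x)

  q : ℕ
  q = sum (λ w → ω w * g w)

  g≤c : ∀ w → g w ≤ c w
  g≤c w = sum-mono-≤ λ x → ℕ.*-monoʳ-≤ (a w x) (tri≤ν x)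

  g-centre : g u ≡ n
  g-centre = sum-cong-≗ ν*tri
    where
    ν*tri : ∀ x → ν x * tri x ≡ tri x
    ν*tri x with c x ℕ.≟ 2
    ... | yes _ = νν≡ν x
    ... | no _  = ℕ.*-zeroʳ (ν x)

  g-onTriangle : ∀ {z} → OnTriangle z → g z ≡ 2
  g-onTriangle {z} (nz , e) = trans (sum-cong-≗ λ x → pointwise x (adj? G z x) (adj? G u x)) e
    where
    pointwise : ∀ x → Dec (z ~ x) → Dec (Near x) → a z x * tri x ≡ a z x * ν x
    pointwise x (no z≁x)  _        = trans (cong (_* tri x) (a-≁ z≁x)) (sym (cong (_* ν x) (a-≁ z≁x)))
    pointwise x (yes z~x) (yes nx) = cong (a z x *_) (trans (tri-≡1 (adjacent⇒onTriangle nx (adj-sym G z~x) nz)) (sym (a-~ nx)))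
    pointwise x (yes _)   (no ¬nx) = cong (a z x *_) (trans (tri-not-near ¬nx) (sym (a-≁ ¬nx)))

  -- Indicator of the triangle through x, obtained without choosing its two other vertices.
  triangle : Vertex → Vertex → ℕ
  triangle x z = δ x z + a x z * tri z

  data OnTriangleOf (x z : Vertex) : Set where
    itself : x ≡ z → OnTriangleOf x z
    other  : x ~ z → OnTriangle z → OnTriangleOf x z

  0<triangle : ∀ x z → 0 < triangle x z → OnTriangleOf x z
  0<triangle x z p with x Fin.≟ z
  ... | yes e = itself e
  ... | no ¬e = other (proj₁ facts) (proj₂ facts)
    where
    split : ∀ k l → 0 < k * l → 0 < k × 0 < l
    split (suc k) zero    p = contradiction (subst (0 <_) (ℕ.*-zeroʳ (suc k)) p) λ ()
    split (suc k) (suc l) p = s≤s z≤n , s≤s z≤n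
    facts : x ~ z × OnTriangle z
    facts = let p , q = split (a x z) (tri z) (subst (0 <_) (cong (_+ a x z * tri z) (δ-≢ x z ¬e)) p)
            in 0<a⇒~ p , 0<tri q

  triangle≤1 : ∀ x z → triangle x z ≤ 1
  triangle≤1 x z with x Fin.≟ z
  ... | yes refl = ℕ.≤-reflexive (cong₂ _+_ (δ-refl x) (cong (_* tri x) (a-loop x)))
  ... | no ¬e    = subst (λ k → k + a x z * tri z ≤ 1) (sym (δ-≢ x z ¬e)) (ℕ.*-mono-≤ (a≤1 x z) (tri≤1 z))

  sum-triangle : ∀ {x} → OnTriangle x → sum (triangle x) ≡ 3
  sum-triangle {x} tx = trans (∑-distrib-+ (δ x) (λ z → a x z * tri z)) (cong₂ _+_ (sum-δ₁ x) (g-onTriangle tx))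

  0<triangle⇒tri : ∀ {x} → OnTriangle x → ∀ z → 0 < triangle x z → 0 < tri z
  0<triangle⇒tri tx z p with 0<triangle _ z p
  ... | itself refl = ℕ.≤-reflexive (sym (tri-≡1 tx))
  ... | other _ tz  = ℕ.≤-reflexive (sym (tri-≡1 tz))

  -- Around the hub x, the vertices w y u z form a path.
  far-meets-triangle-once : ∀ {w x y z} → ¬ Near w → u ≢ w → Near x → Near y → Near z →
    x ~ y → y ~ z → x ~ z → w ~ x → w ~ y → ⊥
  far-meets-triangle-once w-far u≢w nx ny nz x~y y~z x~z w~x w~y =
    no-fan (adj-sym G w~x) x~y (adj-sym G nx) x~z w~y (adj-sym G ny) nz
      (λ e → u≢w (sym e)) (λ { refl → w-far nz }) (~⇒≢ y~z)

  -- Double counting: a triangle vertex sees at most one neighbour of w on its own triangle, and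
  -- each neighbour of w on a triangle is seen by all three vertices of that triangle, itself
  -- included.
  3g≤n : ∀ {w} → Far w → 3 * g w ≤ n
  3g≤n {w} (u≢w , w-far) = subst (_≤ n) total (sum-mono-≤ pointwise)
    where
    meets : Vertex → ℕ
    meets x = sum (λ z → triangle x z * a w z)

    positive : ∀ x z → 0 < triangle x z * a w z → OnTriangleOf x z × w ~ z
    positive x z p with adj? G w z
    ... | yes q = 0<triangle x z (subst (0 <_) (ℕ.*-identityʳ (triangle x z)) p) , q
    ... | no _  = contradiction (subst (0 <_) (ℕ.*-zeroʳ (triangle x z)) p) λ ()

    absurd : ∀ {x z z′} → OnTriangle x → z ≢ z′ → OnTriangleOf x z → OnTriangleOf x z′ → w ~ z → w ~ z′ → ⊥
    absurd tx z≢z′ (itself refl) (itself refl) _ _ = z≢z′ refl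
    absurd (nx , cx) z≢z′ (itself refl) (other x~z′ (nz′ , cz′)) w~x w~z′ =
      let t , x~t , z′~t , nt = common-neighbour nx nz′ x~z′ (ℕ.≤-reflexive (sym cx)) (ℕ.≤-reflexive (sym cz′))
      in far-meets-triangle-once w-far u≢w nx nz′ nt x~z′ z′~t x~t w~x w~z′
    absurd tx z≢z′ (other x~z tz) (itself refl) w~z w~x =
      absurd tx (λ e → z≢z′ (sym e)) (itself refl) (other x~z tz) w~x w~z
    absurd {x} {z} {z′} (nx , cx) z≢z′ (other x~z (nz , cz)) (other x~z′ (nz′ , cz′)) w~z w~z′
      with common-neighbour nx nz x~z (ℕ.≤-reflexive (sym cx)) (ℕ.≤-reflexive (sym cz))
    ... | t , x~t , z~t , nt with z′ Fin.≟ t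
    ...   | yes refl = far-meets-triangle-once w-far u≢w nz nz′ nx z~t (adj-sym G x~t) (adj-sym G x~z) w~z w~z′
    ...   | no z′≢t  = no-path nz′ nx nz nt (adj-sym G x~z′) x~z z~t (λ e → z≢z′ (sym e)) z′≢t (~⇒≢ x~t)

    meets≤1 : ∀ {x} → OnTriangle x → meets x ≤ 1
    meets≤1 {x} tx = ℕ.≮⇒≥ λ 2≤ →
      let z , z′ , z≢z′ , p , p′ = two-terms (λ z → triangle x z * a w z) (λ z → ℕ.*-mono-≤ (triangle≤1 x z) (a≤1 w z)) 2≤
          on , w~z = positive x z p
          on′ , w~z′ = positive x z′ p′
      in absurd tx z≢z′ on on′ w~z w~z′

    pointwise : ∀ x → tri x * meets x ≤ tri x
    pointwise x with tri x in eq
    ... | zero  = z≤n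
    ... | suc k = ℕ.≤-trans (ℕ.*-monoʳ-≤ (suc k) (meets≤1 (0<tri (subst (0 <_) (sym eq) (s≤s z≤n)))))
                    (ℕ.≤-reflexive (ℕ.*-identityʳ (suc k)))

    open ≡-Reasoning

    swap : sum (λ x → tri x * sum (λ z → a x z * tri z * a w z)) ≡ 2 * g w
    swap = begin
      sum (λ x → tri x * sum (λ z → a x z * tri z * a w z))
        ≡⟨ sum-cong-≗ (λ x → *-distribˡ-sum (tri x) (λ z → a x z * tri z * a w z)) ⟩
      sum (λ x → sum (λ z → tri x * (a x z * tri z * a w z)))
        ≡⟨ ∑-comm (λ x z → tri x * (a x z * tri z * a w z)) ⟩
      sum (λ z → sum (λ x → tri x * (a x z * tri z * a w z)))
        ≡⟨ sum-cong-≗ (λ z → trans (sum-cong-≗ (reorder z)) (sym (*-distribˡ-sum (a w z * tri z) (λ x → a z x * tri x)))) ⟩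
      sum (λ z → a w z * tri z * g z)
        ≡⟨ sum-cong-≗ (λ z → degree-two z) ⟩
      sum (λ z → 2 * (a w z * tri z))
        ≡⟨ *-distribˡ-sum 2 (λ z → a w z * tri z) ⟨
      2 * g w ∎
      where
      reorder : ∀ z x → tri x * (a x z * tri z * a w z) ≡ a w z * tri z * (a z x * tri x)
      reorder z x = trans (cong (λ k → tri x * (k * tri z * a w z)) (a-sym x z))
        (solve 4 (λ p q r s → p :* (q :* r :* s) := s :* r :* (q :* p)) refl (tri x) (a z x) (tri z) (a w z))
        where open ℕ-Solver.+-*-Solver
      degree-two : ∀ z → a w z * tri z * g z ≡ 2 * (a w z * tri z)
      degree-two z = by-cases (c z ℕ.≟ 2) (adj? G u z)
        where
        zero-case : tri z ≡ 0 → a w z * tri z * g z ≡ 2 * (a w z * tri z)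
        zero-case e = trans (cong (_* g z) e′) (sym (cong (2 *_) e′))
          where
          e′ : a w z * tri z ≡ 0
          e′ = trans (cong (a w z *_) e) (ℕ.*-zeroʳ (a w z))
        by-cases : Dec (c z ≡ 2) → Dec (Near z) → a w z * tri z * g z ≡ 2 * (a w z * tri z)
        by-cases (yes e) (yes nz) = trans (cong (a w z * tri z *_) (g-onTriangle (nz , e))) (ℕ.*-comm (a w z * tri z) 2)
        by-cases (yes _) (no ¬nz) = zero-case (tri-not-near ¬nz)
        by-cases (no ¬e) _        = zero-case (tri-≢2 ¬e)

    total : sum (λ x → tri x * meets x) ≡ 3 * g w
    total = begin
      sum (λ x → tri x * meets x)
        ≡⟨ sum-cong-≗ (λ x → trans (cong (tri x *_) (trans
             (sum-cong-≗ (λ z → ℕ.*-distribʳ-+ (a w z) (δ x z) (a x z * tri z)))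
             (trans (∑-distrib-+ (λ z → δ x z * a w z) (λ z → a x z * tri z * a w z))
                    (cong (_+ sum (λ z → a x z * tri z * a w z)) (sum-δ x (a w))))))
             (ℕ.*-distribˡ-+ (tri x) (a w x) (sum (λ z → a x z * tri z * a w z)))) ⟩
      sum (λ x → tri x * a w x + tri x * sum (λ z → a x z * tri z * a w z))
        ≡⟨ ∑-distrib-+ (λ x → tri x * a w x) (λ x → tri x * sum (λ z → a x z * tri z * a w z)) ⟩
      sum (λ x → tri x * a w x) + sum (λ x → tri x * sum (λ z → a x z * tri z * a w z))
        ≡⟨ cong₂ _+_ (sum-cong-≗ (λ x → ℕ.*-comm (tri x) (a w x))) swap ⟩
      3 * g w ∎

  triangle≤tri : ∀ {x} → OnTriangle x → ∀ z → triangle x z ≤ tri z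
  triangle≤tri {x} tx z with triangle x z in eq
  ... | zero = z≤n
  ... | suc k = ℕ.≤-trans (subst (_≤ 1) eq (triangle≤1 x z)) (0<triangle⇒tri tx z (subst (0 <_) (sym eq) (s≤s z≤n)))

  -- The indicators of the two triangles are disjoint and each sums to 3. A common vertex y would
  -- give the path z y x t, with t a common neighbour of x and y.
  two-triangles : ∀ {x z} → OnTriangle x → OnTriangle z → triangle x z ≡ 0 → 6 ≤ n
  two-triangles {x} {z} tx tz outside =
    subst (_≤ n) (trans (∑-distrib-+ (triangle x) (triangle z)) (cong₂ _+_ (sum-triangle tx) (sum-triangle tz)))
      (sum-mono-≤ both≤tri)
    where
    x≢z : x ≢ z
    x≢z refl = contradiction (trans (sym (δ-refl z)) (ℕ.m+n≡0⇒m≡0 (δ z z) outside)) λ ()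
    x≁z : ¬ x ~ z
    x≁z x~z = contradiction (trans (sym (cong₂ _*_ (a-~ x~z) (tri-≡1 tz))) (ℕ.m+n≡0⇒n≡0 (δ x z) outside)) λ ()
    disjoint : ∀ {y} → OnTriangleOf x y → OnTriangleOf z y → ⊥
    disjoint (itself refl)  (itself refl)  = x≢z refl
    disjoint (itself refl)  (other z~x _)  = x≁z (adj-sym G z~x)
    disjoint (other x~z _)  (itself refl)  = x≁z x~z
    disjoint (other x~y ty) (other z~y _) =
      let t , x~t , y~t , nt = common-neighbour (proj₁ tx) (proj₁ ty) x~y (ℕ.≤-reflexive (sym (proj₂ tx))) (ℕ.≤-reflexive (sym (proj₂ ty)))
      in no-path (proj₁ tz) (proj₁ ty) (proj₁ tx) nt z~y (adj-sym G x~y) x~t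
           (λ e → x≢z (sym e)) (λ { refl → x≁z x~t }) (~⇒≢ y~t)
    both≤tri : ∀ y → triangle x y + triangle z y ≤ tri y
    both≤tri y with triangle x y in eqˣ | triangle z y in eqᶻ
    ... | zero  | _     = subst (_≤ tri y) eqᶻ (triangle≤tri tz y)
    ... | suc k | zero  = subst (_≤ tri y) (trans eqˣ (sym (ℕ.+-identityʳ (suc k)))) (triangle≤tri tx y)
    ... | suc k | suc l = ⊥-elim (disjoint (0<triangle x y (subst (0 <_) (sym eqˣ) (s≤s z≤n)))
                                           (0<triangle z y (subst (0 <_) (sym eqᶻ) (s≤s z≤n))))

  -- The triangle of a first vertex accounts for 3; any surplus is a triangle vertex outside it, and
  -- its triangle brings three more.
  n-cases : n ≡ 0 ⊎ n ≡ 3 ⊎ 6 ≤ n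
  n-cases with n ℕ.≟ 0 | n ℕ.≟ 3
  ... | yes n≡0 | _       = inj₁ n≡0
  ... | no _    | yes n≡3 = inj₂ (inj₁ n≡3)
  ... | no n≢0  | no n≢3  =
    let x , 0<tri-x = sum-<-witness (λ _ → 0) tri
                        (subst (_< n) (sym (sum-zero {order G} (λ _ → 0) λ _ → refl)) (ℕ.n≢0⇒n>0 n≢0))
        tx = 0<tri 0<tri-x
        z , p = sum-<-witness (triangle x) tri
                  (ℕ.≤∧≢⇒< (sum-mono-≤ (triangle≤tri tx)) λ e → n≢3 (trans (sym e) (sum-triangle tx)))
    in inj₂ (inj₂ (two-triangles tx (0<tri (ℕ.≤-<-trans z≤n p))
         (ℕ.n≤0⇒n≡0 (ℕ.≤-pred (ℕ.<-≤-trans p (tri≤1 z))))))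

  2tri≤νc : ∀ x → 2 * tri x ≤ ν x * c x
  2tri≤νc x with c x ℕ.≟ 2
  ... | yes e = ℕ.≤-reflexive (trans (ℕ.*-comm 2 (ν x)) (cong (ν x *_) (sym e)))
  ... | no _  = z≤n

  -- This is m ≥ 2n + q, doubled: n edges at u, n edges inside the triangles, q edges from the
  -- triangles to far vertices.
  edge-count : 4 * n + 2 * q ≤ sum degree
  edge-count = ℕ.+-cancelʳ-≤ (sum (λ x → ν x * c x)) (4 * n + 2 * q) (sum degree) (begin
    4 * n + 2 * q + Νc                   ≡⟨ regroup n q Νc ⟩
    2 * n + 2 * n + 2 * q + Νc           ≤⟨ ℕ.+-monoˡ-≤ Νc (ℕ.+-mono-≤ (ℕ.+-mono-≤ (ℕ.*-monoʳ-≤ 2 n≤ν) 2n≤Νc) (ℕ.*-monoʳ-≤ 2 q≤Ωc)) ⟩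
    2 * sum ν + Νc + 2 * Ωc + Νc         ≡⟨ regroup′ (sum ν) Νc Ωc ⟩
    2 * (sum ν + Νc + Ωc)                ≡⟨ cong (2 *_) sum-c ⟨
    2 * sum c                            ≤⟨ ℕ.m≤m+n (2 * sum c) farEdgeEnds ⟩
    2 * sum c + farEdgeEnds              ≡⟨ sum-degree ⟨
    sum degree + Νc                      ∎)
    where
    open ℕ.≤-Reasoning
    Νc Ωc : ℕ
    Νc = sum (λ x → ν x * c x)
    Ωc = sum (λ x → ω x * c x)
    n≤ν : n ≤ sum ν
    n≤ν = sum-mono-≤ tri≤ν
    2n≤Νc : 2 * n ≤ Νc
    2n≤Νc = ℕ.≤-trans (ℕ.≤-reflexive (*-distribˡ-sum 2 tri)) (sum-mono-≤ 2tri≤νc)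
    q≤Ωc : q ≤ Ωc
    q≤Ωc = sum-mono-≤ λ w → ℕ.*-monoʳ-≤ (ω w) (g≤c w)
    open ℕ-Solver.+-*-Solver
    regroup : ∀ n q k → 4 * n + 2 * q + k ≡ 2 * n + 2 * n + 2 * q + k
    regroup = solve 3 (λ n q k → con 4 :* n :+ con 2 :* q :+ k := con 2 :* n :+ con 2 :* n :+ con 2 :* q :+ k) refl
    regroup′ : ∀ v k w → 2 * v + k + 2 * w + k ≡ 2 * (v + k + w)
    regroup′ = solve 3 (λ v k w → con 2 :* v :+ k :+ con 2 :* w :+ k := con 2 :* (v :+ k :+ w)) refl

-- Polynomial inequalities that exclude the triangle case

module LambdaBounds (O : OrderedRing) where

  open OrderedRingProperties O

  -- The constant 7 is 8 - 1: it comes from L² - L ≥ m - 1 and m ≥ 8.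
  record LargeRoot (L : Carrier) : Set where
    field
      1≤L      : ι 1 ≤ L
      7≤L[L-1] : ι 7 ≤ L * L - L

    0≤p : 0# ≤ (L * L - L) - ι 7
    0≤p = ≤⇒0≤- 7≤L[L-1]

    0≤L-1 : 0# ≤ L - ι 1
    0≤L-1 = ≤⇒0≤- 1≤L

    0≤L : 0# ≤ L
    0≤L = ≤-trans (0≤ι 1) 1≤L

    3<L : ι 3 < L
    3<L L≤3 = pos+nonNeg≉0 (0<ι 0)
      (+-nonNeg (+-nonNeg 0≤p (*-nonNeg 0≤L (≤⇒0≤- L≤3))) (*-nonNeg (0≤ι 2) (≤⇒0≤- L≤3)))
      (solve 1 (λ L → :ι 1 :+ ((L :* L :- L) :- :ι 7 :+ L :* (:ι 3 :- L) :+ :ι 2 :* (:ι 3 :- L)) := :ι 0) refl L)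

    0<L-3 : 0# < L - ι 3
    0<L-3 p = 3<L (≤-by (≤⇒0≤- p) (solve 1 (λ L → :ι 3 :- L := :ι 0 :- (L :- :ι 3)) refl L))

    0≤L-3 : 0# ≤ L - ι 3
    0≤L-3 = <⇒≤ 0<L-3

    0<L-2 : 0# < L - ι 2
    0<L-2 p = +-pos-nonNeg 0<L-3 (0≤ι 1) (≤-trans (≤-reflexive (solve 1 (λ L → (L :- :ι 3) :+ :ι 1 := L :- :ι 2) refl L)) p)

    0≤L-2 : 0# ≤ L - ι 2
    0≤L-2 = <⇒≤ 0<L-2

    0<L : 0# < L
    0<L = <-≤-trans (0<ι 0) 1≤L

    0<L-1 : 0# < L - ι 1
    0<L-1 p = 0<L-2 (≤-trans (≤-by (0≤ι 1) (solve 1 (λ L → (L :- :ι 1) :- (L :- :ι 2) := :ι 1) refl L)) p)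

    -- Write k for the expression. If k ≤ 0, then L² - L ≥ 7 gives 5L ≥ 16, while division with
    -- remainder gives 25k = (15L + 8)(5L - 16) + 3 > 0.
    0<3L²-8L-5 : 0# < ι 3 * (L * L) - ι 8 * L - ι 5
    0<3L²-8L-5 k≤0 = pos+nonNeg≉0 (0<ι 2)
      (+-nonNeg
        (*-nonNeg (+-nonNeg (*-nonNeg (0≤ι 15) 0≤L) (0≤ι 8)) (+-nonNeg (*-nonNeg (0≤ι 3) 0≤p) 0≤-k))
        (*-nonNeg (0≤ι 25) 0≤-k))
      (solve 1 (λ L → let k = :ι 0 :- (:ι 3 :* (L :* L) :- :ι 8 :* L :- :ι 5) in
        :ι 3 :+ ((:ι 15 :* L :+ :ι 8) :* (:ι 3 :* ((L :* L :- L) :- :ι 7) :+ k) :+ :ι 25 :* k) := :ι 0) refl L)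
      where
      0≤-k : 0# ≤ 0# - (ι 3 * (L * L) - ι 8 * L - ι 5)
      0≤-k = ≤⇒0≤- k≤0

  -- The case of a neighbourhood made of triangles and isolated vertices: n counts
  -- the triangle vertices and Y is their total weight, q counts their edges to
  -- vertices outside the closed neighbourhood and Q is the weight at the far ends,
  -- T is twice the weight of the isolated vertices plus the far edges.
  record TriangleWeights (L M Y T Q : Carrier) (n q : ℕ) : Set where
    field
      large  : LargeRoot L
      0<M    : 0# < M
      0≤T    : 0# ≤ T
      Y≤nM   : Y ≤ ι n * M
      Q≤qM   : Q ≤ ι q * M
      budget : T + ι 2 * (ι n * M - Y) + ι 2 * (ι q * M - Q) ≤ ι 2 * M
      total  : ι 2 * (L * M) ≤ ι 2 * Y + T
      inner  : L * Y ≤ ι n * M + ι 2 * Y + Q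
      outer  : ι 6 * (L * Q) ≤ ι q * (ι 2 * (ι n * M) + ι 3 * T)
      edges  : ι 2 * ι n + ι q ≤ L * L - L + ι 1

    open LargeRoot large public
    0≤M : 0# ≤ M
    0≤M = <⇒≤ 0<M
    0≤B : 0# ≤ ι n * M - Y
    0≤B = ≤⇒0≤- Y≤nM
    0≤R : 0# ≤ ι q * M - Q
    0≤R = ≤⇒0≤- Q≤qM
    A₁ : 0# ≤ ι 2 * M - (T + ι 2 * (ι n * M - Y) + ι 2 * (ι q * M - Q))
    A₁ = ≤⇒0≤- budget
    A₂ : 0# ≤ (ι 2 * Y + T) - ι 2 * (L * M)
    A₂ = ≤⇒0≤- total
    A₃ : 0# ≤ (ι n * M + ι 2 * Y + Q) - L * Y
    A₃ = ≤⇒0≤- inner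
    A₄ : 0# ≤ ι q * (ι 2 * (ι n * M) + ι 3 * T) - ι 6 * (L * Q)
    A₄ = ≤⇒0≤- outer
    A₅ : 0# ≤ (L * L - L + ι 1) - (ι 2 * ι n + ι q)
    A₅ = ≤⇒0≤- edges

  -- Here Y ≤ 0, so `total` and `budget` give 2LM ≤ T + 2Y ≤ 2M + 4Y ≤ 2M, that is L ≤ 1.
  no-triangle-absurd : ∀ {L M Y T Q q} → TriangleWeights L M Y T Q 0 q → ⊥
  no-triangle-absurd {L} {M} {Y} {T} {Q} {q} W =
    pos+nonNeg≉0 (*-pos 0<L-3 0<M)
      (+-nonNeg (+-nonNeg (+-nonNeg (+-nonNeg (+-nonNeg A₁ A₂) (*-nonNeg (0≤ι 4) 0≤B)) (*-nonNeg (0≤ι 2) 0≤R)) (*-nonNeg 0≤L-3 0≤M)) (*-nonNeg (0≤ι 4) 0≤M))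
      (solve 6 (λ L M Y T Q q →
        (L :- :ι 3) :* M :+ ((:ι 2 :* M :- (T :+ :ι 2 :* (:ι 0 :* M :- Y) :+ :ι 2 :* (q :* M :- Q)))
          :+ ((:ι 2 :* Y :+ T) :- :ι 2 :* (L :* M)) :+ :ι 4 :* (:ι 0 :* M :- Y) :+ :ι 2 :* (q :* M :- Q)
          :+ (L :- :ι 3) :* M :+ :ι 4 :* M) := :ι 0) refl L M Y T Q (ι q))
    where open TriangleWeights W

  -- Here Q ≤ 0. Then `budget` and `total` give (L + 2)M ≤ 2Y, and `inner` gives (L - 2)Y ≤ 3M.
  -- Hence L² ≤ 10, whereas L² ≥ L + 7 > 10.
  one-triangle-absurd₀ : ∀ {L M Y T Q} → TriangleWeights L M Y T Q 3 0 → ⊥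
  one-triangle-absurd₀ {L} {M} {Y} {T} {Q} W =
    pos+nonNeg≉0 (*-pos (0<ι 1) (*-pos 0<L-3 0<M))
      (+-nonNeg (+-nonNeg (+-nonNeg (*-nonNeg (0≤ι 2) (*-nonNeg 0≤p 0≤M)) (*-nonNeg (0≤ι 4) A₃))
        (*-nonNeg 0≤L-2 (+-nonNeg A₁ A₂))) (*-nonNeg (*-nonNeg (0≤ι 2) 0≤L) 0≤R))
      (solve 5 (λ L M Y T Q →
        :ι 2 :* ((L :- :ι 3) :* M) :+ (:ι 2 :* (((L :* L :- L) :- :ι 7) :* M)
          :+ :ι 4 :* ((:ι 3 :* M :+ :ι 2 :* Y :+ Q) :- L :* Y)
          :+ (L :- :ι 2) :* ((:ι 2 :* M :- (T :+ :ι 2 :* (:ι 3 :* M :- Y) :+ :ι 2 :* (:ι 0 :* M :- Q))) :+ ((:ι 2 :* Y :+ T) :- :ι 2 :* (L :* M)))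
          :+ :ι 2 :* L :* (:ι 0 :* M :- Q)) := :ι 0) refl L M Y T Q)
    where open TriangleWeights W

  -- The tight case. Y cancels in 2a₃ + (L - 2)a₁ and in (L - 2)(a₁ + a₂) + 4a₃; multiples of a₄
  -- then remove Q. What remains has coefficient -3L(L - 3) at T, and at M it becomes -6(3L² - 8L -
  -- 5) once six times L² - L - 7 is added.
  one-triangle-absurd₁ : ∀ {L M Y T Q} → TriangleWeights L M Y T Q 3 1 → ⊥
  one-triangle-absurd₁ {L} {M} {Y} {T} {Q} W =
    pos+nonNeg≉0 (*-pos (0<ι 5) (*-pos 0<3L²-8L-5 0<M))
      (+-nonNeg (+-nonNeg (+-nonNeg
        (+-nonNeg (*-nonNeg 0≤L (*-nonNeg (0≤ι 3) (+-nonNeg (*-nonNeg (0≤ι 2) A₃) (*-nonNeg 0≤L-2 A₁)))) (*-nonNeg 0≤L-1 A₄))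
        (*-nonNeg (0≤ι 3) (*-nonNeg (*-nonNeg 0≤L 0≤L-3) 0≤T)))
        (+-nonNeg (*-nonNeg (0≤ι 3) (+-nonNeg (*-nonNeg 0≤L-2 (+-nonNeg A₁ A₂)) (*-nonNeg (0≤ι 4) A₃))) A₄))
        (*-nonNeg (0≤ι 6) (*-nonNeg 0≤p 0≤M)))
      (solve 5 (λ L M Y T Q →
        let a₁ = :ι 2 :* M :- (T :+ :ι 2 :* (:ι 3 :* M :- Y) :+ :ι 2 :* (:ι 1 :* M :- Q))
            a₂ = (:ι 2 :* Y :+ T) :- :ι 2 :* (L :* M)
            a₃ = (:ι 3 :* M :+ :ι 2 :* Y :+ Q) :- L :* Y
            a₄ = :ι 1 :* (:ι 2 :* (:ι 3 :* M) :+ :ι 3 :* T) :- :ι 6 :* (L :* Q)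
        in
        :ι 6 :* ((:ι 3 :* (L :* L) :- :ι 8 :* L :- :ι 5) :* M)
          :+ ((L :* (:ι 3 :* (:ι 2 :* a₃ :+ (L :- :ι 2) :* a₁)) :+ (L :- :ι 1) :* a₄)
          :+ :ι 3 :* ((L :* (L :- :ι 3)) :* T)
          :+ (:ι 3 :* ((L :- :ι 2) :* (a₁ :+ a₂) :+ :ι 4 :* a₃) :+ a₄)
          :+ :ι 6 :* (((L :* L :- L) :- :ι 7) :* M)) := :ι 0) refl L M Y T Q)
    where
    open TriangleWeights W

  -- `budget` gives Q ≥ (q - 1)M + T/2 and T ≤ 2M, and `outer` reads 6LQ ≤ 6qM + 3qT. The combined
  -- inequality is linear in T, and for q ≥ 2 it would force L ≤ 2 both at T = 0 and at T = 2M.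
  one-triangle-absurd₂ : ∀ {L M Y T Q q} → TriangleWeights L M Y T Q 3 q → 2 ℕ.≤ q → ⊥
  one-triangle-absurd₂ {L} {M} {Y} {T} {Q} {q} W 2≤q =
    pos+nonNeg≉0 (*-pos (0<ι 5) (*-pos 0<L-2 0<M))
      (+-nonNeg (+-nonNeg (+-nonNeg
        (*-nonNeg (0≤ι 3) (*-nonNeg (*-nonNeg 0≤q-2 0≤L-1) 0≤Z))
        (*-nonNeg (0≤ι 3) (*-nonNeg 0≤T (*-nonNeg (+-nonNeg 0≤q-2 (0≤ι 1)) 0≤L-2))))
        (*-nonNeg (*-nonNeg (0≤ι 3) 0≤L) (+-nonNeg A₁ (*-nonNeg (0≤ι 2) 0≤B)))) A₄)
      (solve 6 (λ L M Y T Q q →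
        let B = :ι 3 :* M :- Y
            R = q :* M :- Q
            a₁ = :ι 2 :* M :- (T :+ :ι 2 :* B :+ :ι 2 :* R)
        in
        :ι 6 :* ((L :- :ι 2) :* M) :+
          (:ι 3 :* (((q :- :ι 2) :* (L :- :ι 1)) :* (a₁ :+ :ι 2 :* B :+ :ι 2 :* R))
          :+ :ι 3 :* (T :* (((q :- :ι 2) :+ :ι 1) :* (L :- :ι 2)))
          :+ :ι 3 :* L :* (a₁ :+ :ι 2 :* B)
          :+ (q :* (:ι 2 :* (:ι 3 :* M) :+ :ι 3 :* T) :- :ι 6 :* (L :* Q))) := :ι 0) refl L M Y T Q (ι q))
    where
    open TriangleWeights W
    0≤q-2 : 0# ≤ ι q - ι 2
    0≤q-2 = ≤⇒0≤- (ι-mono-≤ 2≤q)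
    0≤Z : 0# ≤ (ι 2 * M - (T + ι 2 * (ι 3 * M - Y) + ι 2 * (ι q * M - Q))) + ι 2 * (ι 3 * M - Y) + ι 2 * (ι q * M - Q)
    0≤Z = +-nonNeg (+-nonNeg A₁ (*-nonNeg (0≤ι 2) 0≤B)) (*-nonNeg (0≤ι 2) 0≤R)

  -- `inner` and `budget` give (L - 2)(n - 1) ≤ n + q. Adding `edges` yields (L - 1)(L - n + 1) ≥ 0,
  -- so n ≤ L + 1 and q ≥ n² - 5n + 3, which is at least 9 for n ≥ 6. But `outer` and `budget` give
  -- q(3L - n - 3) ≤ 3L, where 3L - n - 3 ≥ 2L - 4 and L ≥ 5.
  many-triangles-absurd : ∀ {L M Y T Q n q} → TriangleWeights L M Y T Q n q → 6 ℕ.≤ n → ⊥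
  many-triangles-absurd {L} {M} {Y} {T} {Q} {n} {q} W 6≤n =
    pos+nonNeg≉0 (0<ι 38)
      (+-nonNeg (+-nonNeg (+-nonNeg (*-nonNeg (0≤ι 24) 0≤L-n+1) (*-nonNeg (0≤ι 15) 0≤n-6)) (*-nonNeg 0≤q-9 0≤X)) 0≤H)
      (solve 3 (λ L n q →
        :ι 39 :+ (:ι 24 :* (L :- n :+ :ι 1) :+ :ι 15 :* (n :- :ι 6)
          :+ (q :- :ι 9) :* (:ι 3 :* (L :- n :+ :ι 1) :+ :ι 2 :* (n :- :ι 6) :+ :ι 6)
          :+ (:ι 3 :* L :- q :* (:ι 3 :* L :- n :- :ι 3))) := :ι 0) refl L (ι n) (ι q))
    where
    open TriangleWeights W
    n′ q′ : Carrier
    n′ = ι n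
    q′ = ι q
    0≤n-6 : 0# ≤ n′ - ι 6
    0≤n-6 = ≤⇒0≤- (ι-mono-≤ 6≤n)
    0≤F : 0# ≤ (n′ + q′) - (L - ι 2) * (n′ - ι 1)
    0≤F = *-cancelˡ-nonNeg (*-pos (0<ι 1) 0<M) (≤-respʳ
      (solve 7 (λ L M Y T Q n q →
        let B = n :* M :- Y
            R = q :* M :- Q
            a₁ = :ι 2 :* M :- (T :+ :ι 2 :* B :+ :ι 2 :* R)
        in :ι 2 :* ((n :* M :+ :ι 2 :* Y :+ Q) :- L :* Y) :+ (L :- :ι 2) :* (a₁ :+ T :+ :ι 2 :* R) :+ :ι 2 :* R
           := (:ι 2 :* M) :* ((n :+ q) :- (L :- :ι 2) :* (n :- :ι 1))) refl L M Y T Q n′ q′)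
      (+-nonNeg (+-nonNeg (*-nonNeg (0≤ι 2) A₃) (*-nonNeg 0≤L-2 (+-nonNeg (+-nonNeg A₁ 0≤T) (*-nonNeg (0≤ι 2) 0≤R)))) (*-nonNeg (0≤ι 2) 0≤R)))
    0≤L-n+1 : 0# ≤ L - n′ + ι 1
    0≤L-n+1 = *-cancelˡ-nonNeg 0<L-1 (≤-respʳ
      (solve 3 (λ L n q →
        ((L :* L :- L :+ :ι 1) :- (:ι 2 :* n :+ q)) :+ ((n :+ q) :- (L :- :ι 2) :* (n :- :ι 1)) := (L :- :ι 1) :* (L :- n :+ :ι 1)) refl L n′ q′)
      (+-nonNeg A₅ 0≤F))
    0≤q-9 : 0# ≤ q′ - ι 9
    0≤q-9 = ≤-respʳ
      (solve 3 (λ L n q → ((n :+ q) :- (L :- :ι 2) :* (n :- :ι 1)) :+ (L :- n :+ :ι 1) :* ((n :- :ι 6) :+ :ι 5) :+ (n :- :ι 6) :* (n :+ :ι 1)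
        := q :- :ι 9) refl L n′ q′)
      (+-nonNeg (+-nonNeg 0≤F (*-nonNeg 0≤L-n+1 (+-nonNeg 0≤n-6 (0≤ι 5)))) (*-nonNeg 0≤n-6 (+-nonNeg (0≤ι n) (0≤ι 1))))
    0≤X : 0# ≤ ι 3 * (L - n′ + ι 1) + ι 2 * (n′ - ι 6) + ι 6
    0≤X = +-nonNeg (+-nonNeg (*-nonNeg (0≤ι 3) 0≤L-n+1) (*-nonNeg (0≤ι 2) 0≤n-6)) (0≤ι 6)
    0≤H : 0# ≤ ι 3 * L - q′ * (ι 3 * L - n′ - ι 3)
    0≤H = *-cancelˡ-nonNeg (*-pos (0<ι 1) 0<M) (≤-respʳ
      (solve 7 (λ L M Y T Q n q →
        let B = n :* M :- Y
            R = q :* M :- Q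
            a₁ = :ι 2 :* M :- (T :+ :ι 2 :* B :+ :ι 2 :* R)
        in :ι 3 :* L :* (a₁ :+ T :+ :ι 2 :* B) :+ (q :* (:ι 2 :* (n :* M) :+ :ι 3 :* T) :- :ι 6 :* (L :* Q)) :+ :ι 3 :* q :* (a₁ :+ :ι 2 :* B :+ :ι 2 :* R)
           := (:ι 2 :* M) :* (:ι 3 :* L :- q :* (:ι 3 :* L :- n :- :ι 3))) refl L M Y T Q n′ q′)
      (+-nonNeg (+-nonNeg (*-nonNeg (*-nonNeg (0≤ι 3) 0≤L) (+-nonNeg (+-nonNeg A₁ 0≤T) (*-nonNeg (0≤ι 2) 0≤B))) A₄)
        (*-nonNeg (*-nonNeg (0≤ι 3) (0≤ι q)) (+-nonNeg (+-nonNeg A₁ (*-nonNeg (0≤ι 2) 0≤B)) (*-nonNeg (0≤ι 2) 0≤R)))))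

-- Finite sums with integer weights in an ordered ring

module WeightedSums (O : OrderedRing) where

  open OrderedRingProperties O
  open NatSum using (δ; δ-disjoint₂; δ-disjoint₃)

  ι-sum : ∀ {n} (f : Fin n → ℕ) → ι (NatSum.sum f) ≈ sum (λ i → ι (f i))
  ι-sum {zero}  f = refl
  ι-sum {suc n} f = trans (ι-+ (f zero) _) (+-congˡ (ι-sum (λ i → f (suc i))))

  sum-cong : ∀ {n} {f g : Fin n → Carrier} → (∀ i → f i ≈ g i) → sum f ≈ sum g
  sum-cong {f = f} {g} = sum-cong-≋ {x = f} {y = g}

  sum-axpy : ∀ {n} (k : Carrier) (f g : Fin n → Carrier) → sum (λ i → k * f i + g i) ≈ k * sum f + sum g
  sum-axpy k f g = trans (∑-distrib-+ (λ i → k * f i) g) (+-congʳ (sym (*-distribˡ-sum k f)))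

  sum-*ˡ : ∀ {n} (k : Carrier) (f : Fin n → Carrier) → sum (λ i → k * f i) ≈ k * sum f
  sum-*ˡ k f = sym (*-distribˡ-sum k f)

  sum-ι* : ∀ {n} (f : Fin n → ℕ) (k : Carrier) → sum (λ i → ι (f i) * k) ≈ ι (NatSum.sum f) * k
  sum-ι* f k = trans (sym (*-distribʳ-sum k (λ i → ι (f i)))) (*-congʳ (sym (ι-sum f)))

  sum-zero : ∀ {n} (f : Fin n → Carrier) → (∀ i → f i ≈ 0#) → sum f ≈ 0#
  sum-zero {zero}  f p = refl
  sum-zero {suc n} f p = trans (+-cong (p zero) (sum-zero (λ i → f (suc i)) (λ i → p (suc i)))) (+-identityˡ 0#)

  sum-δ : ∀ {n} (i : Fin n) (f : Fin n → Carrier) → sum (λ j → ι (δ i j) * f j) ≈ f i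
  sum-δ {suc n} zero f = trans (+-cong (trans (*-congʳ ι-1) (*-identityˡ (f zero)))
    (sum-zero (λ j → 0# * f (suc j)) (λ j → zeroˡ (f (suc j))))) (+-identityʳ (f zero))
  sum-δ (suc i) f = trans (+-cong (zeroˡ (f zero)) (sum-δ i (λ j → f (suc j)))) (+-identityˡ (f (suc i)))

  ι*≤ : ∀ {k x} → k ℕ.≤ 1 → 0# ≤ x → ι k * x ≤ x
  ι*≤ {zero}        {x} _  0≤x = ≤-respˡ (sym (zeroˡ x)) 0≤x
  ι*≤ {suc zero}    {x} _  0≤x = ≤-reflexive (trans (*-congʳ ι-1) (*-identityˡ x))
  ι*≤ {suc (suc k)} (s≤s ())

  two-terms≤sum : ∀ {n} (f : Fin n → Carrier) → (∀ i → 0# ≤ f i) → ∀ {i j} → i ≢ j → f i + f j ≤ sum f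
  two-terms≤sum f 0≤f {i} {j} i≢j = ≤-respˡ total (sum-mono-≤ λ k → ι*≤ (δ-disjoint₂ i≢j k) (0≤f k))
    where
    total : sum (λ k → ι (δ i k ℕ.+ δ j k) * f k) ≈ f i + f j
    total = trans (sum-cong (λ k → trans (*-congʳ (ι-+ (δ i k) (δ j k))) (distribʳ (f k) (ι (δ i k)) (ι (δ j k)))))
      (trans (∑-distrib-+ (λ k → ι (δ i k) * f k) (λ k → ι (δ j k) * f k)) (+-cong (sum-δ i f) (sum-δ j f)))

  three-terms≤sum : ∀ {n} (f : Fin n → Carrier) → (∀ i → 0# ≤ f i) →
                    ∀ {i j k} → i ≢ j → i ≢ k → j ≢ k → (f i + f j) + f k ≤ sum f
  three-terms≤sum f 0≤f {i} {j} {k} i≢j i≢k j≢k =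
    ≤-respˡ total (sum-mono-≤ λ l → ι*≤ (δ-disjoint₃ i≢j i≢k j≢k l) (0≤f l))
    where
    total : sum (λ l → ι (δ i l ℕ.+ δ j l ℕ.+ δ k l) * f l) ≈ (f i + f j) + f k
    total = trans (sum-cong (λ l → trans (*-congʳ (trans (ι-+ (δ i l ℕ.+ δ j l) (δ k l)) (+-congʳ (ι-+ (δ i l) (δ j l)))))
                     (trans (distribʳ (f l) (ι (δ i l) + ι (δ j l)) (ι (δ k l))) (+-congʳ (distribʳ (f l) (ι (δ i l)) (ι (δ j l)))))))
      (trans (∑-distrib-+ (λ l → ι (δ i l) * f l + ι (δ j l) * f l) (λ l → ι (δ k l) * f l))
      (+-cong (trans (∑-distrib-+ (λ l → ι (δ i l) * f l) (λ l → ι (δ j l) * f l)) (+-cong (sum-δ i f) (sum-δ j f))) (sum-δ k f)))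

  term≤sum : ∀ {n} (f : Fin n → Carrier) → (∀ i → 0# ≤ f i) → ∀ i → f i ≤ sum f
  term≤sum f 0≤f i = ≤-respˡ (sum-δ i f) (sum-mono-≤ λ k → ι*≤ (NatSum.δ≤1 i k) (0≤f k))

-- The walk-count identity at a vertex of maximal weight

module Weighted (O : OrderedRing) where

  open OrderedRingProperties O
  open LambdaBounds O
  open WeightedSums O

  record Subeigenvector (G : Graph) (m : ℕ) (L : Carrier) (u : Fin (order G)) : Set where
    open Link G u using (a; degree)
    field
      large   : LargeRoot L
      y       : Fin (order G) → Carrier
      0≤y     : ∀ x → 0# ≤ y x
      y≤yu    : ∀ x → y x ≤ y u
      0<yu    : 0# < y u
      Ly≤Ay   : ∀ x → L * y x ≤ sum (λ z → ι (a x z) * y z)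
      degrees : NatSum.sum degree ≡ 2 ℕ.* m
      m≤      : ι m ≤ L * L - L + ι 1

  module Budget (G : Graph) (free : (V 5 -free) G) (m : ℕ) (L : Carrier) (u : Fin (order G))
                (S : Subeigenvector G m L u) where

    open Subeigenvector S public
    open LargeRoot large public
    open Link G u public
    open FanFree G free u public

    M : Carrier
    M = y u

    0≤M : 0# ≤ M
    0≤M = <⇒≤ 0<yu

    0≤M-y : ∀ x → 0# ≤ M - y x
    0≤M-y x = ≤⇒0≤- (y≤yu x)

    LM≰3M : ¬ (L * M ≤ ι 3 * M)
    LM≰3M p = 3<L (0≤-⇒≤ (*-cancelˡ-nonNeg 0<yu (≤-respʳ
      (solve 2 (λ L M → :ι 3 :* M :- L :* M := M :* (:ι 3 :- L)) refl L M) (≤⇒0≤- p))))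

    Ay slack : Vertex → Carrier
    Ay x    = sum (λ z → ι (a x z) * y z)
    slack x = Ay x - L * y x

    0≤slack : ∀ x → 0# ≤ slack x
    0≤slack x = ≤⇒0≤- (Ly≤Ay x)

    -- `slacks` is A²y - L Ay at u. Together with (L - 1) times the slack of u it is (A² - A)y - (L²
    -- - L)y at u.
    excess slacks : Carrier
    excess = (L * L - L + ι 1) - ι m
    slacks = sum (λ v → ι (ν v) * slack v)

    0≤excess : 0# ≤ excess
    0≤excess = ≤⇒0≤- m≤

    0≤slacks : 0# ≤ slacks
    0≤slacks = sum-nonNeg λ v → *-nonNeg (0≤ι (ν v)) (0≤slack v)

    -- The first term is the loss from replacing y by M at the end of the c walks of length two from
    -- u. The second comes from Ay, and `- ν c M` corrects the double counting of edges inside N(u).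
    -- The local data are separate arguments so that known degrees can be substituted by `Φ-value`.
    φ : ℕ → ℕ → ℕ → ℕ → Carrier → Carrier
    φ c ν s l y = ι 2 * (ι c * (M - y)) + ι 2 * (ι ν * y) + (ι ν * ι s - ι l - ι ν * ι c) * M

    -- The term (leaves - leaf) M sums to zero; it moves the deficit of the leaves
    -- of a star to its centre, which makes every Φ x nonnegative.
    Φ : Vertex → Carrier
    Φ x = φ (c x) (ν x) (leaves x) (leaf x) (y x)

    private
      -- Walks of length two from u, grouped by their end on the left and by their middle vertex on
      -- the right.
      cross : sum (λ x → ι (c x) * y x) ≈ sum (λ v → ι (ν v) * Ay v)
      cross = begin
        sum (λ x → ι (c x) * y x)
          ≈⟨ sum-cong (λ x → trans (*-congʳ (ι-sum (λ v → a x v ℕ.* ν v))) (*-distribʳ-sum (y x) (λ v → ι (a x v ℕ.* ν v)))) ⟩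
        sum (λ x → sum (λ v → ι (a x v ℕ.* ν v) * y x))
          ≈⟨ ∑-comm (λ x v → ι (a x v ℕ.* ν v) * y x) ⟩
        sum (λ v → sum (λ x → ι (a x v ℕ.* ν v) * y x))
          ≈⟨ sum-cong (λ v → trans (sum-cong (reorder v)) (sum-*ˡ (ι (ν v)) (λ x → ι (a v x) * y x))) ⟩
        sum (λ v → ι (ν v) * Ay v) ∎
        where
        open ≈-Reasoning
        reorder : ∀ v x → ι (a x v ℕ.* ν v) * y x ≈ ι (ν v) * (ι (a v x) * y x)
        reorder v x = trans (*-congʳ (trans (ι-* (a x v) (ν v)) (*-congʳ (ι-cong (a-sym x v)))))
          (solve 3 (λ p q r → (p :* q) :* r := q :* (p :* r)) refl (ι (a v x)) (ι (ν v)) (y x))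

      slacks≈ : slacks ≈ sum (λ v → ι (ν v) * Ay v) - L * Ay u
      slacks≈ = begin
        sum (λ v → ι (ν v) * slack v)
          ≈⟨ sum-cong (λ v → solve 4 (λ n A L y → n :* (A :- L :* y) := (:- L) :* (n :* y) :+ n :* A) refl (ι (ν v)) (Ay v) L (y v)) ⟩
        sum (λ v → (- L) * (ι (ν v) * y v) + ι (ν v) * Ay v)
          ≈⟨ sum-axpy (- L) (λ v → ι (ν v) * y v) (λ v → ι (ν v) * Ay v) ⟩
        (- L) * Ay u + sum (λ v → ι (ν v) * Ay v)
          ≈⟨ solve 3 (λ L A S → (:- L) :* A :+ S := S :- L :* A) refl L (Ay u) (sum (λ v → ι (ν v) * Ay v)) ⟩
        sum (λ v → ι (ν v) * Ay v) - L * Ay u ∎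
        where open ≈-Reasoning

      NA C NC : Carrier
      NA = sum (λ v → ι (ν v) * Ay v)
      C  = sum (λ x → ι (c x))
      NC = sum (λ x → ι (ν x) * ι (c x))

      sumΦ≈ : sum Φ ≈ (ι 2 * M) * C + ((- ι 2) * NA + (ι 2 * Ay u + (- M) * NC))
      sumΦ≈ = begin
        sum Φ
          ≈⟨ sum-cong (λ x → solve 6 (λ M c n s l y →
               :ι 2 :* (c :* (M :- y)) :+ :ι 2 :* (n :* y) :+ (n :* s :- l :- n :* c) :* M
               := (:ι 2 :* M) :* c :+ ((:- :ι 2) :* (c :* y) :+ (:ι 2 :* (n :* y) :+ (M :* (n :* s) :+ ((:- M) :* l :+ (:- M) :* (n :* c))))))
               refl M (ι (c x)) (ι (ν x)) (ι (leaves x)) (ι (leaf x)) (y x)) ⟩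
        sum (λ x → (ι 2 * M) * ι (c x) + t₁ x)
          ≈⟨ sum-axpy (ι 2 * M) (λ x → ι (c x)) t₁ ⟩
        (ι 2 * M) * C + sum t₁
          ≈⟨ +-congˡ (sum-axpy (- ι 2) (λ x → ι (c x) * y x) t₂) ⟩
        (ι 2 * M) * C + ((- ι 2) * sum (λ x → ι (c x) * y x) + sum t₂)
          ≈⟨ +-congˡ (+-cong (*-congˡ cross) (sum-axpy (ι 2) (λ x → ι (ν x) * y x) t₃)) ⟩
        (ι 2 * M) * C + ((- ι 2) * NA + (ι 2 * Ay u + sum t₃))
          ≈⟨ +-congˡ (+-congˡ (+-congˡ (begin
               sum t₃
                 ≈⟨ sum-axpy M (λ x → ι (ν x) * ι (leaves x)) t₄ ⟩
               M * sum (λ x → ι (ν x) * ι (leaves x)) + sum t₄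
                 ≈⟨ +-cong (*-congˡ leaves≈leaf) (sum-axpy (- M) (λ x → ι (leaf x)) (λ x → (- M) * (ι (ν x) * ι (c x)))) ⟩
               M * sum (λ x → ι (leaf x)) + ((- M) * sum (λ x → ι (leaf x)) + sum (λ x → (- M) * (ι (ν x) * ι (c x))))
                 ≈⟨ +-congˡ (+-congˡ (sum-*ˡ (- M) (λ x → ι (ν x) * ι (c x)))) ⟩
               M * sum (λ x → ι (leaf x)) + ((- M) * sum (λ x → ι (leaf x)) + (- M) * NC)
                 ≈⟨ solve 3 (λ M l n → M :* l :+ ((:- M) :* l :+ (:- M) :* n) := (:- M) :* n) refl M (sum (λ x → ι (leaf x))) NC ⟩
               (- M) * NC ∎))) ⟩
        (ι 2 * M) * C + ((- ι 2) * NA + (ι 2 * Ay u + (- M) * NC)) ∎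
        where
        open ≈-Reasoning
        t₁ t₂ t₃ t₄ : Vertex → Carrier
        t₄ x = (- M) * ι (leaf x) + (- M) * (ι (ν x) * ι (c x))
        t₃ x = M * (ι (ν x) * ι (leaves x)) + t₄ x
        t₂ x = ι 2 * (ι (ν x) * y x) + t₃ x
        t₁ x = (- ι 2) * (ι (c x) * y x) + t₂ x
        leaves≈leaf : sum (λ x → ι (ν x) * ι (leaves x)) ≈ sum (λ x → ι (leaf x))
        leaves≈leaf = trans (sum-cong (λ x → sym (ι-* (ν x) (leaves x))))
          (trans (sym (ι-sum (λ x → ν x ℕ.* leaves x))) (trans (ι-cong sum-leaves) (ι-sum leaf)))

      edges≈ : ι 2 * ι m + NC ≈ ι 2 * C + ι farEdgeEnds
      edges≈ = begin
        ι 2 * ι m + NC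
          ≈⟨ +-cong (sym (ι-* 2 m)) (trans (sum-cong (λ x → sym (ι-* (ν x) (c x)))) (sym (ι-sum (λ x → ν x ℕ.* c x)))) ⟩
        ι (2 ℕ.* m) + ι (NatSum.sum (λ x → ν x ℕ.* c x))
          ≈⟨ ι-+ (2 ℕ.* m) _ ⟨
        ι (2 ℕ.* m ℕ.+ NatSum.sum (λ x → ν x ℕ.* c x))
          ≈⟨ ι-cong (≡.trans (≡.cong (ℕ._+ NatSum.sum (λ x → ν x ℕ.* c x)) (≡.sym degrees)) sum-degree) ⟩
        ι (2 ℕ.* NatSum.sum c ℕ.+ farEdgeEnds)
          ≈⟨ ι-+ (2 ℕ.* NatSum.sum c) farEdgeEnds ⟩
        ι (2 ℕ.* NatSum.sum c) + ι farEdgeEnds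
          ≈⟨ +-congʳ (trans (ι-* 2 (NatSum.sum c)) (*-congˡ (ι-sum c))) ⟩
        ι 2 * C + ι farEdgeEnds ∎
        where open ≈-Reasoning

    -- The left side is the 1 in L² - L + 1, times 2M. After the edge count has replaced 2m, all
    -- other terms cancel.
    budget : ι 2 * M ≈ ι 2 * slacks + ι 2 * ((L - ι 1) * slack u) + ι 2 * (excess * M) + ι farEdgeEnds * M + sum Φ
    budget = begin
      ι 2 * M
        ≈⟨ solve 7 (λ M L N A k C n → :ι 2 :* M :=
             :ι 2 :* (N :- L :* A) :+ :ι 2 :* ((L :- :ι 1) :* (A :- L :* M)) :+ :ι 2 :* (((L :* L :- L :+ :ι 1) :- k) :* M)
               :+ (:ι 2 :* k :+ n :- :ι 2 :* C) :* M :+ ((:ι 2 :* M) :* C :+ ((:- :ι 2) :* N :+ (:ι 2 :* A :+ (:- M) :* n))))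
             refl M L NA (Ay u) (ι m) C NC ⟩
      ι 2 * (NA - L * Ay u) + ι 2 * ((L - ι 1) * slack u) + ι 2 * (excess * M)
        + (ι 2 * ι m + NC - ι 2 * C) * M + ((ι 2 * M) * C + ((- ι 2) * NA + (ι 2 * Ay u + (- M) * NC)))
        ≈⟨ +-cong (+-cong (+-congʳ (+-congʳ (*-congˡ (sym slacks≈)))) (*-congʳ far≈)) (sym sumΦ≈) ⟩
      ι 2 * slacks + ι 2 * ((L - ι 1) * slack u) + ι 2 * (excess * M) + ι farEdgeEnds * M + sum Φ ∎
      where
      open ≈-Reasoning
      far≈ : ι 2 * ι m + NC - ι 2 * C ≈ ι farEdgeEnds
      far≈ = trans (+-congʳ edges≈) (solve 2 (λ C e → :ι 2 :* C :+ e :- :ι 2 :* C := e) refl C (ι farEdgeEnds))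

    Φ-value : ∀ {x k n s l} → c x ≡ k → ν x ≡ n → leaves x ≡ s → leaf x ≡ l → Φ x ≈ φ k n s l (y x)
    Φ-value ≡.refl ≡.refl ≡.refl ≡.refl = refl

    -- This covers u itself, where M - y vanishes.
    Φ-far : ∀ {x} → ¬ Near x → Φ x ≈ ι 2 * (ι (c x) * (M - y x))
    Φ-far {x} ¬nx = trans (Φ-value ≡.refl (a-≁ ¬nx) ≡.refl (leaf-not-near ¬nx))
      (solve 4 (λ M c s y → :ι 2 :* (c :* (M :- y)) :+ :ι 2 :* (:ι 0 :* y) :+ (:ι 0 :* s :- :ι 0 :- :ι 0 :* c) :* M
        := :ι 2 :* (c :* (M :- y))) refl M (ι (c x)) (ι (leaves x)) (y x))

    Φ-isolated : ∀ {x} → Near x → c x ≡ 0 → Φ x ≈ ι 2 * y x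
    Φ-isolated {x} nx e = trans (Φ-value e (a-~ nx) (c≡0⇒leaves≡0 e) (leaf-≢1 λ e′ → contradiction (≡.trans (≡.sym e) e′) λ ()))
      (solve 2 (λ M y → :ι 2 :* (:ι 0 :* (M :- y)) :+ :ι 2 :* (:ι 1 :* y) :+ (:ι 1 :* :ι 0 :- :ι 0 :- :ι 1 :* :ι 0) :* M
        := :ι 2 :* y) refl M (y x))

    -- A leaf has M to give and passes it to its neighbour. What it keeps is what it receives, so it
    -- is nonzero only when its component is a single edge.
    Φ-leaf : ∀ {x} → Near x → c x ≡ 1 → Φ x ≈ ι (leaves x) * M
    Φ-leaf {x} nx e = trans (Φ-value e (a-~ nx) ≡.refl (leaf-≡1 nx e))
      (solve 3 (λ M s y → :ι 2 :* (:ι 1 :* (M :- y)) :+ :ι 2 :* (:ι 1 :* y) :+ (:ι 1 :* s :- :ι 1 :- :ι 1 :* :ι 1) :* M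
        := s :* M) refl M (ι (leaves x)) (y x))

    Φ-two : ∀ {x} → Near x → c x ≡ 2 → Φ x ≈ ι 2 * (M - y x) + ι (leaves x) * M
    Φ-two {x} nx e = trans (Φ-value e (a-~ nx) ≡.refl (leaf-≢1 λ e′ → contradiction (≡.trans (≡.sym e) e′) λ ()))
      (solve 3 (λ M s y → :ι 2 :* (:ι 2 :* (M :- y)) :+ :ι 2 :* (:ι 1 :* y) :+ (:ι 1 :* s :- :ι 0 :- :ι 1 :* :ι 2) :* M
        := :ι 2 :* (M :- y) :+ s :* M) refl M (ι (leaves x)) (y x))

    -- The M received from each of the c leaves cancels -cM, and 2c(M - y) + 2y exceeds 2M by 2(c -
    -- 1)(M - y).
    Φ-star : ∀ {x} → Near x → 2 ℕ.≤ c x → leaves x ≡ c x → ι 2 * M ≤ Φ x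
    Φ-star {x} nx 2≤c e = ≤-by (*-nonNeg (*-nonNeg (0≤ι 2) 0≤c-1) (0≤M-y x))
      (trans (+-congʳ (Φ-value ≡.refl (a-~ nx) e (leaf-≢1 λ e′ → contradiction (≡.subst (2 ℕ.≤_) e′ 2≤c) λ { (s≤s ()) })))
        (solve 3 (λ M c y → (:ι 2 :* (c :* (M :- y)) :+ :ι 2 :* (:ι 1 :* y) :+ (:ι 1 :* c :- :ι 0 :- :ι 1 :* c) :* M) :- :ι 2 :* M
          := (:ι 2 :* (c :- :ι 1)) :* (M :- y)) refl M (ι (c x)) (y x)))
      where
      0≤c-1 : 0# ≤ ι (c x) - ι 1
      0≤c-1 = ≤⇒0≤- (ι-mono-≤ (ℕ.≤-trans (s≤s z≤n) 2≤c))

    Φ-large : ∀ {x} → Near x → 3 ℕ.≤ c x → ι 2 * M ≤ Φ x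
    Φ-large nx 3≤c = Φ-star nx (ℕ.≤-trans (s≤s (s≤s z≤n)) 3≤c) (all-leaves (large⇒leaves nx 3≤c))

    0≤Φ : ∀ x → 0# ≤ Φ x
    0≤Φ x = by-cases (adj? G u x)
      where
      degree-cases : Near x → ∀ k → c x ≡ k → 0# ≤ Φ x
      degree-cases nx 0 e = ≤-respʳ (sym (Φ-isolated nx e)) (*-nonNeg (0≤ι 2) (0≤y x))
      degree-cases nx 1 e = ≤-respʳ (sym (Φ-leaf nx e)) (*-nonNeg (0≤ι (leaves x)) 0≤M)
      degree-cases nx 2 e = ≤-respʳ (sym (Φ-two nx e)) (+-nonNeg (*-nonNeg (0≤ι 2) (0≤M-y x)) (*-nonNeg (0≤ι (leaves x)) 0≤M))
      degree-cases nx (suc (suc (suc k))) e = ≤-trans (*-nonNeg (0≤ι 2) 0≤M)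
        (Φ-large nx (≡.subst (3 ℕ.≤_) (≡.sym e) (s≤s (s≤s (s≤s z≤n)))))
      by-cases : Dec (Near x) → 0# ≤ Φ x
      by-cases (yes nx) = degree-cases nx (c x) ≡.refl
      by-cases (no ¬nx) = ≤-respʳ (sym (Φ-far ¬nx)) (*-nonNeg (0≤ι 2) (*-nonNeg (0≤ι (c x)) (0≤M-y x)))

-- K₂ ∨ tK₁ plus isolated vertices, with u and b the vertices of K₂.
record IsBook (G : Graph) (u b : Fin (order G)) : Set where
  field
    spine  : Adj G u b
    cover  : ∀ {x z} → Adj G x z → (x ≡ u ⊎ x ≡ b) ⊎ (z ≡ u ⊎ z ≡ b)
    pages  : ∀ {x} → x ≢ b → Adj G u x → Adj G b x
    pages′ : ∀ {x} → x ≢ u → Adj G b x → Adj G u x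

-- A star in N(u) exhausts the budget and forces the book

module LeafCase (O : OrderedRing) (G : Graph) (free : (V 5 -free) G) (m : ℕ) (L : OrderedRing.Carrier O) (u : Fin (order G))
                (S : Weighted.Subeigenvector O G m L u) (l b : Fin (order G)) (nl : Adj G u l)
                (cl : Link.c G u l ≡ 1) (nb : Adj G u b) (l~b : Adj G l b) where

  open OrderedRingProperties O
  open LambdaBounds O
  open WeightedSums O
  open Weighted O
  open Budget G free m L u S renaming (b to farDegree)

  l≢b : l ≢ b
  l≢b = ~⇒≢ l~b

  b~l : b ~ l
  b~l = adj-sym G l~b

  1≤cb : 1 ℕ.≤ c b
  1≤cb = 1≤c b~l nl

  c-cases : ∀ x → 1 ℕ.≤ c x → c x ≡ 1 ⊎ 2 ℕ.≤ c x
  c-cases x = 1⊎2≤ (c x)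
    where
    1⊎2≤ : ∀ k → 1 ℕ.≤ k → k ≡ 1 ⊎ 2 ℕ.≤ k
    1⊎2≤ 1             _ = inj₁ ≡.refl
    1⊎2≤ (suc (suc k)) _ = inj₂ (s≤s (s≤s z≤n))

  M≤Φ-leaf : ∀ {x z} → Near x → c x ≡ 1 → x ~ z → Near z → c z ≡ 1 → M ≤ Φ x
  M≤Φ-leaf {x} nx cx x~z nz cz = ≤-respʳ (sym (Φ-leaf nx cx))
    (≤-by (*-nonNeg (≤⇒0≤- (ι-mono-≤ (leaf-neighbour x~z nz cz))) 0≤M)
      (solve 2 (λ s M → s :* M :- M := (s :- :ι 1) :* M) refl (ι (leaves x)) M))

  -- If b is a leaf too, the component is a single edge and each end contributes M; otherwise b is
  -- the centre of a star and contributes 2M alone.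
  star-weight : ι 2 * M ≤ Φ l + Φ b
  star-weight with c-cases b 1≤cb
  ... | inj₁ cb = ≤-respˡ (solve 1 (λ M → M :+ M := :ι 2 :* M) refl M)
                    (+-mono-≤ (M≤Φ-leaf nl cl l~b nb cb) (M≤Φ-leaf nb cb b~l nl cl))
  ... | inj₂ 2≤cb = ≤-respˡ (+-identityˡ (ι 2 * M))
                      (+-mono-≤ (0≤Φ l) (Φ-star nb 2≤cb (all-leaves (star⇒leaves nl cl l~b nb))))

  *-cancelˡ-≤0 : ∀ {k x} → 0# < k → k * x ≤ 0# → x ≤ 0#
  *-cancelˡ-≤0 {k} {x} 0<k kx≤0 = ≤-by (*-cancelˡ-nonNeg 0<k (≤-respʳ
    (solve 2 (λ k x → :ι 0 :- k :* x := k :* (:- x)) refl k x) (≤⇒0≤- kx≤0)))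
    (solve 1 (λ x → :ι 0 :- x := :- x) refl x)

  vanish : ∀ {a b c d f K} → 0# ≤ a → 0# ≤ b → 0# ≤ c → 0# ≤ d → K ≈ a + b + c + d + f → K ≤ f →
           a ≤ 0# × b ≤ 0# × c ≤ 0# × d ≤ 0# × f ≤ K
  vanish {a} {b} {c} {d} {f} {K} 0≤a 0≤b 0≤c 0≤d e K≤f =
    ≤-by (+-nonNeg (+-nonNeg (+-nonNeg 0≤b 0≤c) 0≤d) rest)
      (solve 5 (λ a b c d f → :ι 0 :- a := b :+ c :+ d :+ (f :- (a :+ b :+ c :+ d :+ f))) refl a b c d f) ,
    ≤-by (+-nonNeg (+-nonNeg (+-nonNeg 0≤a 0≤c) 0≤d) rest)
      (solve 5 (λ a b c d f → :ι 0 :- b := a :+ c :+ d :+ (f :- (a :+ b :+ c :+ d :+ f))) refl a b c d f) ,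
    ≤-by (+-nonNeg (+-nonNeg (+-nonNeg 0≤a 0≤b) 0≤d) rest)
      (solve 5 (λ a b c d f → :ι 0 :- c := a :+ b :+ d :+ (f :- (a :+ b :+ c :+ d :+ f))) refl a b c d f) ,
    ≤-by (+-nonNeg (+-nonNeg (+-nonNeg 0≤a 0≤b) 0≤c) rest)
      (solve 5 (λ a b c d f → :ι 0 :- d := a :+ b :+ c :+ (f :- (a :+ b :+ c :+ d :+ f))) refl a b c d f) ,
    ≤-by (+-nonNeg (+-nonNeg (+-nonNeg 0≤a 0≤b) 0≤c) 0≤d) (trans (+-congʳ e)
      (solve 5 (λ a b c d f → (a :+ b :+ c :+ d :+ f) :- f := a :+ b :+ c :+ d) refl a b c d f))
    where
    rest : 0# ≤ f - (a + b + c + d + f)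
    rest = ≤⇒0≤- (≤-respˡ e K≤f)

  -- The star through l already exhausts the budget.
  exhausted : ι 2 * slacks ≤ 0# × ι 2 * ((L - ι 1) * slack u) ≤ 0# × ι 2 * (excess * M) ≤ 0# × ι farEdgeEnds * M ≤ 0# × sum Φ ≤ ι 2 * M
  exhausted = vanish (*-nonNeg (0≤ι 2) 0≤slacks) (*-nonNeg (0≤ι 2) (*-nonNeg 0≤L-1 (0≤slack u)))
    (*-nonNeg (0≤ι 2) (*-nonNeg 0≤excess 0≤M)) (*-nonNeg (0≤ι farEdgeEnds) 0≤M)
    budget (≤-trans star-weight (two-terms≤sum Φ 0≤Φ l≢b))

  excess≤0 : excess ≤ 0#
  excess≤0 = *-cancelˡ-≤0 0<yu (≤-respˡ (*-comm excess M) (*-cancelˡ-≤0 (0<ι 1) (proj₁ (proj₂ (proj₂ exhausted)))))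

  slack-centre≤0 : slack u ≤ 0#
  slack-centre≤0 = *-cancelˡ-≤0 0<L-1 (*-cancelˡ-≤0 (0<ι 1) (proj₁ (proj₂ exhausted)))

  slack-near≤0 : ∀ {x} → Near x → slack x ≤ 0#
  slack-near≤0 {x} nx = ≤-respˡ (trans (*-congʳ (trans (ι-cong (a-~ nx)) ι-1)) (*-identityˡ (slack x)))
    (≤-trans (term≤sum (λ v → ι (ν v) * slack v) (λ v → *-nonNeg (0≤ι (ν v)) (0≤slack v)) x) (*-cancelˡ-≤0 (0<ι 1) (proj₁ exhausted)))

  farEdgeEnds≡0 : farEdgeEnds ≡ 0
  farEdgeEnds≡0 = vanishing farEdgeEnds (proj₁ (proj₂ (proj₂ (proj₂ exhausted))))
    where
    vanishing : ∀ k → ι k * M ≤ 0# → k ≡ 0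
    vanishing zero    _ = ≡.refl
    vanishing (suc k) p = ⊥-elim (*-pos (0<ι k) 0<yu p)

  Φ≤0 : ∀ {x} → x ≢ l → x ≢ b → Φ x ≤ 0#
  Φ≤0 {x} x≢l x≢b = ≤-by (+-nonNeg (≤⇒0≤- star-weight)
      (≤⇒0≤- (≤-trans (three-terms≤sum Φ 0≤Φ l≢b (λ e → x≢l (≡.sym e)) (λ e → x≢b (≡.sym e))) (proj₂ (proj₂ (proj₂ (proj₂ exhausted)))))))
    (solve 4 (λ M p q r → :ι 0 :- r := ((p :+ q) :- :ι 2 :* M) :+ (:ι 2 :* M :- ((p :+ q) :+ r))) refl M (Φ l) (Φ b) (Φ x))

  M≤Ay : ∀ {x} → Near x → M ≤ Ay x
  M≤Ay {x} nx = ≤-respˡ (trans (*-congʳ (trans (ι-cong (a-~ (adj-sym G nx))) ι-1)) (*-identityˡ M))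
    (term≤sum (λ z → ι (a x z) * y z) (λ z → *-nonNeg (0≤ι (a x z)) (0≤y z)) u)

  -- No slack is left at neighbours of u, so L y equals Ay there, and Ay is at least M because u is
  -- adjacent.
  0<y-near : ∀ {x} → Near x → 0# < y x
  0<y-near {x} nx = *-cancelˡ-pos 0<L (<-≤-trans 0<yu (≤-trans (M≤Ay nx)
    (≤-by (≤⇒0≤- (slack-near≤0 nx)) (solve 2 (λ A B → B :- A := :ι 0 :- (A :- B)) refl (Ay x) (L * y x)))))

  -- An isolated vertex of N(u) would contribute 2y > 0 to a budget that is already spent.
  1≤c-near : ∀ {x} → Near x → 1 ℕ.≤ c x
  1≤c-near {x} nx = ℕ.n≢0⇒n>0 λ e → *-pos (0<ι 1) (0<y-near nx) (≤-respˡ (Φ-isolated nx e)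
    (Φ≤0 (λ { ≡.refl → contradiction (≡.trans (≡.sym e) cl) λ () })
         (λ { ≡.refl → contradiction (≡.subst (1 ℕ.≤_) e 1≤cb) λ () })))

  far-independent : ∀ {w x} → Far w → Far x → ¬ w ~ x
  far-independent {w} {x} fw fx w~x = contradiction (≡.subst (1 ℕ.≤_) b≡0 1≤b) λ ()
    where
    1≤b : 1 ℕ.≤ farDegree w
    1≤b = ≡.subst (ℕ._≤ farDegree w) (≡.cong₂ ℕ._*_ (a-~ w~x) (ω-far fx)) (NatSum.term≤sum (λ v → a w v ℕ.* ω v) x)
    b≡0 : farDegree w ≡ 0
    b≡0 = ℕ.n≤0⇒n≡0 (ℕ.≤-trans (ℕ.m≤m+n (farDegree w) (farDegree w)) (≡.subst (farDegree w ℕ.+ farDegree w ℕ.≤_) farEdgeEnds≡0 (2b≤farEdgeEnds fw)))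

  far⇒≢near : ∀ {w x} → Far w → Near x → w ≢ x
  far⇒≢near fw nx ≡.refl = proj₂ fw nx

  M≤y-far : ∀ {w} → Far w → 1 ℕ.≤ c w → M ≤ y w
  M≤y-far {w} fw 1≤cw = 0≤-⇒≤ (≤-respʳ (solve 2 (λ M y → :ι 0 :- (M :- y) := y :- M) refl M (y w))
    (≤⇒0≤- (*-cancelˡ-≤0 0<c (*-cancelˡ-≤0 (0<ι 1)
      (≤-respˡ (Φ-far (proj₂ fw)) (Φ≤0 (far⇒≢near fw nl) (far⇒≢near fw nb)))))))
    where
    0<c : 0# < ι (c w)
    0<c = <-≤-trans (0<ι 0) (ι-mono-≤ 1≤cw)

  -- Such a w has weight M, and its neighbours all lie in N(u). Thus Ay at w is at least LM, which
  -- is Ay at u, and a neighbour of u missed by w would leave a positive deficit.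
  far⇒complete : ∀ {w z} → Far w → 1 ℕ.≤ c w → Near z → w ~ z
  far⇒complete {w} {z} fw 1≤cw nz = decidable-stable (adj? G w z) λ w≁z → 0<y-near nz (≤-by
      (+-nonNeg (+-nonNeg (+-nonNeg (≤⇒0≤- (Ay+y≤ w≁z)) (≤⇒0≤- slack-centre≤0)) (0≤slack w)) (*-nonNeg 0≤L (≤⇒0≤- (M≤y-far fw 1≤cw))))
      (solve 6 (λ L M A B y z → :ι 0 :- z := (A :- (B :+ z)) :+ (:ι 0 :- (A :- L :* M)) :+ (B :- L :* y) :+ L :* (y :- M))
        refl L M (Ay u) (Ay w) (y w) (y z)))
    where
    coefficient : ¬ w ~ z → ∀ x → Place x → a w x ℕ.+ NatSum.δ z x ℕ.≤ a u x
    coefficient w≁z x (centre ≡.refl) = ℕ.≤-trans (ℕ.≤-reflexive (≡.cong₂ ℕ._+_ (a-≁ (λ w~u → proj₂ fw (adj-sym G w~u))) (NatSum.δ-≢ z u (λ e → ~⇒≢ nz (≡.sym e))))) z≤n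
    coefficient w≁z x (near nx) = ≡.subst (a w x ℕ.+ NatSum.δ z x ℕ.≤_) (≡.sym (a-~ nx)) (bound (z Fin.≟ x))
      where
      bound : Dec (z ≡ x) → a w x ℕ.+ NatSum.δ z x ℕ.≤ 1
      bound (yes ≡.refl) = ℕ.≤-reflexive (≡.cong₂ ℕ._+_ (a-≁ w≁z) (NatSum.δ-refl z))
      bound (no z≢x)     = ≡.subst (ℕ._≤ 1) (≡.sym (≡.trans (≡.cong (a w x ℕ.+_) (NatSum.δ-≢ z x z≢x)) (ℕ.+-identityʳ (a w x)))) (a≤1 w x)
    coefficient w≁z x (far p q) = ℕ.≤-trans (ℕ.≤-reflexive (≡.cong₂ ℕ._+_ (a-≁ (far-independent fw (p , q))) (NatSum.δ-≢ z x (λ { ≡.refl → q nz })))) z≤n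
    Ay+y≤ : ¬ w ~ z → Ay w + y z ≤ Ay u
    Ay+y≤ w≁z = ≤-respˡ
      (trans (sum-cong (λ x → trans (*-congʳ (ι-+ (a w x) (NatSum.δ z x))) (distribʳ (y x) (ι (a w x)) (ι (NatSum.δ z x)))))
        (trans (∑-distrib-+ (λ x → ι (a w x) * y x) (λ x → ι (NatSum.δ z x) * y x)) (+-congˡ (sum-δ z y))))
      (sum-mono-≤ λ x → ≤-respˡ (*-comm (y x) _) (≤-respʳ (*-comm (y x) _) (*-monoˡ-≤ (0≤y x) (ι-mono-≤ (coefficient w≁z x (place x))))))

  Ay≤degree : ∀ x → Ay x ≤ ι (degree x) * M
  Ay≤degree x = ≤-respʳ (sum-ι* (a x) M) (sum-mono-≤ λ z → *-monoˡ-≤ (0≤ι (a x z)) (y≤yu z))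

  3≤degree : 3 ℕ.≤ NatSum.sum ν
  3≤degree = ℕ.≮⇒≥ λ d<3 → LM≰3M (≤-trans (Ly≤Ay u) (≤-trans (Ay≤degree u)
    (≤-respˡ (*-comm M (ι (degree u))) (≤-respʳ (*-comm M (ι 3)) (*-monoˡ-≤ 0≤M (ι-mono-≤ (ℕ.<⇒≤ d<3)))))))

  third-near : ∃ λ p → Near p × p ≢ l × p ≢ b
  third-near =
    let p , 0<ν , p≢l , p≢b = NatSum.outside-two ν (a≤1 u) 3≤degree l b
    in p , 0<a⇒~ 0<ν , p≢l , p≢b

  module _ {w : Vertex} (fw : Far w) (1≤cw : 1 ℕ.≤ c w) where

    -- Around the hub x, the vertices p u q w form a path.
    near-c≤1 : ∀ {x p q} → Near x → x ~ p → Near p → x ~ q → Near q → q ≢ p → ⊥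
    near-c≤1 {x} {p} {q} nx x~p np x~q nq q≢p = no-fan {h = x} {p = p} {q = u} {r = q} {s = w}
      x~p (adj-sym G nx) x~q (adj-sym G (far⇒complete fw 1≤cw nx)) (adj-sym G np) nq (adj-sym G (far⇒complete fw 1≤cw nq))
      (λ e → q≢p (≡.sym e)) (λ e → far⇒≢near fw np (≡.sym e)) (proj₁ fw)

    near-c≡1 : ∀ {x} → Near x → c x ≡ 1
    near-c≡1 {x} nx = Sum.[ (λ e → e) , (λ 2≤cx → ⊥-elim (contra 2≤cx (neighbour x (1≤c-near nx)))) ]′ (c-cases x (1≤c-near nx))
      where
      contra : 2 ℕ.≤ c x → (∃ λ p → x ~ p × Near p) → ⊥
      contra 2≤cx (p , x~p , np) = distinct (second-neighbour x 2≤cx p)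
        where
        distinct : (∃ λ q → x ~ q × Near q × q ≢ p) → ⊥
        distinct (q , x~q , nq , q≢p) = near-c≤1 nx x~p np x~q nq q≢p

    -- p and its neighbour in N(u) would both be leaves, so p would contribute M besides the
    -- component of l and b.
    joined-absurd : ∀ {p} → Near p → p ≢ l → p ≢ b → ⊥
    joined-absurd {p} np p≢l p≢b = contra (neighbour p (1≤c-near np))
      where
      contra : (∃ λ z → p ~ z × Near z) → ⊥
      contra (z , p~z , nz) = 0<yu (≤-trans (M≤Φ-leaf np (near-c≡1 np) p~z nz (near-c≡1 nz)) (Φ≤0 p≢l p≢b))

  far⇒c≡0 : ∀ {w} → Far w → c w ≡ 0
  far⇒c≡0 {w} fw = decidable-stable (c w ℕ.≟ 0) λ ¬e → contra (ℕ.n≢0⇒n>0 ¬e) third-near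
    where
    contra : 1 ℕ.≤ c w → (∃ λ p → Near p × p ≢ l × p ≢ b) → ⊥
    contra 1≤cw (p , np , p≢l , p≢b) = joined-absurd fw 1≤cw np p≢l p≢b

  near≢far : ∀ {x z} → Near x → Far z → ¬ x ~ z
  near≢far nx fz x~z = contradiction (≡.subst (1 ℕ.≤_) (far⇒c≡0 fz) (1≤c (adj-sym G x~z) nx)) λ ()

  -- At degree two in N(u), a vanishing contribution forces y = M; but then the whole degree is 3,
  -- so LM ≤ 3M. At degree three or more the contribution is at least 2M.
  other-c≡1 : ∀ {x} → Near x → x ≢ l → x ≢ b → c x ≡ 1
  other-c≡1 {x} nx x≢l x≢b = go (c x) ≡.refl
    where
    go : ∀ k → c x ≡ k → c x ≡ 1
    go 0 e = contradiction (≡.subst (1 ℕ.≤_) e (1≤c-near nx)) λ ()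
    go 1 e = e
    go 2 e = ⊥-elim (LM≰3M (≤-trans (*-monoˡ-≤ 0≤L M≤y) (≤-trans (Ly≤Ay x)
               (≤-trans (Ay≤degree x) (≤-reflexive (*-congʳ (ι-cong degree≡3)))))))
      where
      b≡0 : farDegree x ≡ 0
      b≡0 = NatSum.sum-zero (λ v → a x v ℕ.* ω v) λ v → pointwise v (place v)
        where
        pointwise : ∀ v → Place v → a x v ℕ.* ω v ≡ 0
        pointwise v (centre ≡.refl) = ≡.trans (≡.cong (a x u ℕ.*_) ω-centre) (ℕ.*-zeroʳ (a x u))
        pointwise v (near nv)       = ≡.trans (≡.cong (a x v ℕ.*_) (ω-near nv)) (ℕ.*-zeroʳ (a x v))
        pointwise v (far p q)       = ≡.cong (ℕ._* ω v) (a-≁ (near≢far nx (p , q)))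
      degree≡3 : degree x ≡ 3
      degree≡3 = ≡.trans (degree-split x) (≡.cong₂ ℕ._+_ (≡.cong₂ ℕ._+_ (a-~ nx) e) b≡0)
      M≤y : M ≤ y x
      M≤y = 0≤-⇒≤ (*-cancelˡ-nonNeg (0<ι 1) (≤-respʳ
        (solve 3 (λ M y s → s :* M :+ (:ι 0 :- (:ι 2 :* (M :- y) :+ s :* M)) := :ι 2 :* (y :- M)) refl M (y x) (ι (leaves x)))
        (+-nonNeg (*-nonNeg (0≤ι (leaves x)) 0≤M) (≤⇒0≤- (≤-respˡ (Φ-two nx e) (Φ≤0 x≢l x≢b))))))
    go (suc (suc (suc k))) e = ⊥-elim (*-pos (0<ι 1) 0<yu
      (≤-trans (Φ-large nx (≡.subst (3 ℕ.≤_) (≡.sym e) (s≤s (s≤s (s≤s z≤n))))) (Φ≤0 x≢l x≢b)))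

  near⇒c≡1 : ∀ {x} → Near x → x ≢ b → c x ≡ 1
  near⇒c≡1 {x} nx x≢b = by-cases (x Fin.≟ l)
    where
    by-cases : Dec (x ≡ l) → c x ≡ 1
    by-cases (yes x≡l) = ≡.trans (≡.cong c x≡l) cl
    by-cases (no x≢l)  = other-c≡1 nx x≢l x≢b

  -- The only neighbour of l in N(u) is b. Any other edge avoiding b would join two leaves and
  -- contribute M again.
  near-edge : ∀ {x z} → Near x → Near z → x ~ z → x ≢ b → z ≡ b
  near-edge {x} {z} nx nz x~z x≢b = by-cases (z Fin.≟ b) (x Fin.≟ l)
    where
    by-cases : Dec (z ≡ b) → Dec (x ≡ l) → z ≡ b
    by-cases (yes z≡b) _         = z≡b
    by-cases (no _)    (yes x≡l) = c≡1⇒unique cl (≡.subst (_~ z) x≡l x~z) nz l~b nb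
    by-cases (no z≢b)  (no x≢l)  = ⊥-elim (0<yu (≤-trans
      (M≤Φ-leaf nx (near⇒c≡1 nx x≢b) x~z nz (near⇒c≡1 nz z≢b)) (Φ≤0 x≢l x≢b)))

  near⇒~b : ∀ {x} → Near x → x ≢ b → b ~ x
  near⇒~b {x} nx x≢b = joined (neighbour x (1≤c-near nx))
    where
    joined : (∃ λ z → x ~ z × Near z) → b ~ x
    joined (z , x~z , nz) = adj-sym G (≡.subst (x ~_) (near-edge nx nz x~z x≢b) x~z)

  book : IsBook G u b
  book = record
    { spine  = nb
    ; cover  = λ {x} {z} x~z → cover x~z (place x) (place z)
    ; pages  = λ x≢b nx → near⇒~b nx x≢b
    ; pages′ = λ {x} x≢u b~x → pages′ x≢u b~x (place x)
    }
    where
    cover : ∀ {x z} → x ~ z → Place x → Place z → (x ≡ u ⊎ x ≡ b) ⊎ (z ≡ u ⊎ z ≡ b)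
    cover x~z (centre e) _          = inj₁ (inj₁ (≡.sym e))
    cover x~z _          (centre e) = inj₂ (inj₁ (≡.sym e))
    cover {x} {z} x~z (near nx) (near nz) = by-cases (x Fin.≟ b)
      where
      by-cases : Dec (x ≡ b) → (x ≡ u ⊎ x ≡ b) ⊎ (z ≡ u ⊎ z ≡ b)
      by-cases (yes x≡b) = inj₁ (inj₂ x≡b)
      by-cases (no x≢b)  = inj₂ (inj₂ (near-edge nx nz x~z x≢b))
    cover x~z (near nx) (far p q) = ⊥-elim (near≢far nx (p , q) x~z)
    cover x~z (far p q) (near nz) = ⊥-elim (near≢far nz (p , q) (adj-sym G x~z))
    cover x~z (far p q) (far r s) = ⊥-elim (far-independent (p , q) (r , s) x~z)
    pages′ : ∀ {x} → x ≢ u → b ~ x → Place x → u ~ x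
    pages′ x≢u b~x (centre e) = contradiction (≡.sym e) x≢u
    pages′ x≢u b~x (near nx)  = nx
    pages′ x≢u b~x (far p q)  = ⊥-elim (near≢far nb (p , q) b~x)

-- Triangles and isolated vertices only: derivation of the contradictory weights

module NoLeafCase (O : OrderedRing) (G : Graph) (free : (V 5 -free) G) (m : ℕ) (L : OrderedRing.Carrier O) (u : Fin (order G))
                  (S : Weighted.Subeigenvector O G m L u) (no-leaf : ∀ x → Adj G u x → Link.c G u x ≢ 1) where

  open OrderedRingProperties O
  open LambdaBounds O
  open WeightedSums O
  open Weighted O
  open Budget G free m L u S
  open Triangles G free u no-leaf

  Y S₀ Q T : Carrier
  Y  = sum (λ x → ι (tri x) * y x)
  S₀ = sum (λ x → ι (iso x) * y x)
  Q  = sum (λ x → ι (ω x ℕ.* g x) * y x)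
  T  = ι 2 * S₀ + ι farEdgeEnds * M

  0≤S₀ : 0# ≤ S₀
  0≤S₀ = sum-nonNeg λ x → *-nonNeg (0≤ι (iso x)) (0≤y x)

  0≤T : 0# ≤ T
  0≤T = +-nonNeg (*-nonNeg (0≤ι 2) 0≤S₀) (*-nonNeg (0≤ι farEdgeEnds) 0≤M)

  weighted≤ : ∀ (k : Vertex → ℕ) → sum (λ x → ι (k x) * y x) ≤ ι (NatSum.sum k) * M
  weighted≤ k = ≤-respʳ (sum-ι* k M) (sum-mono-≤ λ x → *-monoˡ-≤ (0≤ι (k x)) (y≤yu x))

  data Kind (x : Vertex) : Set where
    centre     : u ≡ x → tri x ≡ 0 → iso x ≡ 0 → ω x ≡ 0 → Kind x
    onTriangle : Near x → c x ≡ 2 → tri x ≡ 1 → iso x ≡ 0 → ω x ≡ 0 → Kind x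
    isolated   : Near x → c x ≡ 0 → tri x ≡ 0 → iso x ≡ 1 → ω x ≡ 0 → Kind x
    far        : Far x → tri x ≡ 0 → iso x ≡ 0 → ω x ≡ 1 → Kind x

  kind : ∀ x → Kind x
  kind x with place x
  ... | centre ≡.refl = centre ≡.refl (tri-not-near (loopless G)) (iso-not-near (loopless G)) ω-centre
  ... | far p q       = far (p , q) (tri-not-near q) (iso-not-near q) (ω-far (p , q))
  ... | near nx with c-cases nx
  ...   | inj₁ e = isolated nx e (tri-≢2 λ e′ → contradiction (≡.trans (≡.sym e) e′) λ ()) (iso-≡1 nx e) (ω-near nx)
  ...   | inj₂ e = onTriangle nx e (tri-≡1 (nx , e)) (iso-≢0 λ e′ → contradiction (≡.trans (≡.sym e) e′) λ ()) (ω-near nx)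

  ψ : ℕ → ℕ → ℕ → Carrier → Carrier
  ψ t i k y = ι 2 * (ι t * (M - y)) + (ι 2 * (ι i * y) + ι 2 * (ι k * (M - y)))

  Ψ : Vertex → Carrier
  Ψ x = ψ (tri x) (iso x) (ω x ℕ.* g x) (y x)

  Ψ-value : ∀ {x t i w} → tri x ≡ t → iso x ≡ i → ω x ≡ w → Ψ x ≈ ψ t i (w ℕ.* g x) (y x)
  Ψ-value ≡.refl ≡.refl ≡.refl = refl

  -- Equality at the vertices of N(u). At a far vertex only the g edges to triangles are kept out of
  -- all c edges to N(u).
  Ψ≤Φ : ∀ x → Ψ x ≤ Φ x
  Ψ≤Φ x with kind x
  ... | centre ≡.refl t i w = ≤-trans (≤-reflexive (trans (Ψ-value t i w)
          (solve 2 (λ M y → :ι 2 :* (:ι 0 :* (M :- y)) :+ (:ι 2 :* (:ι 0 :* y) :+ :ι 2 :* (:ι 0 :* (M :- y))) := :ι 0) refl M (y x)))) (0≤Φ x)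
  ... | onTriangle nx e t i w = ≤-reflexive (trans (Ψ-value t i w) (trans
          (solve 2 (λ M y → :ι 2 :* (:ι 1 :* (M :- y)) :+ (:ι 2 :* (:ι 0 :* y) :+ :ι 2 :* (:ι 0 :* (M :- y)))
            := :ι 2 :* (M :- y) :+ :ι 0 :* M) refl M (y x))
          (sym (trans (Φ-two nx e) (+-congˡ (*-congʳ (ι-cong (no-leaf-neighbours no-leaf x))))))))
  ... | isolated nx e t i w = ≤-reflexive (trans (Ψ-value t i w) (trans
          (solve 2 (λ M y → :ι 2 :* (:ι 0 :* (M :- y)) :+ (:ι 2 :* (:ι 1 :* y) :+ :ι 2 :* (:ι 0 :* (M :- y)))
            := :ι 2 :* y) refl M (y x)) (sym (Φ-isolated nx e))))
  ... | far fx t i w = ≤-respˡ (sym (Ψ-value t i w)) (≤-respʳ (sym (Φ-far (proj₂ fx)))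
          (≤-by (*-nonNeg (*-nonNeg (0≤ι 2) (≤⇒0≤- (ι-mono-≤ 1g≤c))) (0≤M-y x))
            (solve 4 (λ M y c k → :ι 2 :* (c :* (M :- y)) :- (:ι 2 :* (:ι 0 :* (M :- y)) :+ (:ι 2 :* (:ι 0 :* y) :+ :ι 2 :* (k :* (M :- y))))
              := (:ι 2 :* (c :- k)) :* (M :- y)) refl M (y x) (ι (c x)) (ι (1 ℕ.* g x)))))
    where
    1g≤c : 1 ℕ.* g x ℕ.≤ c x
    1g≤c = ℕ.≤-trans (ℕ.≤-reflexive (ℕ.*-identityˡ (g x))) (g≤c x)

  sum-deficit : ∀ (k : Vertex → ℕ) → sum (λ x → ι (k x) * (M - y x)) ≈ ι (NatSum.sum k) * M - sum (λ x → ι (k x) * y x)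
  sum-deficit k = begin
    sum (λ x → ι (k x) * (M - y x))
      ≈⟨ sum-cong (λ x → solve 3 (λ k M y → k :* (M :- y) := (:- :ι 1) :* (k :* y) :+ k :* M) refl (ι (k x)) M (y x)) ⟩
    sum (λ x → (- ι 1) * (ι (k x) * y x) + ι (k x) * M)
      ≈⟨ sum-axpy (- ι 1) (λ x → ι (k x) * y x) (λ x → ι (k x) * M) ⟩
    (- ι 1) * sum (λ x → ι (k x) * y x) + sum (λ x → ι (k x) * M)
      ≈⟨ +-congˡ (sum-ι* k M) ⟩
    (- ι 1) * sum (λ x → ι (k x) * y x) + ι (NatSum.sum k) * M
      ≈⟨ solve 2 (λ s t → (:- :ι 1) :* s :+ t := t :- s) refl (sum (λ x → ι (k x) * y x)) (ι (NatSum.sum k) * M) ⟩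
    ι (NatSum.sum k) * M - sum (λ x → ι (k x) * y x) ∎
    where open ≈-Reasoning

  sumΨ≈ : sum Ψ ≈ ι 2 * (ι n * M - Y) + (ι 2 * S₀ + ι 2 * (ι q * M - Q))
  sumΨ≈ = begin
    sum Ψ
      ≈⟨ sum-axpy (ι 2) (λ x → ι (tri x) * (M - y x)) ψ₁ ⟩
    ι 2 * sum (λ x → ι (tri x) * (M - y x)) + sum ψ₁
      ≈⟨ +-cong (*-congˡ (sum-deficit tri)) (sum-axpy (ι 2) (λ x → ι (iso x) * y x) ψ₂) ⟩
    ι 2 * (ι n * M - Y) + (ι 2 * S₀ + sum ψ₂)
      ≈⟨ +-congˡ (+-congˡ (trans (sum-*ˡ (ι 2) (λ x → ι (ω x ℕ.* g x) * (M - y x))) (*-congˡ (sum-deficit (λ x → ω x ℕ.* g x))))) ⟩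
    ι 2 * (ι n * M - Y) + (ι 2 * S₀ + ι 2 * (ι q * M - Q)) ∎
    where
    open ≈-Reasoning
    ψ₁ ψ₂ : Vertex → Carrier
    ψ₂ x = ι 2 * (ι (ω x ℕ.* g x) * (M - y x))
    ψ₁ x = ι 2 * (ι (iso x) * y x) + ψ₂ x

  budget≤ : T + ι 2 * (ι n * M - Y) + ι 2 * (ι q * M - Q) ≤ ι 2 * M
  budget≤ = ≤-by
    (+-nonNeg (+-nonNeg (+-nonNeg (*-nonNeg (0≤ι 2) 0≤slacks) (*-nonNeg (0≤ι 2) (*-nonNeg 0≤L-1 (0≤slack u))))
      (*-nonNeg (0≤ι 2) (*-nonNeg 0≤excess 0≤M))) (≤⇒0≤- (sum-mono-≤ Ψ≤Φ)))
    (trans (+-congʳ budget) (trans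
      (solve 8 (λ a b c e f Z s R → (a :+ b :+ c :+ e :+ f) :- ((:ι 2 :* s :+ e) :+ Z :+ R) := a :+ b :+ c :+ (f :- (Z :+ (:ι 2 :* s :+ R))))
        refl (ι 2 * slacks) (ι 2 * ((L - ι 1) * slack u)) (ι 2 * (excess * M)) (ι farEdgeEnds * M) (sum Φ) (ι 2 * (ι n * M - Y)) S₀ (ι 2 * (ι q * M - Q)))
      (+-congˡ (+-congˡ (-‿cong (sym sumΨ≈))))))

  Ay-centre : Ay u ≈ Y + S₀
  Ay-centre = trans (sum-cong pointwise) (∑-distrib-+ (λ x → ι (tri x) * y x) (λ x → ι (iso x) * y x))
    where
    split : ∀ {x} k t i → k ≡ t ℕ.+ i → ι k * y x ≈ ι t * y x + ι i * y x
    split {x} k t i e = trans (*-congʳ (trans (ι-cong e) (ι-+ t i))) (distribʳ (y x) (ι t) (ι i))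
    pointwise : ∀ x → ι (ν x) * y x ≈ ι (tri x) * y x + ι (iso x) * y x
    pointwise x with kind x
    ... | centre ≡.refl t i _    = split (ν x) (tri x) (iso x) (≡.trans (a-loop u) (≡.sym (≡.cong₂ ℕ._+_ t i)))
    ... | onTriangle nx _ t i _  = split (ν x) (tri x) (iso x) (≡.trans (a-~ nx) (≡.sym (≡.cong₂ ℕ._+_ t i)))
    ... | isolated nx _ t i _    = split (ν x) (tri x) (iso x) (≡.trans (a-~ nx) (≡.sym (≡.cong₂ ℕ._+_ t i)))
    ... | far fx t i _           = split (ν x) (tri x) (iso x) (≡.trans (a-≁ (proj₂ fx)) (≡.sym (≡.cong₂ ℕ._+_ t i)))

  -- The eigenvalue inequality at u, doubled; the far-edge part of `T` is nonnegative and may be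
  -- added.
  total≤ : ι 2 * (L * M) ≤ ι 2 * Y + T
  total≤ = ≤-by (+-nonNeg (*-nonNeg (0≤ι 2) (0≤slack u)) (*-nonNeg (0≤ι farEdgeEnds) 0≤M))
    (trans (solve 5 (λ L M Y s e → (:ι 2 :* Y :+ (:ι 2 :* s :+ e)) :- :ι 2 :* (L :* M) := :ι 2 :* ((Y :+ s) :- L :* M) :+ e)
             refl L M Y S₀ (ι farEdgeEnds * M))
           (+-congʳ (*-congˡ (+-congʳ (sym Ay-centre)))))

  -- Sum the eigenvalue inequality over the triangle vertices and collect by the other end: u occurs
  -- n times, a triangle vertex twice, an isolated vertex never, a far vertex g times.
  inner≤ : L * Y ≤ ι n * M + ι 2 * Y + Q
  inner≤ = ≤-trans (≤-respˡ scaled (sum-mono-≤ λ x → *-monoˡ-≤ (0≤ι (tri x)) (Ly≤Ay x)))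
    (≤-respˡ (sym crossed) (≤-respʳ bound (sum-mono-≤ pointwise)))
    where
    scaled : sum (λ x → ι (tri x) * (L * y x)) ≈ L * Y
    scaled = trans (sum-cong (λ x → solve 3 (λ t L y → t :* (L :* y) := L :* (t :* y)) refl (ι (tri x)) L (y x)))
                   (sum-*ˡ L (λ x → ι (tri x) * y x))
    crossed : sum (λ x → ι (tri x) * Ay x) ≈ sum (λ z → ι (g z) * y z)
    crossed = begin
      sum (λ x → ι (tri x) * Ay x)
        ≈⟨ sum-cong (λ x → *-distribˡ-sum (ι (tri x)) (λ z → ι (a x z) * y z)) ⟩
      sum (λ x → sum (λ z → ι (tri x) * (ι (a x z) * y z)))
        ≈⟨ ∑-comm (λ x z → ι (tri x) * (ι (a x z) * y z)) ⟩
      sum (λ z → sum (λ x → ι (tri x) * (ι (a x z) * y z)))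
        ≈⟨ sum-cong (λ z → trans (sum-cong (reorder z)) (sum-ι* (λ x → a z x ℕ.* tri x) (y z))) ⟩
      sum (λ z → ι (g z) * y z) ∎
      where
      open ≈-Reasoning
      reorder : ∀ z x → ι (tri x) * (ι (a x z) * y z) ≈ ι (a z x ℕ.* tri x) * y z
      reorder z x = trans (*-congˡ (*-congʳ (ι-cong (a-sym x z))))
        (trans (solve 3 (λ t a y → t :* (a :* y) := (a :* t) :* y) refl (ι (tri x)) (ι (a z x)) (y z))
               (*-congʳ (sym (ι-* (a z x) (tri x)))))
    majorant : Vertex → Carrier
    majorant z = ι (NatSum.δ u z) * (ι n * M) + (ι 2 * (ι (tri z) * y z) + ι (ω z ℕ.* g z) * y z)
    bound : sum majorant ≈ ι n * M + ι 2 * Y + Q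
    bound = trans (∑-distrib-+ (λ z → ι (NatSum.δ u z) * (ι n * M)) (λ z → ι 2 * (ι (tri z) * y z) + ι (ω z ℕ.* g z) * y z))
      (trans (+-cong (sum-δ u (λ _ → ι n * M)) (sum-axpy (ι 2) (λ z → ι (tri z) * y z) (λ z → ι (ω z ℕ.* g z) * y z)))
             (sym (+-assoc (ι n * M) (ι 2 * Y) Q)))
    values : ∀ {z k d t w} → g z ≡ k → NatSum.δ u z ≡ d → tri z ≡ t → ω z ≡ w →
             ι k * y z ≤ ι d * (ι n * M) + (ι 2 * (ι t * y z) + ι (w ℕ.* k) * y z) → ι (g z) * y z ≤ majorant z
    values ≡.refl ≡.refl ≡.refl ≡.refl p = p
    pointwise : ∀ z → ι (g z) * y z ≤ majorant z
    pointwise z with kind z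
    ... | centre ≡.refl t i w = values g-centre (NatSum.δ-refl u) t w
            (≤-reflexive (solve 2 (λ n y → n :* y := :ι 1 :* (n :* y) :+ (:ι 2 :* (:ι 0 :* y) :+ :ι 0 :* y)) refl (ι n) M))
    ... | onTriangle nz e t i w = values (g-onTriangle (nz , e)) (NatSum.δ-≢ u z (~⇒≢ nz)) t w
            (≤-reflexive (solve 2 (λ N y → :ι 2 :* y := :ι 0 :* N :+ (:ι 2 :* (:ι 1 :* y) :+ :ι 0 :* y)) refl (ι n * M) (y z)))
    ... | isolated nz e t i w = values (ℕ.n≤0⇒n≡0 (≡.subst (g z ℕ.≤_) e (g≤c z))) (NatSum.δ-≢ u z (~⇒≢ nz)) t w
            (≤-reflexive (solve 2 (λ N y → :ι 0 :* y := :ι 0 :* N :+ (:ι 2 :* (:ι 0 :* y) :+ :ι 0 :* y)) refl (ι n * M) (y z)))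
    ... | far fz t i w = values ≡.refl (NatSum.δ-≢ u z (proj₁ fz)) t w
            (≤-respʳ (+-congˡ (+-congˡ (*-congʳ (ι-cong (≡.sym (ℕ.*-identityˡ (g z)))))))
              (≤-reflexive (solve 3 (λ N y k → k :* y := :ι 0 :* N :+ (:ι 2 :* (:ι 0 :* y) :+ k :* y)) refl (ι n * M) (y z) (ι (g z)))))

  -- Ay at w is at most gM + S₀ + bM, with 3g ≤ n and 2b ≤ `farEdgeEnds`; the factor 6 clears both
  -- denominators.
  far-weight : ∀ {w} → Far w → ι 6 * (L * y w) ≤ ι 2 * (ι n * M) + ι 3 * T
  far-weight {w} fw = ≤-by
    (+-nonNeg (+-nonNeg (+-nonNeg
      (*-nonNeg (0≤ι 6) (≤⇒0≤- (≤-trans (Ly≤Ay w) Ay≤)))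
      (*-nonNeg (*-nonNeg (0≤ι 2) (≤⇒0≤- 3g≤n′)) 0≤M))
      (*-nonNeg (*-nonNeg (0≤ι 3) (≤⇒0≤- 2b≤E)) 0≤M)) (≤-refl {0#}))
    (solve 8 (λ L M y g b n e s → (:ι 2 :* (n :* M) :+ :ι 3 :* (:ι 2 :* s :+ e :* M)) :- :ι 6 :* (L :* y)
      := :ι 6 :* ((g :* M :+ (s :+ b :* M)) :- L :* y) :+ (:ι 2 :* (n :- :ι 3 :* g)) :* M :+ (:ι 3 :* (e :- (b :+ b))) :* M :+ :ι 0)
      refl L M (y w) (ι (g w)) (ι (b w)) (ι n) (ι farEdgeEnds) S₀)
    where
    3g≤n′ : ι 3 * ι (g w) ≤ ι n
    3g≤n′ = ≤-respˡ (ι-* 3 (g w)) (ι-mono-≤ (3g≤n fw))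
    2b≤E : ι (b w) + ι (b w) ≤ ι farEdgeEnds
    2b≤E = ≤-respˡ (ι-+ (b w) (b w)) (ι-mono-≤ (2b≤farEdgeEnds fw))
    majorant : Vertex → Carrier
    majorant x = ι (a w x ℕ.* tri x) * M + (ι (iso x) * y x + ι (a w x ℕ.* ω x) * M)
    values : ∀ {x t i o} → tri x ≡ t → iso x ≡ i → ω x ≡ o →
             ι (a w x) * y x ≤ ι (a w x ℕ.* t) * M + (ι i * y x + ι (a w x ℕ.* o) * M) → ι (a w x) * y x ≤ majorant x
    values ≡.refl ≡.refl ≡.refl p = p
    zeroʳ′ : ∀ k → ι (k ℕ.* 0) ≈ ι 0
    zeroʳ′ k = ι-cong (ℕ.*-zeroʳ k)
    oneʳ′ : ∀ k → ι (k ℕ.* 1) ≈ ι k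
    oneʳ′ k = ι-cong (ℕ.*-identityʳ k)
    pointwise : ∀ x → ι (a w x) * y x ≤ majorant x
    pointwise x with kind x
    ... | centre ≡.refl t i o = values t i o (≤-trans
            (≤-reflexive (trans (*-congʳ (ι-cong (a-≁ λ w~u → proj₂ fw (adj-sym G w~u)))) (zeroˡ M)))
            (+-nonNeg (*-nonNeg (0≤ι (a w u ℕ.* 0)) 0≤M) (+-nonNeg (*-nonNeg (0≤ι 0) 0≤M) (*-nonNeg (0≤ι (a w u ℕ.* 0)) 0≤M))))
    ... | onTriangle nx e t i o = values t i o
            (≤-respʳ (+-cong (*-congʳ (sym (oneʳ′ (a w x)))) (+-congˡ (*-congʳ (sym (zeroʳ′ (a w x))))))
              (≤-respʳ (solve 3 (λ k M y → k :* M := k :* M :+ (:ι 0 :* y :+ :ι 0 :* M)) refl (ι (a w x)) M (y x))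
                (*-monoˡ-≤ (0≤ι (a w x)) (y≤yu x))))
    ... | isolated nx e t i o = values t i o
            (≤-respʳ (+-cong (*-congʳ (sym (zeroʳ′ (a w x)))) (+-congˡ (*-congʳ (sym (zeroʳ′ (a w x))))))
              (≤-respʳ (solve 2 (λ M y → y := :ι 0 :* M :+ (:ι 1 :* y :+ :ι 0 :* M)) refl M (y x))
                (ι*≤ (a≤1 w x) (0≤y x))))
    ... | far fx t i o = values t i o
            (≤-respʳ (+-cong (*-congʳ (sym (zeroʳ′ (a w x)))) (+-congˡ (*-congʳ (sym (oneʳ′ (a w x))))))
              (≤-respʳ (solve 3 (λ k M y → k :* M := :ι 0 :* M :+ (:ι 0 :* y :+ k :* M)) refl (ι (a w x)) M (y x))
                (*-monoˡ-≤ (0≤ι (a w x)) (y≤yu x))))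
    Ay≤ : Ay w ≤ ι (g w) * M + (S₀ + ι (b w) * M)
    Ay≤ = ≤-respʳ
      (trans (∑-distrib-+ (λ x → ι (a w x ℕ.* tri x) * M) (λ x → ι (iso x) * y x + ι (a w x ℕ.* ω x) * M))
        (+-cong (sum-ι* (λ x → a w x ℕ.* tri x) M)
          (trans (∑-distrib-+ (λ x → ι (iso x) * y x) (λ x → ι (a w x ℕ.* ω x) * M)) (+-congˡ (sum-ι* (λ x → a w x ℕ.* ω x) M)))))
      (sum-mono-≤ pointwise)

  outer≤ : ι 6 * (L * Q) ≤ ι q * (ι 2 * (ι n * M) + ι 3 * T)
  outer≤ = ≤-respˡ scaled (≤-respʳ (sum-ι* (λ x → ω x ℕ.* g x) bound) (sum-mono-≤ pointwise))
    where
    bound : Carrier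
    bound = ι 2 * (ι n * M) + ι 3 * T
    scaled : sum (λ x → ι (ω x ℕ.* g x) * (ι 6 * (L * y x))) ≈ ι 6 * (L * Q)
    scaled = trans (sum-cong (λ x → solve 3 (λ k L y → k :* (:ι 6 :* (L :* y)) := (:ι 6 :* L) :* (k :* y)) refl (ι (ω x ℕ.* g x)) L (y x)))
      (trans (sum-*ˡ (ι 6 * L) (λ x → ι (ω x ℕ.* g x) * y x)) (*-assoc (ι 6) L Q))
    vanishing : ∀ x → ω x ≡ 0 → ι (ω x ℕ.* g x) * (ι 6 * (L * y x)) ≤ ι (ω x ℕ.* g x) * bound
    vanishing x e = ≤-reflexive (trans (*-congʳ z) (trans (zeroˡ _) (sym (trans (*-congʳ z) (zeroˡ bound)))))
      where
      z : ι (ω x ℕ.* g x) ≈ 0#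
      z = ι-cong (≡.cong (ℕ._* g x) e)
    pointwise : ∀ x → ι (ω x ℕ.* g x) * (ι 6 * (L * y x)) ≤ ι (ω x ℕ.* g x) * bound
    pointwise x with kind x
    ... | centre _ _ _ o       = vanishing x o
    ... | onTriangle _ _ _ _ o = vanishing x o
    ... | isolated _ _ _ _ o   = vanishing x o
    ... | far fx _ _ _         = *-monoˡ-≤ (0≤ι (ω x ℕ.* g x)) (far-weight fx)

  edges≤ : ι 2 * ι n + ι q ≤ L * L - L + ι 1
  edges≤ = ≤-trans (≤-respˡ (trans (ι-+ (2 ℕ.* n) q) (+-congʳ (ι-* 2 n))) (ι-mono-≤ 2n+q≤m)) m≤
    where
    open ℕ-Solver.+-*-Solver using () renaming (solve to ℕ-solve; _:=_ to _:≡_; _:+_ to _⊕_; _:*_ to _⊛_; con to ℕ-con)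
    2n+q≤m : 2 ℕ.* n ℕ.+ q ℕ.≤ m
    2n+q≤m = ℕ.*-cancelˡ-≤ 2 (≡.subst₂ ℕ._≤_
      (ℕ-solve 2 (λ n q → ℕ-con 4 ⊛ n ⊕ ℕ-con 2 ⊛ q :≡ ℕ-con 2 ⊛ (ℕ-con 2 ⊛ n ⊕ q)) ≡.refl n q) degrees edge-count)

  weights : TriangleWeights L M Y T Q n q
  weights = record
    { large  = large
    ; 0<M    = 0<yu
    ; 0≤T    = 0≤T
    ; Y≤nM   = weighted≤ tri
    ; Q≤qM   = weighted≤ (λ x → ω x ℕ.* g x)
    ; budget = budget≤
    ; total  = total≤
    ; inner  = inner≤
    ; outer  = outer≤
    ; edges  = edges≤
    }

  absurd : ⊥
  absurd with n-cases
  ... | inj₁ n≡0 = no-triangle-absurd (≡.subst (λ k → TriangleWeights L M Y T Q k q) n≡0 weights)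
  ... | inj₂ (inj₂ 6≤n) = many-triangles-absurd weights 6≤n
  ... | inj₂ (inj₁ n≡3) = by-q q (≡.subst (λ k → TriangleWeights L M Y T Q k q) n≡3 weights)
    where
    by-q : ∀ q → TriangleWeights L M Y T Q 3 q → ⊥
    by-q 0 W = one-triangle-absurd₀ W
    by-q 1 W = one-triangle-absurd₁ W
    by-q (suc (suc q)) W = one-triangle-absurd₂ W (s≤s (s≤s z≤n))

-- The two cases combined

module SpectralBound (O : OrderedRing) where

  open OrderedRingProperties O
  open LambdaBounds O
  open Weighted O

  -- The existence of a vertex of degree one in N(u) is decidable, so this case split needs no ¬¬.
  subeigenvector-bound : ∀ (G : Graph) → (V 5 -free) G → ∀ {m L u} → Subeigenvector G m L u →
                         (∃ λ b → IsBook G u b) × L * L - L + ι 1 ≤ ι m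
  subeigenvector-bound G free {m} {L} {u} S = by-cases (Fin.any? λ x → adj? G u x ×-dec (c x ℕ.≟ 1))
    where
    open Link G u using (c)
    by-cases : Dec (∃ λ x → Adj G u x × c x ≡ 1) → (∃ λ b → IsBook G u b) × L * L - L + ι 1 ≤ ι m
    by-cases (no none) = ⊥-elim (NoLeafCase.absurd O G free m L u S λ x nx e → none (x , nx , e))
    by-cases (yes (l , nl , cl)) = case neighbour l (ℕ.≤-reflexive (≡.sym cl)) of λ (b , l~b , nb) →
        let open LeafCase O G free m L u S l b nl cl nb l~b using (book; excess≤0)
        in (b , book) , ≤-by (≤⇒0≤- excess≤0)
             (solve 2 (λ L m → m :- L := :ι 0 :- (L :- m)) refl (L * L - L + ι 1) (ι m))
      where
      open FanFree G free u using (neighbour)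

-- The handshake identity

module Handshake (G : Graph) where

  open NatSum

  indicator : ∀ {A : Set} {P : Pred A 0ℓ} → Decidable P → A → ℕ
  indicator P? x = if does (P? x) then 1 else 0

  length-filter-∷ : ∀ {A : Set} {P : Pred A 0ℓ} (P? : Decidable P) x xs →
                    length (filter P? (x ∷ xs)) ≡ indicator P? x ℕ.+ length (filter P? xs)
  length-filter-∷ P? x xs with does (P? x)
  ... | true  = ≡.refl
  ... | false = ≡.refl

  length-filter-tabulate : ∀ {A : Set} {P : Pred A 0ℓ} (P? : Decidable P) {n} (f : Fin n → A) →
                           length (filter P? (tabulate f)) ≡ sum (λ i → indicator P? (f i))
  length-filter-tabulate P? {zero}  f = ≡.refl
  length-filter-tabulate P? {suc n} f = ≡.trans (length-filter-∷ P? (f zero) _)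
    (≡.cong (indicator P? (f zero) ℕ.+_) (length-filter-tabulate P? (f ∘ suc)))

  length-filter-product : ∀ {A B : Set} {P : Pred (A × B) 0ℓ} (P? : Decidable P) {m n} (f : Fin m → A) (g : Fin n → B) →
    length (filter P? (cartesianProduct (tabulate f) (tabulate g))) ≡ sum (λ i → sum (λ j → indicator P? (f i , g j)))
  length-filter-product P? {zero}  f g = ≡.refl
  length-filter-product P? {suc m} f g = ≡.trans
    (≡.trans (≡.cong length (List.filter-++ P? (map (f zero ,_) (tabulate g)) _)) (List.length-++ (filter P? (map (f zero ,_) (tabulate g)))))
    (≡.cong₂ ℕ._+_
      (≡.trans (≡.cong (length ∘ filter P?) (List.map-tabulate g (f zero ,_))) (length-filter-tabulate P? (λ j → f zero , g j)))
      (length-filter-product P? (f ∘ suc) g))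

  module _ (u : Fin (order G)) where

    open Link G u

    -- `size` counts pairs with i < j, and an adjacent pair is increasing in exactly one of its two
    -- orientations.
    sum-degree≡2size : sum degree ≡ 2 ℕ.* size G
    sum-degree≡2size = begin
      sum (λ i → sum (a i))                                      ≡⟨ sum-cong-≗ (λ i → sum-cong-≗ (orient i)) ⟩
      sum (λ i → sum (λ j → e i j ℕ.+ e j i))                    ≡⟨ sum-cong-≗ (λ i → ∑-distrib-+ (e i) (λ j → e j i)) ⟩
      sum (λ i → sum (e i) ℕ.+ sum (λ j → e j i))                ≡⟨ ∑-distrib-+ (λ i → sum (e i)) (λ i → sum (λ j → e j i)) ⟩
      sum (λ i → sum (e i)) ℕ.+ sum (λ i → sum (λ j → e j i))    ≡⟨ ≡.cong₂ ℕ._+_ (≡.sym size≡) (≡.trans (≡.sym (∑-comm e)) (≡.sym size≡)) ⟩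
      size G ℕ.+ size G                                          ≡⟨ ≡.cong (size G ℕ.+_) (ℕ.+-identityʳ (size G)) ⟨
      2 ℕ.* size G ∎
      where
      open ≡.≡-Reasoning
      isEdge : Decidable (λ (i , j) → i Fin.< j × i ~ j)
      isEdge (i , j) = (i Fin.<? j) ×-dec adj? G i j
      e : Vertex → Vertex → ℕ
      e i j = indicator isEdge (i , j)
      size≡ : size G ≡ sum (λ i → sum (e i))
      size≡ = length-filter-product isEdge id id
      e-edge : ∀ {i j} → i Fin.< j × i ~ j → e i j ≡ 1
      e-edge {i} {j} p = ≡.cong (λ b → if b then 1 else 0) (dec-true (isEdge (i , j)) p)
      e-non-edge : ∀ {i j} → ¬ (i Fin.< j × i ~ j) → e i j ≡ 0
      e-non-edge {i} {j} p = ≡.cong (λ b → if b then 1 else 0) (dec-false (isEdge (i , j)) p)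
      orient : ∀ i j → a i j ≡ e i j ℕ.+ e j i
      orient i j = by-cases (adj? G i j)
        where
        by-cases : Dec (i ~ j) → a i j ≡ e i j ℕ.+ e j i
        by-cases (no i≁j) = ≡.trans (a-≁ i≁j) (≡.sym (≡.cong₂ ℕ._+_ (e-non-edge (i≁j ∘ proj₂)) (e-non-edge (i≁j ∘ adj-sym G ∘ proj₂))))
        by-cases (yes i~j) with Fin.<-cmp i j
        ... | tri< i<j _ j≮i = ≡.trans (a-~ i~j) (≡.sym (≡.cong₂ ℕ._+_ (e-edge (i<j , i~j)) (e-non-edge (j≮i ∘ proj₁))))
        ... | tri≈ _ i≡j _   = contradiction i≡j (~⇒≢ i~j)
        ... | tri> i≮j _ j<i = ≡.trans (a-~ i~j) (≡.sym (≡.cong₂ ℕ._+_ (e-non-edge (i≮j ∘ proj₁)) (e-edge (j<i , adj-sym G i~j))))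

-- Rows, degrees and size of a book

module BookSpectrum (G : Graph) (u b : Fin (order G)) (book : IsBook G u b) where

  open IsBook book
  open Link G u hiding (b)
  open NatSum

  u≢b : u ≢ b
  u≢b = ~⇒≢ spine

  page : Vertex → ℕ
  page x = a u x ℕ.* a b x

  pageCount : ℕ
  pageCount = sum page

  page≤1 : ∀ x → page x ℕ.≤ 1
  page≤1 x = ℕ.*-mono-≤ (a≤1 u x) (a≤1 b x)

  page-centre : page u ≡ 0
  page-centre = ≡.cong (ℕ._* a b u) (a-loop u)

  page-b : page b ≡ 0
  page-b = ≡.trans (≡.cong (a u b ℕ.*_) (a-loop b)) (ℕ.*-zeroʳ (a u b))

  u-page : ∀ {x} → x ≢ b → a u x ≡ page x
  u-page {x} x≢b = by-cases (adj? G u x)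
    where
    by-cases : Dec (u ~ x) → a u x ≡ page x
    by-cases (yes u~x) = ≡.trans (≡.sym (ℕ.*-identityʳ (a u x))) (≡.cong (a u x ℕ.*_) (≡.sym (a-~ (pages x≢b u~x))))
    by-cases (no u≁x)  = ≡.trans (a-≁ u≁x) (≡.sym (≡.cong (ℕ._* a b x) (a-≁ u≁x)))

  b-page : ∀ {x} → x ≢ u → a b x ≡ page x
  b-page {x} x≢u = by-cases (adj? G b x)
    where
    by-cases : Dec (b ~ x) → a b x ≡ page x
    by-cases (yes b~x) = ≡.trans (≡.sym (ℕ.*-identityˡ (a b x))) (≡.cong (ℕ._* a b x) (≡.sym (a-~ (pages′ x≢u b~x))))
    by-cases (no b≁x)  = ≡.trans (a-≁ b≁x) (≡.sym (≡.trans (≡.cong (a u x ℕ.*_) (a-≁ b≁x)) (ℕ.*-zeroʳ (a u x))))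

  row-u : ∀ x → a u x ≡ δ b x ℕ.+ page x
  row-u x with b Fin.≟ x
  ... | yes ≡.refl = ≡.trans (a-~ spine) (≡.sym (≡.cong₂ ℕ._+_ (δ-refl b) page-b))
  ... | no b≢x     = ≡.trans (u-page (λ e → b≢x (≡.sym e))) (≡.cong (ℕ._+ page x) (≡.sym (δ-≢ b x b≢x)))

  row-b : ∀ x → a b x ≡ δ u x ℕ.+ page x
  row-b x with u Fin.≟ x
  ... | yes ≡.refl = ≡.trans (a-~ (adj-sym G spine)) (≡.sym (≡.cong₂ ℕ._+_ (δ-refl u) page-centre))
  ... | no u≢x     = ≡.trans (b-page (λ e → u≢x (≡.sym e))) (≡.cong (ℕ._+ page x) (≡.sym (δ-≢ u x u≢x)))

  -- One formula serves pages, joined to exactly u and b, and isolated vertices, for which the page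
  -- indicator is 0.
  row-other : ∀ {i} → u ≢ i → b ≢ i → ∀ x → a i x ≡ page i ℕ.* (δ u x ℕ.+ δ b x)
  row-other {i} u≢i b≢i x with u Fin.≟ x | b Fin.≟ x
  ... | yes ≡.refl | _ = ≡.trans (a-sym i u) (≡.trans (u-page (λ e → b≢i (≡.sym e)))
          (≡.trans (≡.sym (ℕ.*-identityʳ (page i))) (≡.cong (page i ℕ.*_) (≡.sym (≡.cong₂ ℕ._+_ (δ-refl u) (δ-≢ b u (λ e → u≢b (≡.sym e))))))))
  ... | no u≢x | yes ≡.refl = ≡.trans (a-sym i b) (≡.trans (b-page (λ e → u≢i (≡.sym e)))
          (≡.trans (≡.sym (ℕ.*-identityʳ (page i))) (≡.cong (page i ℕ.*_) (≡.sym (≡.cong₂ ℕ._+_ (δ-≢ u b u≢x) (δ-refl b))))))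
  ... | no u≢x | no b≢x = ≡.trans (a-≁ not-adjacent)
          (≡.sym (≡.trans (≡.cong (page i ℕ.*_) (≡.cong₂ ℕ._+_ (δ-≢ u x u≢x) (δ-≢ b x b≢x))) (ℕ.*-zeroʳ (page i))))
    where
    not-adjacent : ¬ i ~ x
    not-adjacent i~x with cover i~x
    ... | inj₁ (inj₁ e) = u≢i (≡.sym e)
    ... | inj₁ (inj₂ e) = b≢i (≡.sym e)
    ... | inj₂ (inj₁ e) = u≢x (≡.sym e)
    ... | inj₂ (inj₂ e) = b≢x (≡.sym e)

  spine-degree : ∀ {i} v → (∀ x → a i x ≡ δ v x ℕ.+ page x) → degree i ≡ suc pageCount
  spine-degree v row = ≡.trans (sum-cong-≗ row) (≡.trans (∑-distrib-+ (δ v) page) (≡.cong (ℕ._+ pageCount) (sum-δ₁ v)))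

  values : ∀ {i d e p} → δ u i ≡ d → δ b i ≡ e → page i ≡ p →
           degree i ≡ d ℕ.* suc pageCount ℕ.+ e ℕ.* suc pageCount ℕ.+ 2 ℕ.* p →
           degree i ≡ δ u i ℕ.* suc pageCount ℕ.+ δ b i ℕ.* suc pageCount ℕ.+ 2 ℕ.* page i
  values ≡.refl ≡.refl ≡.refl e = e

  degree-formula : ∀ i → degree i ≡ δ u i ℕ.* suc pageCount ℕ.+ δ b i ℕ.* suc pageCount ℕ.+ 2 ℕ.* page i
  degree-formula i with u Fin.≟ i | b Fin.≟ i
  ... | yes ≡.refl | _ = values (δ-refl u) (δ-≢ b u (λ e → u≢b (≡.sym e))) page-centre
          (≡.trans (spine-degree b row-u) (solve 1 (λ k → k := con 1 :* k :+ con 0 :* k :+ con 2 :* con 0) ≡.refl (suc pageCount)))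
    where open ℕ-Solver.+-*-Solver
  ... | no u≢i | yes ≡.refl = values (δ-≢ u b u≢i) (δ-refl b) page-b
          (≡.trans (spine-degree u row-b) (solve 1 (λ k → k := con 0 :* k :+ con 1 :* k :+ con 2 :* con 0) ≡.refl (suc pageCount)))
    where open ℕ-Solver.+-*-Solver
  ... | no u≢i | no b≢i = values (δ-≢ u i u≢i) (δ-≢ b i b≢i) ≡.refl
          (≡.trans (sum-cong-≗ (row-other u≢i b≢i)) (≡.trans (≡.sym (*-distribˡ-sum (page i) (λ x → δ u x ℕ.+ δ b x)))
          (≡.trans (≡.cong (page i ℕ.*_) (≡.trans (∑-distrib-+ (δ u) (δ b)) (≡.cong₂ ℕ._+_ (sum-δ₁ u) (sum-δ₁ b)))) (ℕ.*-comm (page i) 2))))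

  -- With k pages, the degrees k + 1 at the two spine vertices and 2 at each page sum to 2(2k + 1).
  book-size : suc (2 ℕ.* pageCount) ≡ size G
  book-size = ℕ.*-cancelˡ-≡ (suc (2 ℕ.* pageCount)) (size G) 2 (≡.trans (≡.sym total) (Handshake.sum-degree≡2size G u))
    where
    open ≡.≡-Reasoning
    k : ℕ
    k = suc pageCount
    total : sum degree ≡ 2 ℕ.* suc (2 ℕ.* pageCount)
    total = begin
      sum degree
        ≡⟨ sum-cong-≗ degree-formula ⟩
      sum (λ i → δ u i ℕ.* k ℕ.+ δ b i ℕ.* k ℕ.+ 2 ℕ.* page i)
        ≡⟨ ∑-distrib-+ (λ i → δ u i ℕ.* k ℕ.+ δ b i ℕ.* k) (λ i → 2 ℕ.* page i) ⟩
      sum (λ i → δ u i ℕ.* k ℕ.+ δ b i ℕ.* k) ℕ.+ sum (λ i → 2 ℕ.* page i)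
        ≡⟨ ≡.cong₂ ℕ._+_ (≡.trans (∑-distrib-+ (λ i → δ u i ℕ.* k) (λ i → δ b i ℕ.* k)) (≡.cong₂ ℕ._+_ (sum-δ u (λ _ → k)) (sum-δ b (λ _ → k))))
             (≡.sym (*-distribˡ-sum 2 page)) ⟩
      k ℕ.+ k ℕ.+ 2 ℕ.* pageCount
        ≡⟨ solve 1 (λ p → (con 1 :+ p) :+ (con 1 :+ p) :+ con 2 :* p := con 2 :* (con 1 :+ con 2 :* p)) ≡.refl pageCount ⟩
      2 ℕ.* suc (2 ℕ.* pageCount) ∎
      where open ℕ-Solver.+-*-Solver

-- An explicit eigenvector of a book

module BookEigenvector (O : OrderedRing) (G : Graph) (u b : Fin (order G)) (book : IsBook G u b) where

  open BookSpectrum G u b book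
  open Link G u hiding (b)
  open NatSum using (δ; δ-refl; δ-≢)
  open OrderedRingProperties O
  open WeightedSums O using (sum-cong; sum-ι*) renaming (sum-δ to ∑-δ)

  -- Value r on the spine and 2 on the pages. The equation at a page reads r + r = r · 2, and the
  -- one on the spine, with k pages, reads r + 2k = r².
  entry : Carrier → Vertex → Carrier
  entry r x = ι (δ u x) * r + (ι (δ b x) * r + ι (page x) * ι 2)

  entry-value : ∀ r {x d e p} → δ u x ≡ d → δ b x ≡ e → page x ≡ p → entry r x ≈ ι d * r + (ι e * r + ι p * ι 2)
  entry-value r ≡.refl ≡.refl ≡.refl = refl

  entry-u : ∀ r → entry r u ≈ r
  entry-u r = trans (entry-value r (δ-refl u) (δ-≢ b u (λ e → u≢b (≡.sym e))) page-centre)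
    (solve 1 (λ r → :ι 1 :* r :+ (:ι 0 :* r :+ :ι 0 :* :ι 2) := r) refl r)

  entry-b : ∀ r → entry r b ≈ r
  entry-b r = trans (entry-value r (δ-≢ u b u≢b) (δ-refl b) page-b)
    (solve 1 (λ r → :ι 0 :* r :+ (:ι 1 :* r :+ :ι 0 :* :ι 2) := r) refl r)

  pages-entry : ∀ r x → ι (page x) * entry r x ≈ ι (page x) * ι 2
  pages-entry r x with u Fin.≟ x | b Fin.≟ x
  ... | yes ≡.refl | _ = vanish
    where
    vanish : ι (page u) * entry r u ≈ ι (page u) * ι 2
    vanish = trans (*-congʳ (ι-cong page-centre)) (trans (zeroˡ (entry r u)) (sym (trans (*-congʳ (ι-cong page-centre)) (zeroˡ (ι 2)))))
  ... | no _ | yes ≡.refl = trans (*-congʳ (ι-cong page-b)) (trans (zeroˡ (entry r b)) (sym (trans (*-congʳ (ι-cong page-b)) (zeroˡ (ι 2)))))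
  ... | no u≢x | no b≢x = trans (*-congˡ (entry-value r (δ-≢ u x u≢x) (δ-≢ b x b≢x) ≡.refl)) (idempotent (page≤1 x))
    where
    idempotent : ∀ {k} → k ℕ.≤ 1 → ι k * (ι 0 * r + (ι 0 * r + ι k * ι 2)) ≈ ι k * ι 2
    idempotent {zero}        _ = solve 1 (λ r → :ι 0 :* (:ι 0 :* r :+ (:ι 0 :* r :+ :ι 0 :* :ι 2)) := :ι 0 :* :ι 2) refl r
    idempotent {suc zero}    _ = solve 1 (λ r → :ι 1 :* (:ι 0 :* r :+ (:ι 0 :* r :+ :ι 1 :* :ι 2)) := :ι 1 :* :ι 2) refl r
    idempotent {suc (suc k)} (s≤s ())

  spine-row : ∀ r (i : Vertex) (v : Vertex) → (∀ x → a i x ≡ δ v x ℕ.+ page x) →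
              sum (λ x → ι (a i x) * entry r x) ≈ entry r v + ι pageCount * ι 2
  spine-row r i v row = trans (sum-cong λ x → trans (*-congʳ (trans (ι-cong (row x)) (ι-+ (δ v x) (page x))))
        (trans (distribʳ (entry r x) (ι (δ v x)) (ι (page x))) (+-congˡ (pages-entry r x))))
    (trans (∑-distrib-+ (λ x → ι (δ v x) * entry r x) (λ x → ι (page x) * ι 2))
      (+-cong (∑-δ v (entry r)) (sum-ι* page (ι 2))))

  eigenvector : ∀ r → r * r ≈ r + ι pageCount * ι 2 → ∀ i → sum (λ x → ι (a i x) * entry r x) ≈ r * entry r i
  eigenvector r r²≈ i with u Fin.≟ i | b Fin.≟ i
  ... | yes ≡.refl | _ = trans (spine-row r u b row-u) (trans (+-congʳ (entry-b r)) (trans (sym r²≈) (*-congˡ (sym (entry-u r)))))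
  ... | no _ | yes ≡.refl = trans (spine-row r b u row-b) (trans (+-congʳ (entry-u r)) (trans (sym r²≈) (*-congˡ (sym (entry-b r)))))
  ... | no u≢i | no b≢i = begin
    sum (λ x → ι (a i x) * entry r x)
      ≈⟨ sum-cong (λ x → trans (*-congʳ (trans (ι-cong (row-other u≢i b≢i x)) (trans (ι-* (page i) (δ u x ℕ.+ δ b x)) (*-congˡ (ι-+ (δ u x) (δ b x))))))
           (solve 4 (λ p d e z → (p :* (d :+ e)) :* z := p :* (d :* z) :+ p :* (e :* z)) refl (ι (page i)) (ι (δ u x)) (ι (δ b x)) (entry r x))) ⟩
    sum (λ x → ι (page i) * (ι (δ u x) * entry r x) + ι (page i) * (ι (δ b x) * entry r x))
      ≈⟨ ∑-distrib-+ (λ x → ι (page i) * (ι (δ u x) * entry r x)) (λ x → ι (page i) * (ι (δ b x) * entry r x)) ⟩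
    sum (λ x → ι (page i) * (ι (δ u x) * entry r x)) + sum (λ x → ι (page i) * (ι (δ b x) * entry r x))
      ≈⟨ +-cong (column u) (column b) ⟩
    ι (page i) * entry r u + ι (page i) * entry r b
      ≈⟨ +-cong (*-congˡ (entry-u r)) (*-congˡ (entry-b r)) ⟩
    ι (page i) * r + ι (page i) * r
      ≈⟨ solve 2 (λ p r → p :* r :+ p :* r := r :* (:ι 0 :* r :+ (:ι 0 :* r :+ p :* :ι 2))) refl (ι (page i)) r ⟩
    r * (ι 0 * r + (ι 0 * r + ι (page i) * ι 2))
      ≈⟨ *-congˡ (entry-value r (δ-≢ u i u≢i) (δ-≢ b i b≢i) ≡.refl) ⟨
    r * entry r i ∎
    where
    open ≈-Reasoning
    column : ∀ v → sum (λ x → ι (page i) * (ι (δ v x) * entry r x)) ≈ ι (page i) * entry r v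
    column v = trans (sym (*-distribˡ-sum (ι (page i)) (λ x → ι (δ v x) * entry r x))) (*-congˡ (∑-δ v (entry r)))

-- Sorting vertices by kind, and adjacency in K₂ ∨ tK₁ by kind

module Slots where

  data Kind : Set where
    spine page other : Kind

  isSpine isPage : Kind → ℕ
  isSpine spine = 1
  isSpine page  = 0
  isSpine other = 0
  isPage spine = 0
  isPage page  = 1
  isPage other = 0

  Slot : ℕ → ℕ → ℕ → Set
  Slot p t z = (Fin p ⊎ Fin t) ⊎ Fin z

  slotKind : ∀ {p t z} → Slot p t z → Kind
  slotKind (inj₁ (inj₁ _)) = spine
  slotKind (inj₁ (inj₂ _)) = page
  slotKind (inj₂ _)        = other

  record Sorted {n} (κ : Fin n → Kind) (p t z : ℕ) : Set where
    field
      to      : Fin n → Slot p t z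
      from    : Slot p t z → Fin n
      to-from : ∀ s → to (from s) ≡ s
      from-to : ∀ i → from (to i) ≡ i
      kind    : ∀ i → slotKind (to i) ≡ κ i

  -- One slot of kind k is adjoined. `unshift` is `nothing` exactly at the new slot, which makes the
  -- bijection extend by sending vertex `zero` there.
  record Insertion (k : Kind) (p t z p′ t′ z′ : ℕ) : Set where
    field
      new           : Slot p′ t′ z′
      shift         : Slot p t z → Slot p′ t′ z′
      unshift       : Slot p′ t′ z′ → Maybe (Slot p t z)
      unshift-new   : unshift new ≡ nothing
      unshift-shift : ∀ s → unshift (shift s) ≡ just s
      shift-unshift : ∀ s → maybe shift new (unshift s) ≡ s
      new-kind      : slotKind new ≡ k
      shift-kind    : ∀ s → slotKind (shift s) ≡ slotKind s

  insert-spine : ∀ {p t z} → Insertion spine p t z (suc p) t z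
  insert-spine = record
    { new           = inj₁ (inj₁ zero)
    ; shift         = λ { (inj₁ (inj₁ j)) → inj₁ (inj₁ (suc j)) ; (inj₁ (inj₂ j)) → inj₁ (inj₂ j) ; (inj₂ j) → inj₂ j }
    ; unshift       = λ { (inj₁ (inj₁ zero)) → nothing ; (inj₁ (inj₁ (suc j))) → just (inj₁ (inj₁ j))
                        ; (inj₁ (inj₂ j)) → just (inj₁ (inj₂ j)) ; (inj₂ j) → just (inj₂ j) }
    ; unshift-new   = ≡.refl
    ; unshift-shift = λ { (inj₁ (inj₁ _)) → ≡.refl ; (inj₁ (inj₂ _)) → ≡.refl ; (inj₂ _) → ≡.refl }
    ; shift-unshift = λ { (inj₁ (inj₁ zero)) → ≡.refl ; (inj₁ (inj₁ (suc _))) → ≡.refl ; (inj₁ (inj₂ _)) → ≡.refl ; (inj₂ _) → ≡.refl }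
    ; new-kind      = ≡.refl
    ; shift-kind    = λ { (inj₁ (inj₁ _)) → ≡.refl ; (inj₁ (inj₂ _)) → ≡.refl ; (inj₂ _) → ≡.refl }
    }

  insert-page : ∀ {p t z} → Insertion page p t z p (suc t) z
  insert-page = record
    { new           = inj₁ (inj₂ zero)
    ; shift         = λ { (inj₁ (inj₁ j)) → inj₁ (inj₁ j) ; (inj₁ (inj₂ j)) → inj₁ (inj₂ (suc j)) ; (inj₂ j) → inj₂ j }
    ; unshift       = λ { (inj₁ (inj₂ zero)) → nothing ; (inj₁ (inj₂ (suc j))) → just (inj₁ (inj₂ j))
                        ; (inj₁ (inj₁ j)) → just (inj₁ (inj₁ j)) ; (inj₂ j) → just (inj₂ j) }
    ; unshift-new   = ≡.refl
    ; unshift-shift = λ { (inj₁ (inj₁ _)) → ≡.refl ; (inj₁ (inj₂ _)) → ≡.refl ; (inj₂ _) → ≡.refl }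
    ; shift-unshift = λ { (inj₁ (inj₂ zero)) → ≡.refl ; (inj₁ (inj₂ (suc _))) → ≡.refl ; (inj₁ (inj₁ _)) → ≡.refl ; (inj₂ _) → ≡.refl }
    ; new-kind      = ≡.refl
    ; shift-kind    = λ { (inj₁ (inj₁ _)) → ≡.refl ; (inj₁ (inj₂ _)) → ≡.refl ; (inj₂ _) → ≡.refl }
    }

  insert-other : ∀ {p t z} → Insertion other p t z p t (suc z)
  insert-other = record
    { new           = inj₂ zero
    ; shift         = Sum.map₂ suc
    ; unshift       = λ { (inj₁ s) → just (inj₁ s) ; (inj₂ zero) → nothing ; (inj₂ (suc j)) → just (inj₂ j) }
    ; unshift-new   = ≡.refl
    ; unshift-shift = λ { (inj₁ _) → ≡.refl ; (inj₂ _) → ≡.refl }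
    ; shift-unshift = λ { (inj₁ _) → ≡.refl ; (inj₂ zero) → ≡.refl ; (inj₂ (suc _)) → ≡.refl }
    ; new-kind      = ≡.refl
    ; shift-kind    = λ { (inj₁ (inj₁ _)) → ≡.refl ; (inj₁ (inj₂ _)) → ≡.refl ; (inj₂ _) → ≡.refl }
    }

  insert : ∀ {k n} {κ : Fin (suc n) → Kind} {p t z p′ t′ z′} → Insertion k p t z p′ t′ z′ →
           κ zero ≡ k → Sorted (κ ∘ suc) p t z → Sorted κ p′ t′ z′
  insert {n = n} {κ} {p} {t} {z} {p′} {t′} {z′} I e S = record
    { to      = to′
    ; from    = λ s → from′ (unshift s)
    ; to-from = λ s → ≡.trans (to′-from′ (unshift s)) (shift-unshift s)
    ; from-to = λ { zero → ≡.cong from′ unshift-new ; (suc i) → ≡.trans (≡.cong from′ (unshift-shift (to i))) (≡.cong suc (from-to i)) }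
    ; kind    = λ { zero → ≡.trans new-kind (≡.sym e) ; (suc i) → ≡.trans (shift-kind (to i)) (kind i) }
    }
    where
    open Insertion I
    open Sorted S
    to′ : Fin (suc n) → Slot p′ t′ z′
    to′ zero    = new
    to′ (suc i) = shift (to i)
    from′ : Maybe (Slot p t z) → Fin (suc n)
    from′ = maybe (suc ∘ from) zero
    to′-from′ : ∀ s → to′ (from′ s) ≡ maybe shift new s
    to′-from′ (just s) = ≡.cong shift (to-from s)
    to′-from′ nothing  = ≡.refl

  open NatSum using (sum)

  -- The numbers of spine and page slots are sums of indicators, so that they can later be rewritten
  -- to 2 and the number of pages; the remaining count is free.
  sort : ∀ {n} (κ : Fin n → Kind) → ∃ λ z → Sorted κ (sum (isSpine ∘ κ)) (sum (isPage ∘ κ)) z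
  sort {zero} κ = 0 , record
    { to      = λ ()
    ; from    = λ { (inj₁ (inj₁ ())) ; (inj₁ (inj₂ ())) ; (inj₂ ()) }
    ; to-from = λ { (inj₁ (inj₁ ())) ; (inj₁ (inj₂ ())) ; (inj₂ ()) }
    ; from-to = λ ()
    ; kind    = λ ()
    }
  sort {suc n} κ = extend (κ zero) ≡.refl (sort (κ ∘ suc))
    where
    p t : ℕ
    p = sum (isSpine ∘ κ ∘ suc)
    t = sum (isPage ∘ κ ∘ suc)
    extend : ∀ k → κ zero ≡ k → (∃ λ z → Sorted (κ ∘ suc) p t z) →
             ∃ λ z → Sorted κ (isSpine (κ zero) ℕ.+ p) (isPage (κ zero) ℕ.+ t) z
    extend spine e (z , S) = z , ≡.subst (λ k → Sorted κ (isSpine k ℕ.+ p) (isPage k ℕ.+ t) z) (≡.sym e) (insert insert-spine e S)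
    extend page  e (z , S) = z , ≡.subst (λ k → Sorted κ (isSpine k ℕ.+ p) (isPage k ℕ.+ t) z) (≡.sym e) (insert insert-page e S)
    extend other e (z , S) = suc z , ≡.subst (λ k → Sorted κ (isSpine k ℕ.+ p) (isPage k ℕ.+ t) (suc z)) (≡.sym e) (insert insert-other e S)

  -- Adjacency is decided by kinds except between two spine vertices, where D expresses that they
  -- are distinct.
  Joined : Kind → Kind → Set → Set
  Joined spine spine D = D
  Joined spine page  _ = ⊤
  Joined page  spine _ = ⊤
  Joined spine other _ = ⊥
  Joined page  page  _ = ⊥
  Joined page  other _ = ⊥
  Joined other _     _ = ⊥

  joined-map : ∀ k l {D E : Set} → (D → E) → Joined k l D → Joined k l E
  joined-map spine spine f d = f d
  joined-map spine page  f _ = tt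
  joined-map page  spine f _ = tt

  joined-spine : ∀ k l {D} → Joined k l D → k ≡ spine ⊎ l ≡ spine
  joined-spine spine _     _ = inj₁ ≡.refl
  joined-spine page  spine _ = inj₂ ≡.refl

  bookGraph : ℕ → ℕ → Graph
  bookGraph t z = (K 2 ∨ edgeless t) ∪ edgeless z

  module BookGraph (t z : ℕ) where

    fill : Slot 2 t z → Fin (order (bookGraph t z))
    fill s = join (2 ℕ.+ t) z (Sum.map₁ (join 2 t) s)

    slot : Fin (order (bookGraph t z)) → Slot 2 t z
    slot i = Sum.map₁ (splitAt 2) (splitAt (2 ℕ.+ t) i)

    slot-fill : ∀ s → slot (fill s) ≡ s
    slot-fill (inj₁ s) = ≡.trans (≡.cong (Sum.map₁ (splitAt 2)) (Fin.splitAt-join (2 ℕ.+ t) z (inj₁ (join 2 t s))))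
                                  (≡.cong inj₁ (Fin.splitAt-join 2 t s))
    slot-fill (inj₂ j) = ≡.cong (Sum.map₁ (splitAt 2)) (Fin.splitAt-join (2 ℕ.+ t) z (inj₂ j))

    fill-slot : ∀ i → fill (slot i) ≡ i
    fill-slot i = ≡.trans (≡.cong (join (2 ℕ.+ t) z) (cancel-map (splitAt (2 ℕ.+ t) i))) (Fin.join-splitAt (2 ℕ.+ t) z i)
      where
      cancel-map : ∀ s → Sum.map₁ (join 2 t) (Sum.map₁ (splitAt 2) s) ≡ s
      cancel-map (inj₁ j) = ≡.cong inj₁ (Fin.join-splitAt 2 t j)
      cancel-map (inj₂ j) = ≡.refl

    slot-injective : ∀ i j → slot i ≡ slot j → i ≡ j
    slot-injective i j e = ≡.trans (≡.sym (fill-slot i)) (≡.trans (≡.cong fill e) (fill-slot j))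

    bookGraph-adj : ∀ i j → Adj (bookGraph t z) i j ⇔ Joined (slotKind (slot i)) (slotKind (slot j)) (slot i ≢ slot j)
    bookGraph-adj i j with splitAt (2 ℕ.+ t) i | splitAt (2 ℕ.+ t) j
    ... | inj₂ _ | inj₁ _ = mk⇔ (λ ()) (λ ())
    ... | inj₂ _ | inj₂ _ = mk⇔ (λ ()) (λ ())
    ... | inj₁ k | inj₂ _ with splitAt 2 k
    ...   | inj₁ _ = mk⇔ (λ ()) (λ ())
    ...   | inj₂ _ = mk⇔ (λ ()) (λ ())
    bookGraph-adj i j | inj₁ k | inj₁ l with splitAt 2 k | splitAt 2 l
    ...   | inj₁ p | inj₁ q = mk⇔ (λ p≢q e → p≢q (Sum.inj₁-injective (Sum.inj₁-injective e))) (λ ≢ e → ≢ (≡.cong (inj₁ ∘ inj₁) e))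
    ...   | inj₁ _ | inj₂ _ = mk⇔ id id
    ...   | inj₂ _ | inj₁ _ = mk⇔ id id
    ...   | inj₂ _ | inj₂ _ = mk⇔ id id

-- Books are the graphs K₂ ∨ tK₁ up to isolated vertices

module BookIso where

  open Slots
  open NatSum

  module _ (G : Graph) (u b : Fin (order G)) (book : IsBook G u b) where

    open IsBook book renaming (spine to u~b)
    open BookSpectrum G u b book using (u≢b; pageCount; page-centre; page-b) renaming (page to pageIndicator)
    open Link G u hiding (b)

    data View (x : Vertex) : Set where
      isU     : x ≡ u → View x
      isB     : x ≡ b → View x
      isLeaf  : x ≢ u → x ≢ b → u ~ x → b ~ x → View x
      outside : x ≢ u → x ≢ b → ¬ u ~ x → ¬ b ~ x → View x

    view : ∀ x → View x
    view x with x Fin.≟ u | x Fin.≟ b | adj? G u x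
    ... | yes e  | _      | _       = isU e
    ... | no _   | yes e  | _       = isB e
    ... | no x≢u | no x≢b | yes u~x = isLeaf x≢u x≢b u~x (pages x≢b u~x)
    ... | no x≢u | no x≢b | no u≁x  = outside x≢u x≢b u≁x (λ b~x → u≁x (pages′ x≢u b~x))

    viewKind : ∀ {x} → View x → Kind
    viewKind (isU _)           = spine
    viewKind (isB _)           = spine
    viewKind (isLeaf _ _ _ _)  = page
    viewKind (outside _ _ _ _) = other

    κ : Vertex → Kind
    κ x = viewKind (view x)

    not-covered : ∀ {x z} → x ≢ u → x ≢ b → z ≢ u → z ≢ b → ¬ x ~ z
    not-covered x≢u x≢b z≢u z≢b x~z with cover x~z
    ... | inj₁ (inj₁ e) = x≢u e
    ... | inj₁ (inj₂ e) = x≢b e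
    ... | inj₂ (inj₁ e) = z≢u e
    ... | inj₂ (inj₂ e) = z≢b e

    adj⇒joined : ∀ {x z} (v : View x) (w : View z) → x ~ z → Joined (viewKind v) (viewKind w) (x ≢ z)
    adj⇒joined (isU _)              (isU _)              x~z = ~⇒≢ x~z
    adj⇒joined (isU _)              (isB _)              x~z = ~⇒≢ x~z
    adj⇒joined (isB _)              (isU _)              x~z = ~⇒≢ x~z
    adj⇒joined (isB _)              (isB _)              x~z = ~⇒≢ x~z
    adj⇒joined (isU _)              (isLeaf _ _ _ _)     x~z = tt
    adj⇒joined (isB _)              (isLeaf _ _ _ _)     x~z = tt
    adj⇒joined (isU ≡.refl)         (outside _ _ u≁z _)  x~z = u≁z x~z
    adj⇒joined (isB ≡.refl)         (outside _ _ _ b≁z)  x~z = b≁z x~z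
    adj⇒joined (isLeaf _ _ _ _)     (isU _)              x~z = tt
    adj⇒joined (isLeaf _ _ _ _)     (isB _)              x~z = tt
    adj⇒joined (isLeaf p q _ _)     (isLeaf r s _ _)     x~z = not-covered p q r s x~z
    adj⇒joined (isLeaf p q _ _)     (outside r s _ _)    x~z = not-covered p q r s x~z
    adj⇒joined (outside _ _ u≁x _)  (isU ≡.refl)         x~z = u≁x (adj-sym G x~z)
    adj⇒joined (outside _ _ _ b≁x)  (isB ≡.refl)         x~z = b≁x (adj-sym G x~z)
    adj⇒joined (outside p q _ _)    (isLeaf r s _ _)     x~z = not-covered p q r s x~z
    adj⇒joined (outside p q _ _)    (outside r s _ _)    x~z = not-covered p q r s x~z

    joined⇒adj : ∀ {x z} (v : View x) (w : View z) → Joined (viewKind v) (viewKind w) (x ≢ z) → x ~ z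
    joined⇒adj (isU ≡.refl)         (isU ≡.refl)         x≢z = contradiction ≡.refl x≢z
    joined⇒adj (isU ≡.refl)         (isB ≡.refl)         _   = u~b
    joined⇒adj (isB ≡.refl)         (isU ≡.refl)         _   = adj-sym G u~b
    joined⇒adj (isB ≡.refl)         (isB ≡.refl)         x≢z = contradiction ≡.refl x≢z
    joined⇒adj (isU ≡.refl)         (isLeaf _ _ u~z _)   _   = u~z
    joined⇒adj (isB ≡.refl)         (isLeaf _ _ _ b~z)   _   = b~z
    joined⇒adj (isLeaf _ _ u~x _)   (isU ≡.refl)         _   = adj-sym G u~x
    joined⇒adj (isLeaf _ _ _ b~x)   (isB ≡.refl)         _   = adj-sym G b~x
    joined⇒adj (isU _)              (outside _ _ _ _)    ()
    joined⇒adj (isB _)              (outside _ _ _ _)    ()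
    joined⇒adj (isLeaf _ _ _ _)     (isLeaf _ _ _ _)     ()
    joined⇒adj (isLeaf _ _ _ _)     (outside _ _ _ _)    ()
    joined⇒adj (outside _ _ _ _)    _                    ()

    spine-indicator : ∀ {x} (v : View x) → isSpine (viewKind v) ≡ δ u x ℕ.+ δ b x
    spine-indicator (isU ≡.refl)        = ≡.sym (≡.cong₂ ℕ._+_ (δ-refl u) (δ-≢ b u (λ e → u≢b (≡.sym e))))
    spine-indicator (isB ≡.refl)        = ≡.sym (≡.cong₂ ℕ._+_ (δ-≢ u b u≢b) (δ-refl b))
    spine-indicator {x} (isLeaf p q _ _)  = ≡.sym (≡.cong₂ ℕ._+_ (δ-≢ u x (λ e → p (≡.sym e))) (δ-≢ b x (λ e → q (≡.sym e))))
    spine-indicator {x} (outside p q _ _) = ≡.sym (≡.cong₂ ℕ._+_ (δ-≢ u x (λ e → p (≡.sym e))) (δ-≢ b x (λ e → q (≡.sym e))))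

    page-indicator : ∀ {x} (v : View x) → isPage (viewKind v) ≡ pageIndicator x
    page-indicator (isU ≡.refl)            = ≡.sym page-centre
    page-indicator (isB ≡.refl)            = ≡.sym page-b
    page-indicator (isLeaf _ _ u~x b~x)    = ≡.sym (≡.cong₂ ℕ._*_ (a-~ u~x) (a-~ b~x))
    page-indicator {x} (outside _ _ u≁x _) = ≡.sym (≡.cong (ℕ._* a b x) (a-≁ u≁x))

    sorted : ∃ λ z → Sorted κ 2 pageCount z
    sorted = ≡.subst₂ (λ p t → ∃ λ z → Sorted κ p t z)
      (≡.trans (sum-cong-≗ (λ x → spine-indicator (view x))) (≡.trans (∑-distrib-+ (δ u) (δ b)) (≡.cong₂ ℕ._+_ (sum-δ₁ u) (sum-δ₁ b))))
      (sum-cong-≗ (λ x → page-indicator (view x)))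
      (sort κ)

    -- No vertices are added to G, and its own isolated vertices match those added to K₂ ∨ tK₁.
    -- `ground` and `lift` pass between `Fin (order G)` and `Fin (order G + 0)`.
    book⇒iso : G ≅ (K 2 ∨ edgeless pageCount) upToIsolatedVertices
    book⇒iso = 0 , proj₁ sorted , mk↔ₛ′ forward backward forward-backward backward-forward , λ i j → mk⇔ (preserve i j) (reflect i j)
      where
      open Sorted (proj₂ sorted)
      z : ℕ
      z = proj₁ sorted
      open BookGraph pageCount z
      ground : Fin (order G ℕ.+ 0) → Fin (order G)
      ground i = Sum.[ id , (λ ()) ] (splitAt (order G) i)
      lift : Fin (order G) → Fin (order G ℕ.+ 0)
      lift x = x ↑ˡ 0
      ground-lift : ∀ x → ground (lift x) ≡ x
      ground-lift x = ≡.cong Sum.[ id , (λ ()) ] (Fin.splitAt-↑ˡ (order G) x 0)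
      lift-ground : ∀ i → lift (ground i) ≡ i
      lift-ground i with splitAt (order G) i in eq
      ... | inj₁ x = Fin.splitAt⁻¹-↑ˡ eq
      forward : Fin (order G ℕ.+ 0) → Fin (order (bookGraph pageCount z))
      forward i = fill (to (ground i))
      backward : Fin (order (bookGraph pageCount z)) → Fin (order G ℕ.+ 0)
      backward j = lift (from (slot j))
      forward-backward : ∀ j → forward (backward j) ≡ j
      forward-backward j = ≡.trans (≡.cong fill (≡.trans (≡.cong to (ground-lift (from (slot j)))) (to-from (slot j)))) (fill-slot j)
      backward-forward : ∀ i → backward (forward i) ≡ i
      backward-forward i = ≡.trans (≡.cong lift (≡.trans (≡.cong from (slot-fill (to (ground i)))) (from-to (ground i)))) (lift-ground i)
      ground-adj : ∀ i j → Adj (G ∪ edgeless 0) i j ⇔ ground i ~ ground j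
      ground-adj i j with splitAt (order G) i | splitAt (order G) j
      ... | inj₁ _ | inj₁ _ = mk⇔ id id
      same-kind : ∀ i → slotKind (slot (forward i)) ≡ κ (ground i)
      same-kind i = ≡.trans (≡.cong slotKind (slot-fill (to (ground i)))) (kind (ground i))
      Target : Kind → Kind → Fin (order G ℕ.+ 0) → Fin (order G ℕ.+ 0) → Set
      Target k l i j = Joined k l (slot (forward i) ≢ slot (forward j))
      preserve : ∀ i j → Adj (G ∪ edgeless 0) i j → Adj (bookGraph pageCount z) (forward i) (forward j)
      preserve i j i~j = Equivalence.from (bookGraph-adj (forward i) (forward j))
        (≡.subst₂ (λ k l → Target k l i j) (≡.sym (same-kind i)) (≡.sym (same-kind j))
          (joined-map (κ (ground i)) (κ (ground j)) (λ ≢ e → ≢ (≡.trans (≡.sym (ground-back i)) (≡.trans (≡.cong (ground ∘ backward) (slot-injective (forward i) (forward j) e)) (ground-back j))))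
            (adj⇒joined (view (ground i)) (view (ground j)) (Equivalence.to (ground-adj i j) i~j))))
        where
        ground-back : ∀ i → ground (backward (forward i)) ≡ ground i
        ground-back i = ≡.cong ground (backward-forward i)
      reflect : ∀ i j → Adj (bookGraph pageCount z) (forward i) (forward j) → Adj (G ∪ edgeless 0) i j
      reflect i j i~j = Equivalence.from (ground-adj i j) (joined⇒adj (view (ground i)) (view (ground j))
        (joined-map (κ (ground i)) (κ (ground j)) (λ ≢ e → ≢ (≡.cong (slot ∘ fill ∘ to) e))
          (≡.subst₂ (λ k l → Target k l i j) (same-kind i) (same-kind j)
            (Equivalence.to (bookGraph-adj (forward i) (forward j)) i~j))))

  module _ (G : Graph) {t : ℕ} where

    -- The two spine vertices are adjacent, so their preimages are not among the added isolated
    -- vertices and descend to G.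
    iso⇒book : G ≅ (K 2 ∨ edgeless t) upToIsolatedVertices → ∃ λ u → ∃ λ b → IsBook G u b
    iso⇒book (a , z , f , adj) = u , b , record
      { spine  = unlift (≡.subst₂ (Adj H) (≡.sym h-u) (≡.sym h-b) p₀~p₁)
      ; cover  = λ x~z → Sum.map (spine-vertex _) (spine-vertex _) (joined-spine _ _ (joined x~z))
      ; pages  = λ {x} x≢b u~x → same-neighbours kind-b kind-u (λ e → loopless G (≡.subst (Adj G u) e u~x)) x≢b u~x
      ; pages′ = λ {x} x≢u b~x → same-neighbours kind-u kind-b x≢u (λ e → loopless G (≡.subst (Adj G b) e b~x)) b~x
      }
      where
      H : Graph
      H = bookGraph t z
      open BookGraph t z
      p₀ p₁ : Fin (order H)
      p₀ = fill (inj₁ (inj₁ zero))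
      p₁ = fill (inj₁ (inj₁ (suc zero)))
      h : Fin (order G) → Fin (order H)
      h x = Inverse.to f (x ↑ˡ a)
      h-injective : ∀ {x y} → h x ≡ h y → x ≡ y
      h-injective {x} {y} e = Fin.↑ˡ-injective a x y (≡.trans (≡.sym (Inverse.strictlyInverseʳ f (x ↑ˡ a)))
        (≡.trans (≡.cong (Inverse.from f) e) (Inverse.strictlyInverseʳ f (y ↑ˡ a))))
      lift-adj : ∀ x y → Adj G x y ⇔ Adj (G ∪ edgeless a) (x ↑ˡ a) (y ↑ˡ a)
      lift-adj x y with splitAt (order G) (x ↑ˡ a) | Fin.splitAt-↑ˡ (order G) x a | splitAt (order G) (y ↑ˡ a) | Fin.splitAt-↑ˡ (order G) y a
      ... | _ | ≡.refl | _ | ≡.refl = mk⇔ id id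
      lower-adj : ∀ i j → Adj (G ∪ edgeless a) i j → ∃ λ x → ∃ λ y → x ↑ˡ a ≡ i × y ↑ˡ a ≡ j
      lower-adj i j e with splitAt (order G) i in eqⁱ | splitAt (order G) j in eqʲ
      ... | inj₁ x | inj₁ y = x , y , Fin.splitAt⁻¹-↑ˡ eqⁱ , Fin.splitAt⁻¹-↑ˡ eqʲ
      lower-adj i j () | inj₁ _ | inj₂ _
      lower-adj i j () | inj₂ _ | inj₁ _
      lower-adj i j () | inj₂ _ | inj₂ _
      slot-p₀ : slot p₀ ≡ inj₁ (inj₁ zero)
      slot-p₀ = slot-fill (inj₁ (inj₁ zero))
      slot-p₁ : slot p₁ ≡ inj₁ (inj₁ (suc zero))
      slot-p₁ = slot-fill (inj₁ (inj₁ (suc zero)))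
      kind-p₀ : slotKind (slot p₀) ≡ spine
      kind-p₀ = ≡.cong slotKind slot-p₀
      kind-p₁ : slotKind (slot p₁) ≡ spine
      kind-p₁ = ≡.cong slotKind slot-p₁
      p₀~p₁ : Adj H p₀ p₁
      p₀~p₁ = Equivalence.from (bookGraph-adj p₀ p₁)
        (≡.subst₂ (λ k l → Joined k l (slot p₀ ≢ slot p₁)) (≡.sym kind-p₀) (≡.sym kind-p₁)
          (λ e → contradiction (Sum.inj₁-injective (Sum.inj₁-injective (≡.trans (≡.sym slot-p₀) (≡.trans e slot-p₁)))) λ ()))
      spine-edge : ∃ λ x → ∃ λ y → x ↑ˡ a ≡ Inverse.from f p₀ × y ↑ˡ a ≡ Inverse.from f p₁
      spine-edge = lower-adj (Inverse.from f p₀) (Inverse.from f p₁)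
        (Equivalence.from (adj (Inverse.from f p₀) (Inverse.from f p₁))
          (≡.subst₂ (Adj H) (≡.sym (Inverse.strictlyInverseˡ f p₀)) (≡.sym (Inverse.strictlyInverseˡ f p₁)) p₀~p₁))
      u b : Fin (order G)
      u = proj₁ spine-edge
      b = proj₁ (proj₂ spine-edge)
      h-u : h u ≡ p₀
      h-u = ≡.trans (≡.cong (Inverse.to f) (proj₁ (proj₂ (proj₂ spine-edge)))) (Inverse.strictlyInverseˡ f p₀)
      h-b : h b ≡ p₁
      h-b = ≡.trans (≡.cong (Inverse.to f) (proj₂ (proj₂ (proj₂ spine-edge)))) (Inverse.strictlyInverseˡ f p₁)
      joined : ∀ {x y} → Adj G x y → Joined (slotKind (slot (h x))) (slotKind (slot (h y))) (slot (h x) ≢ slot (h y))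
      joined {x} {y} e = Equivalence.to (bookGraph-adj (h x) (h y)) (Equivalence.to (adj (x ↑ˡ a) (y ↑ˡ a)) (Equivalence.to (lift-adj x y) e))
      spine-slot : ∀ (i : Fin (order H)) (s : Slot 2 t z) → slot i ≡ s → slotKind s ≡ spine → i ≡ p₀ ⊎ i ≡ p₁
      spine-slot i (inj₁ (inj₁ zero))       e _ = inj₁ (slot-injective i p₀ (≡.trans e (≡.sym slot-p₀)))
      spine-slot i (inj₁ (inj₁ (suc zero))) e _ = inj₂ (slot-injective i p₁ (≡.trans e (≡.sym slot-p₁)))
      spine-vertex : ∀ x → slotKind (slot (h x)) ≡ spine → x ≡ u ⊎ x ≡ b
      spine-vertex x e with spine-slot (h x) (slot (h x)) ≡.refl e
      ... | inj₁ e₀ = inj₁ (h-injective (≡.trans e₀ (≡.sym h-u)))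
      ... | inj₂ e₁ = inj₂ (h-injective (≡.trans e₁ (≡.sym h-b)))
      unlift : ∀ {x y} → Adj H (h x) (h y) → Adj G x y
      unlift {x} {y} e = Equivalence.from (lift-adj x y) (Equivalence.from (adj (x ↑ˡ a) (y ↑ˡ a)) e)
      kind-u : slotKind (slot (h u)) ≡ spine
      kind-u = ≡.trans (≡.cong (slotKind ∘ slot) h-u) kind-p₀
      kind-b : slotKind (slot (h b)) ≡ spine
      kind-b = ≡.trans (≡.cong (slotKind ∘ slot) h-b) kind-p₁
      page-neighbour : ∀ k {D E} → k ≢ spine → Joined spine k D → Joined spine k E
      page-neighbour spine ≢ _ = contradiction ≡.refl ≢
      page-neighbour page  _ _ = tt
      -- A neighbour outside the spine is a page, and a page is joined to every spine vertex.
      same-neighbours : ∀ {v w x} → slotKind (slot (h v)) ≡ spine → slotKind (slot (h w)) ≡ spine →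
                        x ≢ u → x ≢ b → Adj G w x → Adj G v x
      same-neighbours {v} {w} {x} kv kw x≢u x≢b w~x = unlift (Equivalence.from (bookGraph-adj (h v) (h x))
        (≡.subst (λ k → Joined k κx (slot (h v) ≢ slot (h x))) (≡.sym kv)
          (page-neighbour κx (λ e → Sum.[ x≢u , x≢b ] (spine-vertex x e))
            (≡.subst (λ k → Joined k κx (slot (h w) ≢ slot (h x))) kw (joined w~x)))))
        where
        κx : Kind
        κx = slotKind (slot (h x))

module _ (G : Graph) where

  isBook? : ∀ u b → Dec (IsBook G u b)
  isBook? u b = map′
    (λ (p , q , r , s) → record { spine = p ; cover = λ {x} {z} → q x z ; pages = λ {x} → r x ; pages′ = λ {x} → s x })
    (λ B → let open IsBook B in spine , (λ x z → cover {x} {z}) , (λ x → pages {x}) , (λ x → pages′ {x}))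
    (adj? G u b
      ×-dec Fin.all? (λ x → Fin.all? λ z → adj? G x z →-dec ((x Fin.≟ u ⊎-dec x Fin.≟ b) ⊎-dec (z Fin.≟ u ⊎-dec z Fin.≟ b)))
      ×-dec Fin.all? (λ x → ¬? (x Fin.≟ b) →-dec (adj? G u x →-dec adj? G b x))
      ×-dec Fin.all? (λ x → ¬? (x Fin.≟ u) →-dec (adj? G b x →-dec adj? G u x)))

  -- Decidability is what lets the equality case leave the ¬¬ under which the eigenvector is
  -- analysed.
  hasBook? : Dec (∃ λ u → ∃ λ b → IsBook G u b)
  hasBook? = Fin.any? λ u → Fin.any? (isBook? u)

open import Data.Integer.Base using (+_; _-_)
open import Data.Nat.Base using (_*_; _≤_)

-- From an eigenvector to the bound and its equality case

module EigenvectorAnalysis (O : OrderedRing) where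

  open OrderedRingProperties O renaming (_*_ to _·_; _≤_ to _≼_; _-_ to _⊝_)
  open LambdaBounds O
  open WeightedSums O
  open Weighted O
  open SpectralBound O

  -- An absolute value together with the sign that realises it; since signs are undecidable, it is
  -- obtained only under ¬¬.
  record Modulus (x : Carrier) : Set where
    field
      value : Carrier
      0≤    : 0# ≼ value
      sign  : value ≈ x ⊎ value ≈ - x

    x≤ : x ≼ value
    x≤ with sign
    ... | inj₁ e = ≤-reflexive (sym e)
    ... | inj₂ e = ≤-by (+-nonNeg 0≤ 0≤) (trans (+-congˡ (-‿cong x≈)) (solve 1 (λ v → v :- (:- v) := v :+ v) refl value))
      where
      x≈ : x ≈ - value
      x≈ = trans (solve 1 (λ x → x := :- (:- x)) refl x) (-‿cong (sym e))

    -x≤ : (- x) ≼ value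
    -x≤ with sign
    ... | inj₂ e = ≤-reflexive (sym e)
    ... | inj₁ e = ≤-by (+-nonNeg 0≤ 0≤) (trans (+-congˡ (-‿cong (-‿cong (sym e)))) (solve 1 (λ v → v :- (:- v) := v :+ v) refl value))

  ¬¬-modulus : ∀ x → ¬ ¬ Modulus x
  ¬¬-modulus x k = ≤-total 0# x λ
    { (inj₁ 0≤x) → k record { value = x ; 0≤ = 0≤x ; sign = inj₁ refl }
    ; (inj₂ x≤0) → k record { value = - x ; 0≤ = ≤-respʳ (+-identityˡ (- x)) (≤⇒0≤- x≤0) ; sign = inj₂ refl }
    }

  module _ (G : Graph) (m : ℕ) (8≤m : 8 ≤ m) (size≡m : size G ≡ m) (ρ : Carrier) where

    private
      a : Fin (order G) → Fin (order G) → ℕ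
      a i j = Link.a G i i j

    module _ (1≤ρ : ι 1 ≼ ρ) (m≤ : ι m ≼ ρ · ρ ⊝ ρ + ι 1)
             (x : Fin (order G) → Carrier) (x≉0 : ¬ (∀ i → x i ≈ 0#))
             (eigen : ∀ i → sum (λ j → ι (a i j) · x j) ≈ ρ · x i) where

      large : LargeRoot ρ
      large = record { 1≤L = 1≤ρ ; 7≤L[L-1] = ≤-by (≤⇒0≤- (≤-trans (ι-mono-≤ 8≤m) m≤))
        (solve 1 (λ r → (r :* r :- r) :- :ι 7 := (r :* r :- r :+ :ι 1) :- :ι 8) refl ρ) }

      subeigenvector : (mod : ∀ i → Modulus (x i)) → ∀ u → (∀ j → Modulus.value (mod j) ≼ Modulus.value (mod u)) → Subeigenvector G m ρ u
      subeigenvector mod u max = record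
        { large   = large
        ; y       = y
        ; 0≤y     = λ i → Modulus.0≤ (mod i)
        ; y≤yu    = max
        ; 0<yu    = λ yu≤0 → x≉0 λ i → ≤-antisym
            (≤-trans (Modulus.x≤ (mod i)) (≤-trans (max i) yu≤0))
            (≤-by (≤⇒0≤- (≤-trans (Modulus.-x≤ (mod i)) (≤-trans (max i) yu≤0))) (solve 1 (λ x → x :- :ι 0 := :ι 0 :- (:- x)) refl (x i)))
        ; Ly≤Ay   = Ly≤Ay
        ; degrees = ≡.trans (Handshake.sum-degree≡2size G u) (≡.cong (2 *_) size≡m)
        ; m≤      = m≤
        }
        where
        y : Fin (order G) → Carrier
        y i = Modulus.value (mod i)
        -- With the sign of `x i` fixed, ρ y at i is the eigenvalue sum with that sign, and each
        -- signed term is at most the corresponding term of Ay.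
        Ly≤Ay : ∀ i → ρ · y i ≼ sum (λ j → ι (a i j) · y j)
        Ly≤Ay i with Modulus.sign (mod i)
        ... | inj₁ e = ≤-respˡ (trans (eigen i) (*-congˡ (sym e))) (sum-mono-≤ λ j → *-monoˡ-≤ (0≤ι (a i j)) (Modulus.x≤ (mod j)))
        ... | inj₂ e = ≤-respˡ (begin
                sum (λ j → ι (a i j) · (- x j))
                  ≈⟨ sum-cong (λ j → solve 2 (λ a x → a :* (:- x) := (:- :ι 1) :* (a :* x)) refl (ι (a i j)) (x j)) ⟩
                sum (λ j → (- ι 1) · (ι (a i j) · x j))
                  ≈⟨ sum-*ˡ (- ι 1) (λ j → ι (a i j) · x j) ⟩
                (- ι 1) · sum (λ j → ι (a i j) · x j)
                  ≈⟨ *-congˡ (eigen i) ⟩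
                (- ι 1) · (ρ · x i)
                  ≈⟨ solve 2 (λ r x → (:- :ι 1) :* (r :* x) := r :* (:- x)) refl ρ (x i) ⟩
                ρ · (- x i)
                  ≈⟨ *-congˡ e ⟨
                ρ · y i ∎)
              (sum-mono-≤ λ j → *-monoˡ-≤ (0≤ι (a i j)) (Modulus.-x≤ (mod j)))
          where open ≈-Reasoning

      eigenvalue-bound : (V 5 -free) G → ¬ ¬ ((∃ λ u → ∃ λ b → IsBook G u b) × ρ · ρ ⊝ ρ + ι 1 ≼ ι m)
      eigenvalue-bound free k =
        ¬¬-finite-choice (λ i → ¬¬-modulus (x i)) λ mod →
        -- A maximum needs a vertex to start from. As x is nonzero, it suffices to derive ⊥ from an
        -- arbitrary index `i`.
        x≉0 λ i → ⊥-elim (¬¬-maximum (λ i → Modulus.value (mod i)) i λ (u , max) →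
          let (b , book) , bound = subeigenvector-bound G free (subeigenvector mod u max)
          in k ((u , b , book) , bound))

  record IsExtremalRoot (m : ℕ) (r : Carrier) : Set where
    field
      1≤r : ι 1 ≼ r
      r²≈ : r · r ⊝ r + ι 1 ≈ ι m

  -- From 2r = 1 + s follows 4(r² - r + 1) = s² + 3 = 4m.
  extremalRoot : ∀ {m r s} → 8 ≤ m → r + r ≈ 1# + s → 0# ≼ s → s · s ≈ ι (4 * m) ⊝ ι 3 → IsExtremalRoot m r
  extremalRoot {m} {r} {s} 8≤m r+r≈ 0≤s s²≈ = record { 1≤r = 1≤r ; r²≈ = r²≈ }
    where
    2r≈ : r + r ≈ ι 1 + s
    2r≈ = trans r+r≈ (+-congʳ (sym ι-1))
    -- 29 is 4 · 8 - 3; any bound that makes s at least 1 would serve.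
    29≤s² : ι 29 ≼ s · s
    29≤s² = ≤-respʳ (sym (trans s²≈ (+-congʳ (ι-* 4 m)))) (≤-by (*-nonNeg (0≤ι 4) (≤⇒0≤- (ι-mono-≤ 8≤m)))
      (solve 1 (λ m → (:ι 4 :* m :- :ι 3) :- :ι 29 := :ι 4 :* (m :- :ι 8)) refl (ι m)))
    1≤s : ι 1 ≼ s
    1≤s = <⇒≤ λ s≤1 → pos+nonNeg≉0 (0<ι 27)
      (+-nonNeg (≤⇒0≤- 29≤s²) (*-nonNeg (+-nonNeg (0≤ι 1) 0≤s) (≤⇒0≤- s≤1)))
      (solve 1 (λ s → :ι 28 :+ ((s :* s :- :ι 29) :+ (:ι 1 :+ s) :* (:ι 1 :- s)) := :ι 0) refl s)
    1≤r : ι 1 ≼ r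
    1≤r = 0≤-⇒≤ (*-cancelˡ-nonNeg (0<ι 1) (≤-respʳ
      (trans (+-congʳ (sym 2r≈)) (solve 1 (λ r → (r :+ r) :- :ι 2 := :ι 2 :* (r :- :ι 1)) refl r))
      (≤-respʳ (solve 1 (λ s → s :- :ι 1 := (:ι 1 :+ s) :- :ι 2) refl s) (≤⇒0≤- 1≤s))))
    4z≈0 : ι 4 · (r · r ⊝ r + ι 1 ⊝ ι m) ≈ 0#
    4z≈0 = begin
      ι 4 · (r · r ⊝ r + ι 1 ⊝ ι m)
        ≈⟨ solve 2 (λ r m → :ι 4 :* (r :* r :- r :+ :ι 1 :- m) := (r :+ r) :* (r :+ r) :- :ι 2 :* (r :+ r) :+ :ι 4 :- :ι 4 :* m) refl r (ι m) ⟩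
      (r + r) · (r + r) ⊝ ι 2 · (r + r) + ι 4 ⊝ ι 4 · ι m
        ≈⟨ +-congʳ (+-congʳ (+-cong (*-cong 2r≈ 2r≈) (-‿cong (*-congˡ 2r≈)))) ⟩
      (ι 1 + s) · (ι 1 + s) ⊝ ι 2 · (ι 1 + s) + ι 4 ⊝ ι 4 · ι m
        ≈⟨ solve 2 (λ s m → (:ι 1 :+ s) :* (:ι 1 :+ s) :- :ι 2 :* (:ι 1 :+ s) :+ :ι 4 :- :ι 4 :* m := s :* s :- (:ι 4 :* m :- :ι 3)) refl s (ι m) ⟩
      s · s ⊝ (ι 4 · ι m ⊝ ι 3)
        ≈⟨ +-cong s²≈ (-‿cong (+-congʳ (sym (ι-* 4 m)))) ⟩
      (ι (4 * m) ⊝ ι 3) ⊝ (ι (4 * m) ⊝ ι 3)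
        ≈⟨ -‿inverseʳ (ι (4 * m) ⊝ ι 3) ⟩
      0# ∎
      where open ≈-Reasoning
    r²≈ : r · r ⊝ r + ι 1 ≈ ι m
    r²≈ = ≤-antisym
      (0≤-⇒≤ (*-cancelˡ-nonNeg (0<ι 3) (≤-reflexive (sym (trans
        (solve 2 (λ z m → :ι 4 :* (m :- z) := :- (:ι 4 :* (z :- m))) refl (r · r ⊝ r + ι 1) (ι m))
        (trans (-‿cong 4z≈0) (solve 0 (:- :ι 0 := :ι 0) refl)))))))
      (0≤-⇒≤ (*-cancelˡ-nonNeg (0<ι 3) (≤-reflexive (sym 4z≈0))))

  -- The values of t² - t + 1 at ρ and r differ by (ρ - r)(ρ + r - 1); the second factor is written
  -- 1 + 2(r - 1) + (ρ - r) so that its sign is visible term by term.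
  exceeds-root-absurd : ∀ {m r ρ} → IsExtremalRoot m r → r < ρ → ρ · ρ ⊝ ρ + ι 1 ≼ ι m → ⊥
  exceeds-root-absurd {m} {r} {ρ} R r<ρ bound = pos+nonNeg≉0
    (*-pos 0<ρ-r (+-pos-nonNeg (0<ι 0) (+-nonNeg (+-nonNeg 0≤r-1 0≤r-1) (<⇒≤ 0<ρ-r))))
    (≤⇒0≤- bound)
    (trans (+-congˡ (+-congʳ (sym r²≈)))
      (solve 2 (λ r p → (p :- r) :* (:ι 1 :+ ((r :- :ι 1) :+ (r :- :ι 1) :+ (p :- r))) :+ ((r :* r :- r :+ :ι 1) :- (p :* p :- p :+ :ι 1)) := :ι 0) refl r ρ))
    where
    open IsExtremalRoot R
    0≤r-1 : 0# ≼ r ⊝ ι 1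
    0≤r-1 = ≤⇒0≤- 1≤r
    0<ρ-r : 0# < ρ ⊝ r
    0<ρ-r p = r<ρ (≤-by (≤⇒0≤- p) (solve 2 (λ r p → r :- p := :ι 0 :- (p :- r)) refl r ρ))

  root-mono : ∀ {m r ρ} → IsExtremalRoot m r → r ≼ ρ → ι 1 ≼ ρ × ι m ≼ ρ · ρ ⊝ ρ + ι 1
  root-mono {m} {r} {ρ} R r≤ρ = ≤-trans 1≤r r≤ρ ,
    ≤-respˡ r²≈ (≤-by (*-nonNeg (≤⇒0≤- r≤ρ) (+-nonNeg (0≤ι 1) (+-nonNeg (+-nonNeg 0≤r-1 0≤r-1) (≤⇒0≤- r≤ρ))))
      (solve 2 (λ r p → (p :* p :- p :+ :ι 1) :- (r :* r :- r :+ :ι 1) := (p :- r) :* (:ι 1 :+ ((r :- :ι 1) :+ (r :- :ι 1) :+ (p :- r)))) refl r ρ))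
    where
    open IsExtremalRoot R
    0≤r-1 : 0# ≼ r ⊝ ι 1
    0≤r-1 = ≤⇒0≤- 1≤r

  root-recurrence : ∀ {k r} → IsExtremalRoot (suc (2 * k)) r → r · r ≈ r + ι k · ι 2
  root-recurrence {k} {r} R = trans (solve 1 (λ r → r :* r := (r :* r :- r :+ :ι 1) :+ (r :- :ι 1)) refl r)
    (trans (+-congʳ (trans r²≈ (trans (ι-+ 1 (2 * k)) (+-congˡ (ι-* 2 k)))))
      (solve 2 (λ r k → (:ι 1 :+ :ι 2 :* k) :+ (r :- :ι 1) := r :+ k :* :ι 2) refl r (ι k)))
    where open IsExtremalRoot R

  -- 4m - 3 is formed in ℤ before it is embedded; additivity recovers it as a difference in the
  -- ring.
  additive-difference : ∀ (f : ℤ → Carrier) → (∀ i j → f (i ℤ.+ j) ≈ f i + f j) → f (+ 0) ≈ 0# → f (+ 1) ≈ 1# →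
                        ∀ m n → f (+ m - + n) ≈ ι m ⊝ ι n
  additive-difference f f-+ f-0 f-1 m n = begin
    f (+ m - + n)
      ≈⟨ solve 2 (λ x y → x := (x :+ y) :- y) refl (f (+ m - + n)) (f (+ n)) ⟩
    (f (+ m - + n) + f (+ n)) ⊝ f (+ n)
      ≈⟨ +-cong (sym (f-+ (+ m - + n) (+ n))) (-‿cong (f-ι n)) ⟩
    f ((+ m - + n) ℤ.+ (+ n)) ⊝ ι n
      ≡⟨ ≡.cong (λ z → f z ⊝ ι n) (≡.trans (ℤ.+-assoc (+ m) (ℤ.- (+ n)) (+ n)) (≡.trans (≡.cong (λ k → (+ m) ℤ.+ k) (ℤ.+-inverseˡ (+ n))) (ℤ.+-identityʳ (+ m)))) ⟩
    f (+ m) ⊝ ι n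
      ≈⟨ +-congʳ (f-ι m) ⟩
    ι m ⊝ ι n ∎
    where
    open ≈-Reasoning
    f-ι : ∀ k → f (+ k) ≈ ι k
    f-ι zero    = f-0
    f-ι (suc k) = trans (f-+ (+ 1) (+ k)) (+-cong f-1 (f-ι k))

  module _ (G : Graph) where

    module Extremality (A : Fin (order G) → Fin (order G) → Carrier) (A≈ : ∀ i j → A i j ≈ ι (Link.a G i i j))
                       (m : ℕ) (size≡m : size G ≡ m) (8≤m : 8 ≤ m) (free : (V 5 -free) G)
                       (ρ r : Carrier) (root : IsExtremalRoot m r)
                       (x : Fin (order G) → Carrier) (x≉0 : ¬ (∀ i → x i ≈ 0#))
                       (eigen : ∀ i → sum (λ j → A i j · x j) ≈ ρ · x i) where

      row-sum : ∀ (x : Fin (order G) → Carrier) i → sum (λ j → ι (Link.a G i i j) · x j) ≈ sum (λ j → A i j · x j)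
      row-sum x i = sum-cong λ j → *-congʳ (sym (A≈ i j))

      bound : r ≼ ρ → ¬ ¬ ((∃ λ u → ∃ λ b → IsBook G u b) × ρ · ρ ⊝ ρ + ι 1 ≼ ι m)
      bound r≤ρ = let 1≤ρ , m≤ = root-mono root r≤ρ
                  in eigenvalue-bound G m 8≤m size≡m ρ 1≤ρ m≤ x x≉0 (λ i → trans (row-sum x i) (eigen i)) free

      -- Stability reduces the claim to refuting r < ρ, and the goal ⊥ absorbs the ¬¬ of `bound`.
      ρ≤r : ρ ≼ r
      ρ≤r = ≤-stable λ ρ≰r → bound (<⇒≤ ρ≰r) λ (_ , ρ²≤) → exceeds-root-absurd root ρ≰r ρ²≤

      extremal : ρ ≈ r → ∃ λ t → suc (2 * t) ≡ m × G ≅ (K 2 ∨ edgeless t) upToIsolatedVertices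
      extremal ρ≈r =
        let u , b , book = decidable-stable (hasBook? G) λ none → bound (≤-reflexive (sym ρ≈r)) λ (found , _) → none found
        in BookSpectrum.pageCount G u b book , ≡.trans (BookSpectrum.book-size G u b book) size≡m , BookIso.book⇒iso G u b book

      -- The book's eigenvector makes r an eigenvalue, so maximality gives r ≤ ρ, the converse of
      -- `ρ≤r`.
      attained : (∀ z → ¬ (∀ i → z i ≈ 0#) → (∀ i → sum (λ j → A i j · z j) ≈ r · z i) → r ≼ ρ) →
                 (∃ λ t → suc (2 * t) ≡ m × G ≅ (K 2 ∨ edgeless t) upToIsolatedVertices) → ρ ≈ r
      attained maximal (t , _ , iso) = ≤-antisym ρ≤r (maximal (entry r) nonzero λ i →
          trans (sym (row-sum (entry r) i)) (eigenvector r r²≈ i))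
        where
        found : ∃ λ u → ∃ λ b → IsBook G u b
        found = BookIso.iso⇒book G iso
        u b : Fin (order G)
        u = proj₁ found
        b = proj₁ (proj₂ found)
        book : IsBook G u b
        book = proj₂ (proj₂ found)
        open BookSpectrum G u b book using (pageCount; book-size)
        open BookEigenvector O G u b book using (entry; entry-u; eigenvector)
        r²≈ : r · r ≈ r + ι pageCount · ι 2
        r²≈ = root-recurrence {pageCount} (≡.subst (λ k → IsExtremalRoot k r) (≡.sym (≡.trans book-size size≡m)) root)
        nonzero : ¬ (∀ i → entry r i ≈ 0#)
        nonzero zero-entries = 0<ι 0 (≤-trans (IsExtremalRoot.1≤r root)
          (≤-reflexive (trans (sym (entry-u r)) (zero-entries u))))

-- Specialisation to the reals

open EigenvectorAnalysis ℝ-orderedRing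
open OrderedRingProperties ℝ-orderedRing using (ι; ι-1)

adjacencyMatrix-ι : ∀ G i j → adjacencyMatrix G i j ≃ ι (Link.a G i i j)
adjacencyMatrix-ι G i j with adj? G i j
... | yes _ = ≃-symmetric (ι 1) 1ℝ ι-1
... | no _  = pointwise⇒≃ 0ℝ 0ℝ (λ _ → ≡.refl)

half-root : ∀ m s → 8 ≤ m → s IsSqrtOf fromℤ (+ (4 * m) - + 3) → IsExtremalRoot m (½ℝ *ℝ (1ℝ +ℝ s))
half-root m s 8≤m (0≤s , s²≃) = extremalRoot {m} {½ℝ *ℝ (1ℝ +ℝ s)} {s} 8≤m
  (pointwise⇒≃ (½ℝ *ℝ (1ℝ +ℝ s) +ℝ ½ℝ *ℝ (1ℝ +ℝ s)) (1ℝ +ℝ s) (λ n → half-sum (seq s n))) 0≤s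
  (≃-transitive (s *ℝ s) (fromℤ (+ (4 * m) - + 3)) (ι (4 * m) +ℝ (-ℝ ι 3)) s²≃
    (additive-difference fromℤ fromℤ-+ (pointwise⇒≃ (fromℤ (+ 0)) 0ℝ (λ _ → ≡.refl))
      (pointwise⇒≃ (fromℤ (+ 1)) 1ℝ (λ _ → ≡.refl)) (4 * m) 3))
  where
  half-sum : ∀ q → ½ ℚ.* (1ℚ ℚ.+ q) ℚ.+ ½ ℚ.* (1ℚ ℚ.+ q) ≡ 1ℚ ℚ.+ q
  half-sum = solve 1 (λ q → con ½ :* (con 1ℚ :+ q) :+ con ½ :* (con 1ℚ :+ q) := con 1ℚ :+ q) ≡.refl
    where open ℚ-Solver.+-*-Solver

compare-root : ∀ (G : Graph) (m : ℕ) → size G ≡ m → 8 ≤ m → (V 5 -free) G →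
  ∀ ρ r → IsExtremalRoot m r → IsSpectralRadius G ρ →
  (ρ ≤ℝ r) × (ρ ≃ r ⇔ ∃ λ t → suc (2 * t) ≡ m × G ≅ (K 2 ∨ edgeless t) upToIsolatedVertices)
compare-root G m size≡m 8≤m free ρ r root ((x , x≉0 , eigen) , maximal) =
  ρ≤r , mk⇔ extremal (attained λ z z≉0 z-eigen → maximal r (z , z≉0 , z-eigen))
  where open Extremality G (adjacencyMatrix G) (adjacencyMatrix-ι G) m size≡m 8≤m free ρ r root x x≉0 eigen

theorem1p4 : ∀ (G : Graph) (m : ℕ) → size G ≡ m → 8 ≤ m → (V 5 -free) G →
    ∀ (ρ s : ℝ) → IsSpectralRadius G ρ → s IsSqrtOf fromℤ (+ (4 * m) - + 3) →
    (ρ ≤ℝ ½ℝ *ℝ (1ℝ +ℝ s)) ×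
    (ρ ≃ ½ℝ *ℝ (1ℝ +ℝ s) ⇔
    ∃ λ t → suc (2 * t) ≡ m × G ≅ (K 2 ∨ edgeless t) upToIsolatedVertices)
theorem1p4 G m size≡m 8≤m free ρ s radius sqrt =
  compare-root G m size≡m 8≤m free ρ (½ℝ *ℝ (1ℝ +ℝ s)) (half-root m s 8≤m sqrt) radius
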